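{- (Ordered $3k-3$ Theorem.) Let $G$ be an orderable group and let $S$ be a finite subset of $G$ satisfying $|S^2|\le 3|S|-3$. Then $\langle S\rangle$ is abelian and is generated by a set of at most $3$ elements. Moreover, if $|S|\ge 11$, then one of the following holds: (i) $S$ is a subset of a geometric progression of length at most $2|S|-1$; (ii) $S$ is the union of two geometric progressions with the same ratio, the sum of whose lengths equals $|S|$.
   Context: A group $G$ is orderable if there is a total order $\le$ on $G$ such that $a\le b$ implies $xay\le xby$ for all $a,b,x,y\in G$. For a subset $S$ of a group, $S^2=\{x_1x_2 : x_1,x_2\in S\}$, and $\langle S\rangle$ is the subgroup generated by $S$. A geometric progression of length $l$ and ratio $t$ is a set of the form $\{u,ut,\dots,ut^{l-1}\}$ where $u,t$ are commuting elements of $G$ and $l$ is a positive integer. -}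

module Defs where

open import Level using (Level; _⊔_)
open import Algebra.Bundles using (Group)
open import Data.Nat using (ℕ; zero; suc; _+_; _*_; _≤_; _<_)
open import Data.List using (List; length)
open import Data.Product using (Σ; _×_; ∃)
open import Data.Sum using (_⊎_)
open import Relation.Binary.Core using (Rel)
open import Relation.Binary.Structures using (IsTotalOrder)
open import Relation.Binary.PropositionalEquality using (_≡_)
import Data.List.Membership.Setoid as Mem
import Data.List.Relation.Unary.Unique.Setoid as Uniq

module _ {c ℓ : Level} (G : Group c ℓ) where
  open Group G renaming (Carrier to A)
  open Mem setoid using (_∈_)

  record IsGroupOrder {ℓ₂ : Level} (_≼_ : Rel A ℓ₂) : Set (c ⊔ ℓ ⊔ ℓ₂) where
    field
      isTotalOrder : IsTotalOrder _≈_ _≼_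
      compatible   : ∀ a b x y → a ≼ b → ((x ∙ a) ∙ y) ≼ ((x ∙ b) ∙ y)

  FiniteSubset : List A → Set (c ⊔ ℓ)
  FiniteSubset S = Uniq.Unique setoid S

  data ⟨_⟩ (S : List A) : A → Set (c ⊔ ℓ) where
    gen  : ∀ {x} → x ∈ S → ⟨ S ⟩ x
    one  : ⟨ S ⟩ ε
    mul  : ∀ {x y} → ⟨ S ⟩ x → ⟨ S ⟩ y → ⟨ S ⟩ (x ∙ y)
    inv  : ∀ {x} → ⟨ S ⟩ x → ⟨ S ⟩ (x ⁻¹)
    resp : ∀ {x y} → x ≈ y → ⟨ S ⟩ x → ⟨ S ⟩ y

  InSq : List A → A → Set (c ⊔ ℓ)
  InSq S z = Σ A λ x → Σ A λ y → x ∈ S × y ∈ S × z ≈ x ∙ y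

  SqCard : List A → ℕ → Set (c ⊔ ℓ)
  SqCard S n = Σ (List A) λ ys →
    Uniq.Unique setoid ys × (∀ z → (z ∈ ys → InSq S z) × (InSq S z → z ∈ ys)) × length ys ≡ n

  -- |S²| ≤ 3|S| - 3  (written additively to avoid truncated subtraction)
  SmallDoubling : List A → Set (c ⊔ ℓ)
  SmallDoubling S = Σ ℕ λ n → SqCard S n × (n + 3 ≤ 3 * length S)

  AbelianSpan : List A → Set (c ⊔ ℓ)
  AbelianSpan S = ∀ a b → ⟨ S ⟩ a → ⟨ S ⟩ b → a ∙ b ≈ b ∙ a

  GeneratedByAtMost : ℕ → List A → Set (c ⊔ ℓ)
  GeneratedByAtMost k S = Σ (List A) λ T →
    length T ≤ k × (∀ g → (⟨ S ⟩ g → ⟨ T ⟩ g) × (⟨ T ⟩ g → ⟨ S ⟩ g))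

  pow : A → ℕ → A
  pow t zero    = ε
  pow t (suc i) = pow t i ∙ t

  InGP : A → A → ℕ → A → Set ℓ
  InGP u t l z = Σ ℕ λ i → i < l × z ≈ u ∙ pow t i

  SubsetOfGP : List A → Set (c ⊔ ℓ)
  SubsetOfGP S = Σ A λ u → Σ A λ t → Σ ℕ λ l →
    u ∙ t ≈ t ∙ u × 1 ≤ l × l + 1 ≤ 2 * length S ×
    (∀ s → s ∈ S → InGP u t l s)

  UnionOfTwoGP : List A → Set (c ⊔ ℓ)
  UnionOfTwoGP S = Σ A λ u₁ → Σ A λ u₂ → Σ A λ t → Σ ℕ λ l₁ → Σ ℕ λ l₂ →
    u₁ ∙ t ≈ t ∙ u₁ × u₂ ∙ t ≈ t ∙ u₂ × 1 ≤ l₁ × 1 ≤ l₂ × l₁ + l₂ ≡ length S ×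
    (∀ s → (s ∈ S → InGP u₁ t l₁ s ⊎ InGP u₂ t l₂ s) × (InGP u₁ t l₁ s ⊎ InGP u₂ t l₂ s → s ∈ S))

{-# OPTIONS --safe #-}
-- List S in decreasing order and let Q j be the set of products of two elements of index at least j. By induction from
-- the small elements upwards, |Q j| ≤ 3 (k - j) - 3 makes the elements of index at least j commute and lie in the group
-- generated by three of them: if the next element contributes at most two new products, the coincidences that this
-- forces express everything through two neighbours, and otherwise the inequality passes to the remaining elements.
--
-- The group generated by S is then torsion-free abelian. Solving the relations s i + s j = s l + s h over ℤ and reading
-- the coordinate vectors as numerals in a large base gives a set B of k natural numbers with the same coincidences of
-- sums, such that arithmetic progressions in B come from geometric progressions in S. Normalise B to have minimum 0 and
-- greatest common divisor 1. If its maximum m is at least 2k - 1, consider the set T of the k - 1 residues of B modulo m.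
-- Counting the residues with two lifts in 2B gives |T + T| < 2|T|. By Hamidoune's isoperimetric method T is
-- either an arc for some difference t or is concentrated on the cosets of a proper subgroup, and in both cases counting
-- lifts once more shows that B is the union of two arithmetic progressions with the same difference.
module Submission where

open import Defs
open import Level using (Level)
open import Algebra.Bundles using (Group)
open import Data.Nat using (_≤_)
open import Data.List using (List; length)
open import Data.Product using (_×_)
open import Data.Sum using (_⊎_)
open import Relation.Binary.Core using (Rel)

open import Algebra.Bundles using (AbelianGroup)
open import Algebra.Structures using (IsAbelianGroup)
open import Data.Empty using (⊥; ⊥-elim)
open import Data.Fin using (Fin; toℕ; fromℕ<)
import Data.Fin.Properties as F
open import Data.List using ([]; _∷_; _++_; filter; map; foldr; lookup; tabulate; allFin; upTo; cartesianProduct)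
open import Data.List.Membership.Propositional using (_∈_; find; lose)
open import Data.List.Membership.Propositional.Properties
open import Data.List.Properties using (length-++; length-map; length-tabulate; length-upTo)
open import Data.List.Relation.Unary.All as All using (All; []; _∷_)
open import Data.List.Relation.Unary.AllPairs using (AllPairs; []; _∷_)
open import Data.List.Relation.Unary.Any as Any using (Any; here; there; any?)
import Data.List.Relation.Unary.Any.Properties as AnyP
open import Data.List.Relation.Unary.Unique.Propositional using (Unique)
import Data.List.Relation.Unary.Unique.Propositional.Properties as U
open import Data.Nat as ℕ hiding (_≤_)
open import Data.Nat.Induction using (<-wellFounded)
open import Data.Nat.Properties as ℕP
open import Data.Product using (Σ; ∃; _,_; proj₁; proj₂)
open import Data.Sum as Sum using (inj₁; inj₂; [_,_]′)
open import Data.Unit using (⊤; tt)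
open import Function using (_∘_; id)
open import Induction.WellFounded using (Acc; acc)
open import Relation.Binary.Definitions using (tri<; tri≈; tri>)
open import Relation.Binary.PropositionalEquality as ≡ using (_≡_; _≢_; cong; cong₂; subst)
open import Relation.Nullary using (¬_; Dec; yes; no)
open import Relation.Nullary.Decidable using (_×-dec_; _⊎-dec_; _→-dec_; ¬?; map′; decidable-stable)

-- Since the bound 3|S| - 3 is used without slack, no count may lose an element. In the code the
-- integer set is `bs`, `T` is its set of k - 1 residues, and `B` consists of the residues y both of
-- whose lifts, y and y + m, are sums. The cyclic argument lives on one budget, |T + T| + |B| + 1 ≤
-- 3|T|. As `T` lies in `B`, it gives |T + T| < 2|T|, and every element of `B` outside `T` lowers
-- the bound on |T + T| further. The periodic case needs a supply of such elements: integer sets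
-- satisfy |P + Q| ≥ |P| + |Q| - 1, so two large parts of `T` in cosets of a subgroup overfill the
-- coset of their sum and force elements of `B` there. The integer model must do more than reproduce
-- coincidences of sums. A term u + iτ has to come from a power of one fixed group element, so
-- relations with weights up to 2k are reflected too, and the base of the numerals is chosen above
-- them. Equality in G is not assumed decidable. For products of elements of S it is decided by
-- their positions in the duplicate-free list of S².

-- Linear inequalities over the natural numbers, checked by certificates

module LinearArithmetic where
  open import Data.Nat.Tactic.RingSolver using (solve-∀)
  open import Data.Bool using (Bool; true; T; _∧_)
  open import Data.Bool.Properties using (T-∧)
  open import Function.Bundles using (Equivalence)
  open ≡

  infix 9 #_
  infixl 6 _⊕_
  infixl 7 _⊗_
  data E : Set where
    #_ : ℕ → E
    K : ℕ → E
    s⁺ : E → E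
    _⊕_ : E → E → E
    _⊗_ : ℕ → E → E

  nth : List ℕ → ℕ → ℕ
  nth [] _ = 0
  nth (x ∷ _) zero = x
  nth (_ ∷ xs) (suc i) = nth xs i

  ⟦_⟧ : E → List ℕ → ℕ
  ⟦ # i ⟧ ρ = nth ρ i
  ⟦ K n ⟧ ρ = n
  ⟦ s⁺ e ⟧ ρ = suc (⟦ e ⟧ ρ)
  ⟦ a ⊕ b ⟧ ρ = ⟦ a ⟧ ρ + ⟦ b ⟧ ρ
  ⟦ c ⊗ a ⟧ ρ = c * ⟦ a ⟧ ρ

  private
    unit : ℕ → List ℕ
    unit zero = 1 ∷ []
    unit (suc i) = 0 ∷ unit i

    add : List ℕ → List ℕ → List ℕ
    add [] ys = ys
    add (x ∷ xs) [] = x ∷ xs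
    add (x ∷ xs) (y ∷ ys) = x + y ∷ add xs ys

    NF : Set
    NF = ℕ × List ℕ

    _⊞_ : NF → NF → NF
    (k , xs) ⊞ (l , ys) = k + l , add xs ys

    _⊠_ : ℕ → NF → NF
    c ⊠ (k , xs) = c * k , map (c *_) xs

    nf : E → NF
    nf (# i) = 0 , unit i
    nf (K n) = n , []
    nf (s⁺ e) = (1 , []) ⊞ nf e
    nf (a ⊕ b) = nf a ⊞ nf b
    nf (c ⊗ a) = c ⊠ nf a

    dot : List ℕ → List ℕ → ℕ
    dot [] _ = 0
    dot (_ ∷ _) [] = 0
    dot (c ∷ cs) (x ∷ xs) = c * x + dot cs xs

    val : NF → List ℕ → ℕ
    val (k , cs) ρ = k + dot cs ρ

    r₁ : ∀ a b x p q → (a + b) * x + (p + q) ≡ a * x + p + (b * x + q)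
    r₁ = solve-∀
    r₂ : ∀ c a x p → c * a * x + c * p ≡ c * (a * x + p)
    r₂ = solve-∀
    r₃ : ∀ k l p q → k + l + (p + q) ≡ k + p + (l + q)
    r₃ = solve-∀
    r₄ : ∀ c k p → c * k + c * p ≡ c * (k + p)
    r₄ = solve-∀

    dot-unit : ∀ i ρ → dot (unit i) ρ ≡ nth ρ i
    dot-unit zero [] = refl
    dot-unit zero (x ∷ ρ) = trans (+-identityʳ _) (*-identityˡ x)
    dot-unit (suc i) [] = refl
    dot-unit (suc i) (x ∷ ρ) = dot-unit i ρ

    dot-add : ∀ xs ys ρ → dot (add xs ys) ρ ≡ dot xs ρ + dot ys ρ
    dot-add [] ys ρ = refl
    dot-add (x ∷ xs) [] ρ = sym (+-identityʳ _)
    dot-add (x ∷ xs) (y ∷ ys) [] = refl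
    dot-add (x ∷ xs) (y ∷ ys) (z ∷ ρ) = trans (cong ((x + y) * z +_) (dot-add xs ys ρ)) (r₁ x y z (dot xs ρ) (dot ys ρ))

    dot-scale : ∀ c xs ρ → dot (map (c *_) xs) ρ ≡ c * dot xs ρ
    dot-scale c [] ρ = sym (*-zeroʳ c)
    dot-scale c (x ∷ xs) [] = sym (*-zeroʳ c)
    dot-scale c (x ∷ xs) (z ∷ ρ) = trans (cong (c * x * z +_) (dot-scale c xs ρ)) (r₂ c x z (dot xs ρ))

    ⊞-sound : ∀ a b ρ → val (a ⊞ b) ρ ≡ val a ρ + val b ρ
    ⊞-sound (k , xs) (l , ys) ρ = trans (cong (k + l +_) (dot-add xs ys ρ)) (r₃ k l (dot xs ρ) (dot ys ρ))

    ⊠-sound : ∀ c a ρ → val (c ⊠ a) ρ ≡ c * val a ρ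
    ⊠-sound c (k , xs) ρ = trans (cong (c * k +_) (dot-scale c xs ρ)) (r₄ c k (dot xs ρ))

    nf-sound : ∀ e ρ → val (nf e) ρ ≡ ⟦ e ⟧ ρ
    nf-sound (# i) ρ = dot-unit i ρ
    nf-sound (K n) ρ = +-identityʳ n
    nf-sound (s⁺ e) ρ = trans (⊞-sound (1 , []) (nf e) ρ) (cong suc (nf-sound e ρ))
    nf-sound (a ⊕ b) ρ = trans (⊞-sound (nf a) (nf b) ρ) (cong₂ _+_ (nf-sound a ρ) (nf-sound b ρ))
    nf-sound (c ⊗ a) ρ = trans (⊠-sound c (nf a) ρ) (cong (c *_) (nf-sound a ρ))

  infix 4 _·_≼_
  -- The coefficient is the multiplier of the inequality in a certificate; it is supplied with the
  -- hypothesis and only checked by `refutes`.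
  record Hyp : Set where
    constructor _·_≼_
    field
      coef : ℕ
      lhs rhs : E

  Holds : List ℕ → List Hyp → Set
  Holds ρ [] = ⊤
  Holds ρ ((c · a ≼ b) ∷ hs) = ⟦ a ⟧ ρ ≤ ⟦ b ⟧ ρ × Holds ρ hs

  sumL sumR : List Hyp → NF
  sumL [] = 0 , []
  sumL ((c · a ≼ b) ∷ hs) = (c ⊠ nf a) ⊞ sumL hs
  sumR [] = 0 , []
  sumR ((c · a ≼ b) ∷ hs) = (c ⊠ nf b) ⊞ sumR hs

  sum≤ : ∀ ρ hs → Holds ρ hs → val (sumL hs) ρ ≤ val (sumR hs) ρ
  sum≤ ρ [] _ = z≤n
  sum≤ ρ ((c · a ≼ b) ∷ hs) (p , ps)
    rewrite ⊞-sound (c ⊠ nf a) (sumL hs) ρ | ⊞-sound (c ⊠ nf b) (sumR hs) ρ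
          | ⊠-sound c (nf a) ρ | ⊠-sound c (nf b) ρ | nf-sound a ρ | nf-sound b ρ
    = +-mono-≤ (*-monoʳ-≤ c p) (sum≤ ρ hs ps)

  _≥?ᶜ_ : List ℕ → List ℕ → Bool
  _ ≥?ᶜ [] = true
  [] ≥?ᶜ (y ∷ ys) = (y ≤ᵇ 0) ∧ ([] ≥?ᶜ ys)
  (x ∷ xs) ≥?ᶜ (y ∷ ys) = (y ≤ᵇ x) ∧ (xs ≥?ᶜ ys)

  dot-mono : ∀ xs ys ρ → T (xs ≥?ᶜ ys) → dot ys ρ ≤ dot xs ρ
  dot-mono xs [] ρ _ = z≤n
  dot-mono [] (y ∷ ys) [] _ = z≤n
  dot-mono [] (y ∷ ys) (z ∷ ρ) h with Equivalence.to T-∧ h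
  ... | p , q with ≤ᵇ⇒≤ y 0 p
  ... | z≤n = dot-mono [] ys ρ q
  dot-mono (x ∷ xs) (y ∷ ys) [] _ = z≤n
  dot-mono (x ∷ xs) (y ∷ ys) (z ∷ ρ) h with Equivalence.to T-∧ h
  ... | p , q = +-mono-≤ (*-monoˡ-≤ z (≤ᵇ⇒≤ y x p)) (dot-mono xs ys ρ q)

  -- A Farkas certificate: the weighted sum of the hypotheses is absurd if its left constant is
  -- larger and no left coefficient is smaller, because the variables are natural numbers.
  refutes : List Hyp → Bool
  refutes hs = (proj₁ (sumR hs) <ᵇ proj₁ (sumL hs)) ∧ (proj₂ (sumL hs) ≥?ᶜ proj₂ (sumR hs))

  abstract
    lin⊥ : ∀ ρ hs {_ : T (refutes hs)} → Holds ρ hs → ⊥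
    lin⊥ ρ hs {ok} ps with Equivalence.to T-∧ ok
    ... | p , q = <⇒≱ (+-mono-<-≤ (<ᵇ⇒< _ _ p) (dot-mono (proj₂ (sumL hs)) (proj₂ (sumR hs)) ρ q)) (sum≤ ρ hs ps)

    -- The negated conclusion joins the certificate with weight 1, so the other weights are
    -- normalised to it.
    lin≤ : ∀ ρ a b hs {_ : T (refutes ((1 · s⁺ b ≼ a) ∷ hs))} → Holds ρ hs → ⟦ a ⟧ ρ ≤ ⟦ b ⟧ ρ
    lin≤ ρ a b hs {ok} ps with ⟦ a ⟧ ρ ≤? ⟦ b ⟧ ρ
    ... | yes p = p
    ... | no ¬p = ⊥-elim (lin⊥ ρ ((1 · s⁺ b ≼ a) ∷ hs) {ok} (≰⇒> ¬p , ps))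

-- Decidable subsets of a finite type and their cardinalities

module FiniteSets where
  open ≡
  open LinearArithmetic

  -- A relation instead of a map lets each image be chosen where it is needed. The image of the head
  -- is deleted from `ys`; by injectivity no element of the tail relied on it.
  pigeonhole : ∀ {a b r} {A : Set a} {B : Set b} (R : A → B → Set r) (xs : List A) (ys : List B) → Unique xs →
    (∀ {x} → x ∈ xs → Σ B λ y → y ∈ ys × R x y) →
    (∀ {x x′ y} → x ∈ xs → x′ ∈ xs → R x y → R x′ y → x ≡ x′) →
    length xs ≤ length ys
  pigeonhole R [] ys _ f inj = z≤n
  pigeonhole {B = B} R (x ∷ xs) ys (x∉ ∷ u) f inj with f (here refl)
  ... | y , y∈ , rxy with ∈-∃++ y∈
  ... | as , bs , refl = begin
      suc (length xs)           ≤⟨ s≤s (pigeonhole R xs (as ++ bs) u g (λ p q → inj (there p) (there q))) ⟩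
      suc (length (as ++ bs))   ≡⟨ cong suc (length-++ as) ⟩
      suc (length as + length bs) ≡⟨ sym (+-suc (length as) (length bs)) ⟩
      length as + length (y ∷ bs) ≡⟨ sym (length-++ as) ⟩
      length (as ++ y ∷ bs) ∎
    where
      open ≤-Reasoning
      g : ∀ {x′} → x′ ∈ xs → Σ B λ y′ → y′ ∈ as ++ bs × R x′ y′
      g x′∈ with f (there x′∈)
      ... | y′ , y′∈ , r with ∈-++⁻ as y′∈
      ... | inj₁ p = y′ , ∈-++⁺ˡ p , r
      ... | inj₂ (here refl) = ⊥-elim (All.lookup x∉ x′∈ (inj (here refl) (there x′∈) rxy r))
      ... | inj₂ (there p) = y′ , ∈-++⁺ʳ as p , r

  length-⊆ : ∀ {a} {A : Set a} {xs ys : List A} → Unique xs → (∀ {x} → x ∈ xs → x ∈ ys) → length xs ≤ length ys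
  length-⊆ {xs = xs} {ys} u f = pigeonhole _≡_ xs ys u (λ p → _ , f p , refl) (λ _ _ p q → trans p (sym q))

  -- Membership is any decidable predicate, so equality of sets is a pair of inclusions, and
  -- whatever is transported along it needs its own congruence.
  record DSet (n : ℕ) : Set₁ where
    no-eta-equality
    field
      mem : Fin n → Set
      mem? : ∀ x → Dec (mem x)
  open DSet public

  infix 4 _∈ₛ_ _∉ₛ_ _⊆ₛ_
  _∈ₛ_ _∉ₛ_ : ∀ {n} → Fin n → DSet n → Set
  x ∈ₛ X = mem X x
  x ∉ₛ X = ¬ mem X x

  _⊆ₛ_ : ∀ {n} → DSet n → DSet n → Set
  X ⊆ₛ Y = ∀ {x} → x ∈ₛ X → x ∈ₛ Y

  infixr 6 _∪ₛ_
  infixr 7 _∩ₛ_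
  _∪ₛ_ _∩ₛ_ _∖ₛ_ : ∀ {n} → DSet n → DSet n → DSet n
  (X ∪ₛ Y) .mem x = mem X x ⊎ mem Y x
  (X ∪ₛ Y) .mem? x = mem? X x ⊎-dec mem? Y x
  (X ∩ₛ Y) .mem x = mem X x × mem Y x
  (X ∩ₛ Y) .mem? x = mem? X x ×-dec mem? Y x
  (X ∖ₛ Y) .mem x = mem X x × ¬ mem Y x
  (X ∖ₛ Y) .mem? x = mem? X x ×-dec ¬? (mem? Y x)

  ∁ₛ : ∀ {n} → DSet n → DSet n
  ∁ₛ X .mem x = ¬ mem X x
  ∁ₛ X .mem? x = ¬? (mem? X x)

  fullₛ : ∀ {n} → DSet n
  fullₛ .mem x = ⊤
  fullₛ .mem? x = yes tt

  single : ∀ {n} → Fin n → DSet n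
  single a .mem x = x ≡ a
  single a .mem? x = x F.≟ a

  ofList : ∀ {n} → List (Fin n) → DSet n
  ofList xs .mem x = x ∈ xs
  ofList xs .mem? x = any? (x F.≟_) xs

  elems : ∀ {n} → DSet n → List (Fin n)
  elems X = filter (mem? X) (allFin _)

  ∈-elems⁺ : ∀ {n} (X : DSet n) {x} → x ∈ₛ X → x ∈ elems X
  ∈-elems⁺ X p = ∈-filter⁺ (mem? X) (∈-allFin _) p

  ∈-elems⁻ : ∀ {n} (X : DSet n) {x} → x ∈ elems X → x ∈ₛ X
  ∈-elems⁻ X p = proj₂ (∈-filter⁻ (mem? X) {xs = allFin _} p)

  elems-unique : ∀ {n} (X : DSet n) → Unique (elems X)
  elems-unique X = U.filter⁺ (mem? X) (U.allFin⁺ _)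

  abstract
    card : ∀ {n} → DSet n → ℕ
    card X = length (elems X)

    ∃ₛ? : ∀ {n} (X : DSet n) → Dec (∃ λ x → x ∈ₛ X)
    ∃ₛ? X = F.any? (mem? X)

    ⊆ₛ-dec : ∀ {n} (X Y : DSet n) → Dec (X ⊆ₛ Y)
    ⊆ₛ-dec X Y with F.all? (λ x → mem? X x →-dec mem? Y x)
    ... | yes h = yes λ {x} → h x
    ... | no ¬h = no λ h → ¬h λ x → h {x}

    ⊆ₛ? : ∀ {n} (X Y : DSet n) → (∃ λ x → x ∈ₛ X × x ∉ₛ Y) ⊎ X ⊆ₛ Y
    ⊆ₛ? X Y with ∃ₛ? (X ∖ₛ Y)
    ... | yes (x , p , q) = inj₁ (x , p , q)
    ... | no ¬p = inj₂ λ {x} p → decidable-stable (mem? Y x) λ q → ¬p (x , p , q)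

    card≤elems : ∀ {n} (X : DSet n) → card X ≤ length (elems X)
    card≤elems X = ≤-refl

    elems≤card : ∀ {n} (X : DSet n) → length (elems X) ≤ card X
    elems≤card X = ≤-refl

    card-inj : ∀ {n m} (X : DSet n) (Y : DSet m) (f : Fin n → Fin m) →
      (∀ {x} → x ∈ₛ X → f x ∈ₛ Y) → (∀ {x x′} → x ∈ₛ X → x′ ∈ₛ X → f x ≡ f x′ → x ≡ x′) → card X ≤ card Y
    card-inj X Y f g inj = pigeonhole (λ x y → f x ≡ y) (elems X) (elems Y) (elems-unique X)
      (λ p → _ , ∈-elems⁺ Y (g (∈-elems⁻ X p)) , refl)
      (λ p q r s → inj (∈-elems⁻ X p) (∈-elems⁻ X q) (trans r (sym s)))

    card-mono : ∀ {n} (X Y : DSet n) → X ⊆ₛ Y → card X ≤ card Y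
    card-mono X Y f = card-inj X Y id f (λ _ _ p → p)

    card-cong : ∀ {n} (X Y : DSet n) → X ⊆ₛ Y → Y ⊆ₛ X → card X ≡ card Y
    card-cong X Y f g = ≤-antisym (card-mono X Y f) (card-mono Y X g)

    card-full : ∀ {n} → card (fullₛ {n}) ≡ n
    card-full {n} = ≤-antisym
      (≤-trans (length-⊆ (elems-unique (fullₛ {n})) (λ _ → ∈-allFin _)) (≤-reflexive (length-tabulate {n = n} id)))
      (≤-trans (≤-reflexive (sym (length-tabulate {n = n} id))) (length-⊆ (U.allFin⁺ n) (λ _ → ∈-elems⁺ (fullₛ {n}) tt)))

    card-disjoint : ∀ {n} (X Y Z : DSet n) → X ⊆ₛ Z → Y ⊆ₛ Z → (∀ {x} → x ∈ₛ X → x ∈ₛ Y → ⊥) →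
      card X + card Y ≤ card Z
    card-disjoint X Y Z f g d = ≤-trans (≤-reflexive (sym (length-++ (elems X))))
      (length-⊆ (U.++⁺ (elems-unique X) (elems-unique Y) (λ (p , q) → d (∈-elems⁻ X p) (∈-elems⁻ Y q)))
        (λ p → ∈-elems⁺ Z ([ f ∘ ∈-elems⁻ X , g ∘ ∈-elems⁻ Y ]′ (∈-++⁻ (elems X) p))))

    card-cover : ∀ {n} (X Y Z : DSet n) → (∀ {x} → x ∈ₛ Z → x ∈ₛ X ⊎ x ∈ₛ Y) → card Z ≤ card X + card Y
    card-cover X Y Z f = ≤-trans (length-⊆ (elems-unique Z) g) (≤-reflexive (length-++ (elems X)))
      where
        g : ∀ {x} → x ∈ elems Z → x ∈ elems X ++ elems Y
        g p = [ ∈-++⁺ˡ ∘ ∈-elems⁺ X , ∈-++⁺ʳ (elems X) ∘ ∈-elems⁺ Y ]′ (f (∈-elems⁻ Z p))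

    card-∪∩ : ∀ {n} (X Y : DSet n) → card (X ∪ₛ Y) + card (X ∩ₛ Y) ≡ card X + card Y
    card-∪∩ X Y = ≤-antisym
      (lin≤ (card (X ∪ₛ Y) ∷ card (X ∩ₛ Y) ∷ card X ∷ card Y ∷ card (Y ∖ₛ X) ∷ [])
        (# 0 ⊕ # 1) (# 2 ⊕ # 3) ((1 · # 0 ≼ # 2 ⊕ # 4) ∷ (1 · # 1 ⊕ # 4 ≼ # 3) ∷ [])
        (card-cover X (Y ∖ₛ X) (X ∪ₛ Y) c₁ ,
         card-disjoint (X ∩ₛ Y) (Y ∖ₛ X) Y proj₂ proj₁ (λ (p , _) (_ , q) → q p) , tt))
      (lin≤ (card (X ∪ₛ Y) ∷ card (X ∩ₛ Y) ∷ card X ∷ card Y ∷ card (Y ∖ₛ X) ∷ [])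
        (# 2 ⊕ # 3) (# 0 ⊕ # 1) ((1 · # 2 ⊕ # 4 ≼ # 0) ∷ (1 · # 3 ≼ # 1 ⊕ # 4) ∷ [])
        (card-disjoint X (Y ∖ₛ X) (X ∪ₛ Y) inj₁ (inj₂ ∘ proj₁) (λ p (_ , q) → q p) ,
         card-cover (X ∩ₛ Y) (Y ∖ₛ X) Y c₂ , tt))
      where
        c₁ : ∀ {x} → x ∈ₛ X ∪ₛ Y → x ∈ₛ X ⊎ x ∈ₛ (Y ∖ₛ X)
        c₁ {x} p with mem? X x | p
        ... | yes q | _ = inj₁ q
        ... | no q | inj₁ r = inj₁ r
        ... | no q | inj₂ r = inj₂ (r , q)
        c₂ : ∀ {x} → x ∈ₛ Y → x ∈ₛ X ∩ₛ Y ⊎ x ∈ₛ (Y ∖ₛ X)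
        c₂ {x} p with mem? X x
        ... | yes q = inj₁ (q , p)
        ... | no q = inj₂ (p , q)

    card-∖ : ∀ {n} (X Y : DSet n) → card (X ∩ₛ Y) + card (X ∖ₛ Y) ≡ card X
    card-∖ X Y = ≤-antisym (card-disjoint (X ∩ₛ Y) (X ∖ₛ Y) X proj₁ proj₁ (λ (_ , p) (_ , q) → q p))
      (card-cover (X ∩ₛ Y) (X ∖ₛ Y) X c)
      where
        c : ∀ {x} → x ∈ₛ X → x ∈ₛ X ∩ₛ Y ⊎ x ∈ₛ (X ∖ₛ Y)
        c {x} p with mem? Y x
        ... | yes q = inj₁ (p , q)
        ... | no q = inj₂ (p , q)

    card-∁ : ∀ {n} (X : DSet n) → card X + card (∁ₛ X) ≡ n
    card-∁ {n} X = trans (cong₂ _+_ (card-cong X (fullₛ ∩ₛ X) (tt ,_) proj₂)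
       (card-cong (∁ₛ X) (fullₛ ∖ₛ X) (tt ,_) proj₂)) (trans (card-∖ fullₛ X) card-full)

    card-≥1 : ∀ {n} (X : DSet n) {x} → x ∈ₛ X → 1 ≤ card X
    card-≥1 X p = ∈-length (∈-elems⁺ X p)

    card-≥2 : ∀ {n} (X : DSet n) {x y} → x ∈ₛ X → y ∈ₛ X → x ≢ y → 2 ≤ card X
    card-≥2 X {x} {y} p q ne = length-⊆ {xs = x ∷ y ∷ []} ((ne ∷ []) ∷ [] ∷ []) g
      where
        g : ∀ {z} → z ∈ x ∷ y ∷ [] → z ∈ elems X
        g (here refl) = ∈-elems⁺ X p
        g (there (here refl)) = ∈-elems⁺ X q

    card-≥3 : ∀ {n} (X : DSet n) {x y z} → x ∈ₛ X → y ∈ₛ X → z ∈ₛ X → x ≢ y → x ≢ z → y ≢ z → 3 ≤ card X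
    card-≥3 X {x} {y} {z} p q r xy xz yz = length-⊆ {xs = x ∷ y ∷ z ∷ []} ((xy ∷ xz ∷ []) ∷ (yz ∷ []) ∷ [] ∷ []) g
      where
        g : ∀ {w} → w ∈ x ∷ y ∷ z ∷ [] → w ∈ elems X
        g (here refl) = ∈-elems⁺ X p
        g (there (here refl)) = ∈-elems⁺ X q
        g (there (there (here refl))) = ∈-elems⁺ X r

    card-single : ∀ {n} (a : Fin n) → card (single a) ≡ 1
    card-single a = ≤-antisym (length-⊆ {ys = a ∷ []} (elems-unique (single a)) (λ p → here (∈-elems⁻ (single a) p))) (card-≥1 (single a) refl)

    pick : ∀ {n} (X : DSet n) → 1 ≤ card X → ∃ λ x → x ∈ₛ X
    pick X h = go (elems X) (∈-elems⁻ X) h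
      where
        go : ∀ xs → (∀ {x} → x ∈ xs → x ∈ₛ X) → 1 ≤ length xs → ∃ λ x → x ∈ₛ X
        go (x ∷ _) f _ = x , f (here refl)

    pick₂ : ∀ {n} (X : DSet n) → 2 ≤ card X → ∃ λ x → ∃ λ y → x ∈ₛ X × y ∈ₛ X × x ≢ y
    pick₂ X h = go (elems X) (∈-elems⁻ X) (elems-unique X) h
      where
        go : ∀ xs → (∀ {x} → x ∈ xs → x ∈ₛ X) → Unique xs → 2 ≤ length xs → ∃ λ x → ∃ λ y → x ∈ₛ X × y ∈ₛ X × x ≢ y
        go (x ∷ []) f _ (s≤s ())
        go (x ∷ y ∷ _) f ((ne ∷ _) ∷ _) _ = x , y , f (here refl) , f (there (here refl)) , ne

    pick₃ : ∀ {n} (X : DSet n) → 3 ≤ card X →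
      ∃ λ x → ∃ λ y → ∃ λ z → (x ∈ₛ X × y ∈ₛ X × z ∈ₛ X) × x ≢ y × x ≢ z × y ≢ z
    pick₃ X h = go (elems X) (∈-elems⁻ X) (elems-unique X) h
      where
        go : ∀ xs → (∀ {x} → x ∈ xs → x ∈ₛ X) → Unique xs → 3 ≤ length xs →
          ∃ λ x → ∃ λ y → ∃ λ z → (x ∈ₛ X × y ∈ₛ X × z ∈ₛ X) × x ≢ y × x ≢ z × y ≢ z
        go (x ∷ []) f _ (s≤s ())
        go (x ∷ y ∷ []) f _ (s≤s (s≤s ()))
        go (x ∷ y ∷ z ∷ _) f ((xy ∷ xz ∷ _) ∷ (yz ∷ _) ∷ _) _ =
          x , y , z , (f (here refl) , f (there (here refl)) , f (there (there (here refl)))) , xy , xz , yz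

    -- The device that extracts structure from equality cases: when a count is exact, an inclusion
    -- reverses.
    ⊆-card : ∀ {n} (X Y : DSet n) → X ⊆ₛ Y → card Y ≤ card X → Y ⊆ₛ X
    ⊆-card X Y f h {y} y∈ = decidable-stable (mem? X y) λ y∉ →
      <⇒≱ (≤-trans (≤-reflexive (cong (_+ card X) (sym (card-single y))))
        (card-disjoint (single y) X Y (λ { refl → y∈ }) f (λ { refl q → y∉ q }))) h

    card-strict : ∀ {n} (X Y : DSet n) {y} → X ⊆ₛ Y → y ∈ₛ Y → y ∉ₛ X → card X < card Y
    card-strict X Y f p q = ≰⇒> λ h → q (⊆-card X Y f h p)

    sublists : ∀ {a} {A : Set a} → List A → List (List A)
    sublists [] = [] ∷ []
    sublists (x ∷ xs) = map (x ∷_) (sublists xs) ++ sublists xs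

    -- Makes the search over all subsets finite: each `DSet` has the same elements as some sublist
    -- of `allFin`.
    filter∈sublists : ∀ {a p} {A : Set a} {P : A → Set p} (P? : ∀ x → Dec (P x)) xs → filter P? xs ∈ sublists xs
    filter∈sublists P? [] = here refl
    filter∈sublists P? (x ∷ xs) with P? x
    ... | yes _ = ∈-++⁺ˡ (∈-map⁺ (x ∷_) (filter∈sublists P? xs))
    ... | no _ = ∈-++⁺ʳ (map (x ∷_) (sublists xs)) (filter∈sublists P? xs)

    least : ∀ {a} {A : Set a} (f : A → ℕ) (xs : List A) {y : A} → y ∈ xs → ∃ λ x → x ∈ xs × (∀ {z} → z ∈ xs → f x ≤ f z)
    least f (x ∷ []) _ = x , here refl , λ { (here refl) → ≤-refl }
    least f (x ∷ x′ ∷ xs) _ with least f (x′ ∷ xs) (here refl)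
    ... | y , y∈ , h with ≤-total (f x) (f y)
    ... | inj₁ le = x , here refl , λ { (here refl) → ≤-refl ; (there z∈) → ≤-trans le (h z∈) }
    ... | inj₂ le = y , there y∈ , λ { (here refl) → le ; (there z∈) → h z∈ }

    -- Any family of subsets that only depends on the elements has a member of least weight.
    leastSet : ∀ {n} (C : DSet n → Set) (C? : ∀ X → Dec (C X)) (f : DSet n → ℕ) →
      (∀ {X Y} → X ⊆ₛ Y → Y ⊆ₛ X → C X → C Y) → (∀ {X Y} → X ⊆ₛ Y → Y ⊆ₛ X → f X ≡ f Y) →
      ∀ X₀ → C X₀ → Σ (DSet n) λ M → C M × (∀ X → C X → f M ≤ f X)
    leastSet {n} C C? f C-resp f-resp X₀ c₀ =
      let L , L∈ , h = least (f ∘ ofList) cands (cand X₀ c₀)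
      in ofList L , proj₂ (∈-filter⁻ (C? ∘ ofList) {xs = sublists (allFin n)} L∈) ,
         λ X c → ≤-trans (h (cand X c)) (≤-reflexive (f-resp (∈-elems⁻ X) (∈-elems⁺ X)))
      where
        cands : List (List (Fin n))
        cands = filter (C? ∘ ofList) (sublists (allFin n))
        cand : ∀ X → C X → elems X ∈ cands
        cand X c = ∈-filter⁺ (C? ∘ ofList) (filter∈sublists (mem? X) (allFin n))
          (C-resp {X} {ofList (elems X)} (∈-elems⁺ X) (∈-elems⁻ X) c)

-- Hamidoune's isoperimetric method in a finite abelian group

module Isoperimetry {m : ℕ} (_⊹_ : Fin m → Fin m → Fin m) (o : Fin m) (neg : Fin m → Fin m)
    (isAb : IsAbelianGroup _≡_ _⊹_ o neg) where

  open ≡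
  open LinearArithmetic
  open FiniteSets

  𝔾 : AbelianGroup _ _
  𝔾 = record { isAbelianGroup = isAb }

  open IsAbelianGroup isAb using (assoc; comm; identityˡ; identityʳ; inverseˡ; inverseʳ)
  open import Algebra.Properties.AbelianGroup 𝔾 using (⁻¹-involutive; ∙-cancelʳ; ⁻¹-∙-comm)

  _⊝_ : Fin m → Fin m → Fin m
  x ⊝ y = x ⊹ neg y

  -- Membership in X ⊞ Y, and in a translate, is kept in image form so that introducing it needs no group law.
  infixl 8 _⊞_ _⟫_
  _⊞_ : DSet m → DSet m → DSet m
  (X ⊞ Y) .mem y = ∃ λ x → x ∈ₛ X × ∃ λ z → z ∈ₛ Y × y ≡ x ⊹ z
  (X ⊞ Y) .mem? y = F.any? λ x → mem? X x ×-dec F.any? λ z → mem? Y z ×-dec (y F.≟ x ⊹ z)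

  _⟫_ : DSet m → Fin m → DSet m
  (X ⟫ g) .mem y = ∃ λ x → x ∈ₛ X × y ≡ x ⊹ g
  (X ⟫ g) .mem? y = F.any? λ x → mem? X x ×-dec (y F.≟ x ⊹ g)

  x+g-g : ∀ x g → (x ⊹ g) ⊝ g ≡ x
  x+g-g x g = trans (assoc x g (neg g)) (trans (cong (x ⊹_) (inverseʳ g)) (identityʳ x))

  x-g+g : ∀ x g → (x ⊝ g) ⊹ g ≡ x
  x-g+g x g = trans (assoc x (neg g) g) (trans (cong (x ⊹_) (inverseˡ g)) (identityʳ x))

  x+[y-x] : ∀ x y → x ⊹ (y ⊝ x) ≡ y
  x+[y-x] x y = trans (comm x (y ⊝ x)) (x-g+g y x)

  swapʳ : ∀ x y z → (x ⊹ y) ⊹ z ≡ (x ⊹ z) ⊹ y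
  swapʳ x y z = trans (assoc x y z) (trans (cong (x ⊹_) (comm y z)) (sym (assoc x z y)))

  card-⟫ : ∀ X g → card (X ⟫ g) ≡ card X
  card-⟫ X g = ≤-antisym
    (card-inj (X ⟫ g) X (_⊝ g) (λ { (x , p , refl) → subst (_∈ₛ X) (sym (x+g-g x g)) p }) (λ _ _ → ∙-cancelʳ (neg g) _ _))
    (card-inj X (X ⟫ g) (_⊹ g) (λ p → _ , p , refl) (λ _ _ → ∙-cancelʳ g _ _))

  ⟫-mem : ∀ X g {x} → x ⊹ g ∈ₛ X → x ∈ₛ (X ⟫ neg g)
  ⟫-mem X g {x} p = x ⊹ g , p , sym (x+g-g x g)

  ⟫-mem⁻ : ∀ X g {x} → x ∈ₛ (X ⟫ neg g) → x ⊹ g ∈ₛ X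
  ⟫-mem⁻ X g (y , p , refl) = subst (_∈ₛ X) (sym (x-g+g y g)) p

  ⊞-monoˡ : ∀ {X X′} Y → X ⊆ₛ X′ → X ⊞ Y ⊆ₛ X′ ⊞ Y
  ⊞-monoˡ Y f (x , p , z , q , e) = x , f p , z , q , e

  card-⟫⊞ : ∀ X g Y → card ((X ⟫ g) ⊞ Y) ≡ card (X ⊞ Y)
  card-⟫⊞ X g Y = trans (card-cong ((X ⟫ g) ⊞ Y) ((X ⊞ Y) ⟫ g)
      (λ { (_ , (x , p , refl) , z , q , refl) → x ⊹ z , (x , p , z , q , refl) , swapʳ x g z })
      (λ { (_ , (x , p , z , q , refl) , refl) → x ⊹ g , (x , p , refl) , z , q , swapʳ x z g }))
    (card-⟫ (X ⊞ Y) g)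

  -- The engine of the method. Adding `T` preserves unions, and the sum of an intersection lies in
  -- the intersection of the sums. So a minimiser that overlaps a translate of itself yields a
  -- smaller competitor, unless the translate is the same set.
  submodular : ∀ X Y T → card ((X ∩ₛ Y) ⊞ T) + card ((X ∪ₛ Y) ⊞ T) ≤ card (X ⊞ T) + card (Y ⊞ T)
  submodular X Y T = lin≤ (card ((X ∩ₛ Y) ⊞ T) ∷ card ((X ∪ₛ Y) ⊞ T) ∷ card (X ⊞ T) ∷ card (Y ⊞ T) ∷ card ((X ⊞ T) ∩ₛ (Y ⊞ T)) ∷ card ((X ⊞ T) ∪ₛ (Y ⊞ T)) ∷ [])
    (# 0 ⊕ # 1) (# 2 ⊕ # 3) ((1 · # 0 ≼ # 4) ∷ (1 · # 1 ≼ # 5) ∷ (1 · # 5 ⊕ # 4 ≼ # 2 ⊕ # 3) ∷ [])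
    (card-mono ((X ∩ₛ Y) ⊞ T) ((X ⊞ T) ∩ₛ (Y ⊞ T)) (λ { (x , (p , p′) , z , q , e) → (x , p , z , q , e) , (x , p′ , z , q , e) }) ,
     card-mono ((X ∪ₛ Y) ⊞ T) ((X ⊞ T) ∪ₛ (Y ⊞ T)) (λ { (x , inj₁ p , z , q , e) → inj₁ (x , p , z , q , e) ; (x , inj₂ p , z , q , e) → inj₂ (x , p , z , q , e) }) ,
     ≤-reflexive (card-∪∩ (X ⊞ T) (Y ⊞ T)) , tt)

  negₛ : DSet m → DSet m
  negₛ X .mem x = neg x ∈ₛ X
  negₛ X .mem? x = mem? X (neg x)

  neg-inj : ∀ {x y} → neg x ≡ neg y → x ≡ y
  neg-inj {x} {y} p = trans (sym (⁻¹-involutive x)) (trans (cong neg p) (⁻¹-involutive y))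

  card-neg : ∀ X → card (negₛ X) ≡ card X
  card-neg X = ≤-antisym (card-inj (negₛ X) X neg (λ p → p) (λ _ _ → neg-inj))
    (card-inj X (negₛ X) neg (λ {x} p → subst (_∈ₛ X) (sym (⁻¹-involutive x)) p) (λ _ _ → neg-inj))

  record IsSub (H : DSet m) : Set where
    field
      o∈ : o ∈ₛ H
      sub : ∀ {x y} → x ∈ₛ H → y ∈ₛ H → x ⊝ y ∈ₛ H
    neg∈ : ∀ {x} → x ∈ₛ H → neg x ∈ₛ H
    neg∈ {x} p = subst (_∈ₛ H) (identityˡ (neg x)) (sub o∈ p)
    add : ∀ {x y} → x ∈ₛ H → y ∈ₛ H → x ⊹ y ∈ₛ H
    add {x} {y} p q = subst (λ z → x ⊹ z ∈ₛ H) (⁻¹-involutive y) (sub p (neg∈ q))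

  module Atoms (T : DSet m) (o∈T : o ∈ₛ T) where

    κ : ℕ
    κ = card T

    ⊆⊞ : ∀ X → X ⊆ₛ X ⊞ T
    ⊆⊞ X {x} p = x , p , o , o∈T , sym (identityʳ x)

    card-⊞-∪∩⟫ : ∀ M g → card (M ∪ₛ (M ⟫ g)) + card (M ∩ₛ (M ⟫ g)) ≡ card M + card M
    card-⊞-∪∩⟫ M g = trans (card-∪∩ M (M ⟫ g)) (cong (card M +_) (card-⟫ M g))

    submodular-⟫ : ∀ M g → card ((M ∩ₛ (M ⟫ g)) ⊞ T) + card ((M ∪ₛ (M ⟫ g)) ⊞ T) ≤ card (M ⊞ T) + card (M ⊞ T)
    submodular-⟫ M g = ≤-trans (submodular M (M ⟫ g) T) (≤-reflexive (cong (card (M ⊞ T) +_) (card-⟫⊞ M g T)))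

    card-∩⟫< : ∀ M g {y} → y ∈ₛ (M ⟫ g) → y ∉ₛ M → card (M ∩ₛ (M ⟫ g)) < card M
    card-∩⟫< M g p q = ≤-trans (card-strict (M ∩ₛ (M ⟫ g)) (M ⟫ g) proj₂ p (λ (h , _) → q h)) (≤-reflexive (card-⟫ M g))

    -- The complement of M ⊞ T, reflected: again a set whose sumset with T is not much larger than itself.
    dual : DSet m → DSet m
    dual M = negₛ (∁ₛ (M ⊞ T))

    card-dual : ∀ M → card (M ⊞ T) + card (dual M) ≡ m
    card-dual M = trans (cong (card (M ⊞ T) +_) (card-neg (∁ₛ (M ⊞ T)))) (card-∁ (M ⊞ T))

    -- If n lies in the dual and n + s = - x with x in M, then - n = x + s lies in M + T. So the
    -- dual plus `T` avoids - M.
    card-dual-⊞ : ∀ M → card (dual M ⊞ T) + card M ≤ m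
    card-dual-⊞ M = ≤-trans (≤-reflexive (cong (card (dual M ⊞ T) +_) (sym (card-neg M))))
      (≤-trans (card-disjoint (dual M ⊞ T) (negₛ M) fullₛ (λ _ → tt) (λ _ → tt) disj) (≤-reflexive card-full))
      where
        disj : ∀ {x} → x ∈ₛ dual M ⊞ T → x ∈ₛ negₛ M → ⊥
        disj (n , p , s , s∈ , refl) q = p (neg (n ⊹ s) , q , s , s∈ , eq)
          where
            eq : neg n ≡ neg (n ⊹ s) ⊹ s
            eq = trans (sym (x-g+g (neg n) s)) (cong (_⊹ s) (⁻¹-∙-comm n s))

    -- For x + m₀ and y + m₀ in M, translation by their difference carries m₀ to x - y + m₀, which
    -- therefore lies in M.
    toSub : ∀ M m₀ → m₀ ∈ₛ M → (∀ {x y} → x ∈ₛ M → y ∈ₛ M → M ⟫ (x ⊝ y) ⊆ₛ M) → IsSub (M ⟫ neg m₀)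
    toSub M m₀ m₀∈ h = record
      { o∈ = ⟫-mem M m₀ (subst (_∈ₛ M) (sym (identityˡ m₀)) m₀∈)
      ; sub = λ {x} {y} p q → ⟫-mem M m₀ (h (⟫-mem⁻ M m₀ p) (⟫-mem⁻ M m₀ q) (m₀ , m₀∈ , eq x y)) }
      where
        eq : ∀ x y → (x ⊝ y) ⊹ m₀ ≡ m₀ ⊹ ((x ⊹ m₀) ⊝ (y ⊹ m₀))
        eq x y = trans (comm (x ⊝ y) m₀) (cong (m₀ ⊹_) (sym (begin
          (x ⊹ m₀) ⊹ neg (y ⊹ m₀)       ≡⟨ cong ((x ⊹ m₀) ⊹_) (sym (⁻¹-∙-comm y m₀)) ⟩
          (x ⊹ m₀) ⊹ (neg y ⊹ neg m₀)   ≡⟨ cong ((x ⊹ m₀) ⊹_) (comm (neg y) (neg m₀)) ⟩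
          (x ⊹ m₀) ⊹ (neg m₀ ⊹ neg y)   ≡⟨ sym (assoc (x ⊹ m₀) (neg m₀) (neg y)) ⟩
          ((x ⊹ m₀) ⊹ neg m₀) ⊹ neg y   ≡⟨ cong (_⊹ neg y) (x+g-g x m₀) ⟩
          x ⊹ neg y                     ∎)))
          where open ≡-Reasoning

    -- Without these two exclusions the empty set and the whole group would minimise the excess
    -- trivially.
    Proper : DSet m → Set
    Proper X = 1 ≤ card X × card (X ⊞ T) < m

    Minimal : DSet m → Set₁
    Minimal H = ∀ X → Proper X → card (H ⊞ T) + card X ≤ card (X ⊞ T) + card H

    ⊞-cong : ∀ X Y → X ⊆ₛ Y → Y ⊆ₛ X → card (X ⊞ T) ≡ card (Y ⊞ T)
    ⊞-cong X Y f g = card-cong (X ⊞ T) (Y ⊞ T) (⊞-monoˡ {X} {Y} T f) (⊞-monoˡ {Y} {X} T g)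

    excess : DSet m → ℕ
    excess X = card (X ⊞ T) ∸ card X

    card-excess : ∀ X → card X + excess X ≡ card (X ⊞ T)
    card-excess X = m+[n∸m]≡n (card-mono X (X ⊞ T) (⊆⊞ X))

    module Atom (M : DSet m) (properM : Proper M) (e-min : ∀ X → Proper X → excess M ≤ excess X)
      (card-min : ∀ X → Proper X → excess X ≤ excess M → card M ≤ card X) where

      e : ℕ
      e = excess M

      -- The dual has excess at most e, so as a competitor it has at least |M| elements; and it has
      -- exactly m - |M + T|.
      large : card M + card M + e ≤ m
      large = lin≤ (card M ∷ e ∷ m ∷ card (dual M) ∷ []) (# 0 ⊕ # 0 ⊕ # 1) (# 2)
        ((1 · # 0 ≼ # 3) ∷ (1 · # 0 ⊕ # 1 ⊕ # 3 ≼ # 2) ∷ [])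
        (card-min (dual M) proper-dual
          (lin≤ (excess (dual M) ∷ e ∷ card (dual M) ∷ card M ∷ m ∷ []) (# 0) (# 1)
            ((1 · # 2 ⊕ # 0 ⊕ # 3 ≼ # 4) ∷ (1 · # 4 ≼ # 3 ⊕ # 1 ⊕ # 2) ∷ [])
            (≤-trans (≤-reflexive (cong (_+ card M) (card-excess (dual M)))) (card-dual-⊞ M) , ≤-reflexive (sym dualM) , tt)) ,
         ≤-reflexive dualM , tt)
        where
          dualM : card M + e + card (dual M) ≡ m
          dualM = trans (cong (_+ card (dual M)) (card-excess M)) (card-dual M)
          proper-dual : Proper (dual M)
          proper-dual =
            lin≤ (card (M ⊞ T) ∷ card (dual M) ∷ m ∷ []) (K 1) (# 1) ((1 · s⁺ (# 0) ≼ # 2) ∷ (1 · # 2 ≼ # 0 ⊕ # 1) ∷ [])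
              (proj₂ properM , ≤-reflexive (sym (card-dual M)) , tt) ,
            lin≤ (card (dual M ⊞ T) ∷ card M ∷ m ∷ []) (s⁺ (# 0)) (# 2) ((1 · # 0 ⊕ # 1 ≼ # 2) ∷ (1 · K 1 ≼ # 1) ∷ [])
              (card-dual-⊞ M , proj₁ properM , tt)

      -- If M + g were not inside M, the intersection would be a smaller proper set and so have
      -- larger excess. Submodularity then pushes the excess of the union below e or, when the union
      -- plus `T` is everything, contradicts `large`.
      meet : ∀ g {x} → x ∈ₛ M → x ∈ₛ (M ⟫ g) → M ⟫ g ⊆ₛ M
      meet g {x} x∈ x∈′ {y} y∈ = decidable-stable (mem? M y) contra
        where
          X W : DSet m
          X = M ∩ₛ (M ⟫ g)
          W = M ∪ₛ (M ⟫ g)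
          properX : Proper X
          properX = card-≥1 X (x∈ , x∈′) , ≤-trans (s≤s (card-mono (X ⊞ T) (M ⊞ T) (⊞-monoˡ {X} {M} T proj₁))) (proj₂ properM)
          subm : card X + excess X + card (W ⊞ T) ≤ card M + e + (card M + e)
          subm = subst₂ _≤_ (sym (cong (_+ card (W ⊞ T)) (card-excess X))) (sym (cong₂ _+_ (card-excess M) (card-excess M))) (submodular-⟫ M g)
          contra : y ∉ₛ M → ⊥
          contra y∉ = small⊎large (<-≤-connex (card (W ⊞ T)) m)
            where
              eX : e < excess X
              eX = ≰⇒> λ le → <⇒≱ (card-∩⟫< M g y∈ y∉) (card-min X properX le)
              small⊎large : card (W ⊞ T) < m ⊎ m ≤ card (W ⊞ T) → ⊥
              small⊎large (inj₁ w<) = lin⊥ (card M ∷ e ∷ card X ∷ card W ∷ excess X ∷ excess W ∷ card (W ⊞ T) ∷ [])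
                ((1 · # 2 ⊕ # 4 ⊕ # 6 ≼ # 0 ⊕ # 1 ⊕ (# 0 ⊕ # 1)) ∷ (1 · s⁺ (# 1) ≼ # 4) ∷ (1 · # 1 ≼ # 5) ∷ (1 · # 0 ⊕ # 0 ≼ # 3 ⊕ # 2) ∷ (1 · # 3 ⊕ # 5 ≼ # 6) ∷ [])
                (subm , eX , e-min W (≤-trans (proj₁ properM) (card-mono M W inj₁) , w<) , ≤-reflexive (sym (card-⊞-∪∩⟫ M g)) ,
                 ≤-reflexive (card-excess W) , tt)
              small⊎large (inj₂ w≥) = lin⊥ (card M ∷ e ∷ card X ∷ excess X ∷ m ∷ card (W ⊞ T) ∷ [])
                ((1 · # 2 ⊕ # 3 ⊕ # 5 ≼ # 0 ⊕ # 1 ⊕ (# 0 ⊕ # 1)) ∷ (1 · s⁺ (# 1) ≼ # 3) ∷ (1 · # 4 ≼ # 5) ∷ (1 · # 0 ⊕ # 0 ⊕ # 1 ≼ # 4) ∷ [])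
                (subm , eX , w≥ , large , tt)

      closed : ∀ {x y} → x ∈ₛ M → y ∈ₛ M → M ⟫ (x ⊝ y) ⊆ₛ M
      closed {x} {y} x∈ y∈ = meet (x ⊝ y) x∈ (y , y∈ , sym (x+[y-x] y x))

      subgroup : Σ (DSet m) λ H → IsSub H × Proper H × Minimal H
      subgroup with pick M (proj₁ properM)
      ... | m₀ , m₀∈ = M ⟫ neg m₀ , toSub M m₀ m₀∈ closed ,
          (≤-trans (proj₁ properM) (≤-reflexive (sym (card-⟫ M (neg m₀)))) ,
           ≤-trans (s≤s (≤-reflexive (card-⟫⊞ M (neg m₀) T))) (proj₂ properM)) ,
          λ X c → subst₂ (λ a b → a + card X ≤ card (X ⊞ T) + b) (sym (card-⟫⊞ M (neg m₀) T)) (sym (card-⟫ M (neg m₀)))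
            (lin≤ (card (M ⊞ T) ∷ card X ∷ card (X ⊞ T) ∷ card M ∷ e ∷ excess X ∷ []) (# 0 ⊕ # 1) (# 2 ⊕ # 3)
              ((1 · # 0 ≼ # 3 ⊕ # 4) ∷ (1 · # 4 ≼ # 5) ∷ (1 · # 1 ⊕ # 5 ≼ # 2) ∷ [])
              (≤-reflexive (sym (card-excess M)) , e-min X c , ≤-reflexive (card-excess X) , tt))

    Proper? : ∀ X → Dec (Proper X)
    Proper? X = (1 ≤? card X) ×-dec (card (X ⊞ T) <? m)

    Proper-resp : ∀ {X Y} → X ⊆ₛ Y → Y ⊆ₛ X → Proper X → Proper Y
    Proper-resp {X} {Y} f g (p , q) = ≤-trans p (card-mono X Y f) , ≤-trans (s≤s (≤-reflexive (⊞-cong Y X g f))) q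

    excess-resp : ∀ {X Y} → X ⊆ₛ Y → Y ⊆ₛ X → excess X ≡ excess Y
    excess-resp {X} {Y} f g = cong₂ _∸_ (⊞-cong X Y f g) (card-cong X Y f g)

    minimalSubgroup : ∀ X₀ → Proper X₀ → Σ (DSet m) λ H → IsSub H × Proper H × Minimal H
    minimalSubgroup X₀ c₀ with leastSet Proper Proper? excess (λ {X} {Y} → Proper-resp {X} {Y}) (λ {X} {Y} → excess-resp {X} {Y}) X₀ c₀
    ... | M₁ , c₁ , h₁ with leastSet (λ X → Proper X × excess X ≤ excess M₁) (λ X → Proper? X ×-dec (excess X ≤? excess M₁)) card
          (λ {X} {Y} f g (c , r) → Proper-resp {X} {Y} f g c , ≤-trans (≤-reflexive (excess-resp {Y} {X} g f)) r)
          (λ {X} {Y} f g → card-cong X Y f g) M₁ (c₁ , ≤-refl)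
    ... | M , (c , r) , h = Atom.subgroup M c (λ X c′ → ≤-trans r (h₁ X c′)) (λ X c′ le → h X (c′ , ≤-trans le r))

    -- `dense` leaves fewer than |H| elements of H + T outside `T`; `minimal` will be applied to the
    -- set H + T itself.
    record Periodic : Set₁ where
      field
        H : DSet m
        isSub : IsSub H
        nontrivial : 2 ≤ card H
        proper : card (H ⊞ T) < m
        dense : card (H ⊞ T) + 1 ≤ κ + card H
        minimal : Minimal H

    CauchyDavenport : Set₁
    CauchyDavenport = ∀ X → Proper X → card X + κ ≤ card (X ⊞ T) + 1

    -- Last terms of the runs of difference t in `T`. Their number is the difference between the
    -- sizes of {0, t} + T and `T`, so few ends means a two-element set of small excess.
    ends : Fin m → DSet m
    ends t .mem x = x ∈ₛ T × x ⊹ t ∉ₛ T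
    ends t .mem? x = mem? T x ×-dec ¬? (mem? T (x ⊹ t))

    card-∩-translates : ∀ M (sidon : ∀ g → g ≢ o → card (M ∩ₛ (M ⟫ g)) ≤ 1) x y → x ≢ y → card ((M ⟫ x) ∩ₛ (M ⟫ y)) ≤ 1
    card-∩-translates M sidon x y x≢y = ≤-trans
      (card-inj ((M ⟫ x) ∩ₛ (M ⟫ y)) (M ∩ₛ (M ⟫ (y ⊝ x))) (_⊝ x)
        (λ { ((a , a∈ , refl) , (b , b∈ , e)) → subst (_∈ₛ M) (sym (x+g-g a x)) a∈ ,
               (b , b∈ , trans (cong (_⊝ x) e) (assoc b y (neg x))) })
        (λ _ _ → ∙-cancelʳ (neg x) _ _))
      (sidon (y ⊝ x) λ e → x≢y (sym (trans (sym (x-g+g y x)) (trans (cong (_⊹ x) e) (identityˡ x)))))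

    card-∪-translate : ∀ M U x j → card (U ∩ₛ (M ⟫ x)) ≤ j → card U + card M ≤ card (U ∪ₛ (M ⟫ x)) + j
    card-∪-translate M U x j h = lin≤ (card U ∷ card M ∷ card (U ∪ₛ (M ⟫ x)) ∷ card (U ∩ₛ (M ⟫ x)) ∷ j ∷ card (M ⟫ x) ∷ [])
      (# 0 ⊕ # 1) (# 2 ⊕ # 4) ((1 · # 0 ⊕ # 5 ≼ # 2 ⊕ # 3) ∷ (1 · # 3 ≼ # 4) ∷ (1 · # 1 ≼ # 5) ∷ [])
      (≤-reflexive (sym (card-∪∩ U (M ⟫ x))) , h , ≤-reflexive (sym (card-⟫ M x)) , tt)

    card-∪∩≤ : ∀ (U V W : DSet m) → card ((U ∪ₛ V) ∩ₛ W) ≤ card (U ∩ₛ W) + card (V ∩ₛ W)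
    card-∪∩≤ U V W = card-cover (U ∩ₛ W) (V ∩ₛ W) ((U ∪ₛ V) ∩ₛ W) λ { (inj₁ p , q) → inj₁ (p , q) ; (inj₂ p , q) → inj₂ (p , q) }

    -- Smallest critical sets with at least two elements

    module Critical (κ≥10 : 10 ≤ κ) (κ<m : suc (2 * κ) ≤ m) (CD : CauchyDavenport)
      (M : DSet m) (r≥2 : 2 ≤ card M) (M<m : card (M ⊞ T) < m) (M-crit : card (M ⊞ T) + 1 ≤ card M + κ) (r≤κ : card M ≤ κ)
      (least-crit : ∀ X → 2 ≤ card X → card (X ⊞ T) < m → card (X ⊞ T) + 1 ≤ card X + κ → card M ≤ card X) where

      r : ℕ
      r = card M

      -- The dual is again a competitor; it has two elements because r ≤ κ and 2κ < m.
      -- Cauchy-Davenport for M turns its size m - |M + T| into the bound.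
      large : 2 * r + κ ≤ suc m
      large = lin≤ (r ∷ κ ∷ m ∷ card (M ⊞ T) ∷ card (dual M) ∷ []) (2 ⊗ # 0 ⊕ # 1) (s⁺ (# 2))
        ((1 · # 0 ≼ # 4) ∷ (1 · # 3 ⊕ # 4 ≼ # 2) ∷ (1 · # 0 ⊕ # 1 ≼ # 3 ⊕ K 1) ∷ [])
        (least-crit (dual M)
           (lin≤ (r ∷ κ ∷ m ∷ card (M ⊞ T) ∷ card (dual M) ∷ []) (K 2) (# 4)
              ((1 · # 2 ≼ # 3 ⊕ # 4) ∷ (1 · # 3 ⊕ K 1 ≼ # 0 ⊕ # 1) ∷ (1 · # 0 ≼ # 1) ∷ (1 · s⁺ (2 ⊗ # 1) ≼ # 2) ∷ [])
              (≤-reflexive (sym (card-dual M)) , M-crit , r≤κ , κ<m , tt))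
           (lin≤ (card (dual M ⊞ T) ∷ r ∷ m ∷ []) (s⁺ (# 0)) (# 2) ((1 · # 0 ⊕ # 1 ≼ # 2) ∷ (1 · K 2 ≼ # 1) ∷ [])
              (card-dual-⊞ M , r≥2 , tt))
           (lin≤ (card (dual M ⊞ T) ∷ r ∷ m ∷ card (M ⊞ T) ∷ card (dual M) ∷ κ ∷ []) (# 0 ⊕ K 1) (# 4 ⊕ # 5)
              ((1 · # 0 ⊕ # 1 ≼ # 2) ∷ (1 · # 2 ≼ # 3 ⊕ # 4) ∷ (1 · # 3 ⊕ K 1 ≼ # 1 ⊕ # 5) ∷ [])
              (card-dual-⊞ M , ≤-reflexive (sym (card-dual M)) , M-crit , tt)) ,
         ≤-reflexive (card-dual M) , CD M (≤-trans (s≤s z≤n) r≥2 , M<m) , tt)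

      -- Two common points make the intersection a competitor. If it is smaller than M it is not
      -- critical, and this gain of one contradicts submodularity together with Cauchy-Davenport for
      -- the union, or with `large` if the union plus `T` is everything.
      meet : ∀ g → 2 ≤ card (M ∩ₛ (M ⟫ g)) → M ⟫ g ⊆ₛ M
      meet g two {y} y∈ = decidable-stable (mem? M y) contra
        where
          X W : DSet m
          X = M ∩ₛ (M ⟫ g)
          W = M ∪ₛ (M ⟫ g)
          contra : y ∉ₛ M → ⊥
          contra y∉ = split (<-≤-connex (card (W ⊞ T)) m)
            where
              X-noncrit : card X + κ ≤ card (X ⊞ T)
              X-noncrit = ≤-pred (≤-trans (≰⇒> λ le → <⇒≱ (card-∩⟫< M g y∈ y∉) (least-crit X two
                (≤-trans (s≤s (card-mono (X ⊞ T) (M ⊞ T) (⊞-monoˡ {X} {M} T proj₁))) M<m) le)) (≤-reflexive (+-comm _ 1)))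
              split : card (W ⊞ T) < m ⊎ m ≤ card (W ⊞ T) → ⊥
              split (inj₁ w<) = lin⊥ (r ∷ κ ∷ card X ∷ card W ∷ card (X ⊞ T) ∷ card (W ⊞ T) ∷ card (M ⊞ T) ∷ [])
                ((1 · # 2 ⊕ # 1 ≼ # 4) ∷ (1 · # 3 ⊕ # 1 ≼ # 5 ⊕ K 1) ∷ (1 · # 4 ⊕ # 5 ≼ # 6 ⊕ # 6) ∷ (2 · # 6 ⊕ K 1 ≼ # 0 ⊕ # 1) ∷ (1 · # 0 ⊕ # 0 ≼ # 3 ⊕ # 2) ∷ [])
                (X-noncrit , CD W (≤-trans (s≤s z≤n) (≤-trans r≥2 (card-mono M W inj₁)) , w<) , submodular-⟫ M g , M-crit , ≤-reflexive (sym (card-⊞-∪∩⟫ M g)) , tt)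
              split (inj₂ w≥) = lin⊥ (r ∷ κ ∷ card X ∷ m ∷ card (X ⊞ T) ∷ card (W ⊞ T) ∷ card (M ⊞ T) ∷ [])
                ((1 · # 2 ⊕ # 1 ≼ # 4) ∷ (1 · # 3 ≼ # 5) ∷ (1 · # 4 ⊕ # 5 ≼ # 6 ⊕ # 6) ∷ (2 · # 6 ⊕ K 1 ≼ # 0 ⊕ # 1) ∷ (1 · 2 ⊗ # 0 ⊕ # 1 ≼ s⁺ (# 3)) ∷ (1 · K 2 ≼ # 2) ∷ [])
                (X-noncrit , w≥ , submodular-⟫ M g , M-crit , large , two , tt)

      -- One period g suffices: M and its translate by x - y share x, hence also x + g, so `meet`
      -- applies to every difference.
      periodic : ∀ g → g ≢ o → M ⟫ g ⊆ₛ M → Periodic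
      periodic g g≢o h with pick M (≤-trans (s≤s z≤n) r≥2)
      ... | m₀ , m₀∈ = record
        { H = M ⟫ neg m₀
        ; isSub = toSub M m₀ m₀∈ closed
        ; nontrivial = ≤-trans r≥2 (≤-reflexive (sym (card-⟫ M (neg m₀))))
        ; proper = ≤-trans (s≤s (≤-reflexive (card-⟫⊞ M (neg m₀) T))) M<m
        ; dense = subst₂ (λ a b → a + 1 ≤ κ + b) (sym (card-⟫⊞ M (neg m₀) T)) (sym (card-⟫ M (neg m₀))) (≤-trans M-crit (≤-reflexive (+-comm r κ)))
        ; minimal = λ X c → subst₂ (λ a b → a + card X ≤ card (X ⊞ T) + b) (sym (card-⟫⊞ M (neg m₀) T)) (sym (card-⟫ M (neg m₀)))
            (lin≤ (card (M ⊞ T) ∷ card X ∷ card (X ⊞ T) ∷ r ∷ κ ∷ []) (# 0 ⊕ # 1) (# 2 ⊕ # 3)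
              ((1 · # 0 ⊕ K 1 ≼ # 3 ⊕ # 4) ∷ (1 · # 1 ⊕ # 4 ≼ # 2 ⊕ K 1) ∷ []) (M-crit , CD X c , tt)) }
        where
          closed : ∀ {x y} → x ∈ₛ M → y ∈ₛ M → M ⟫ (x ⊝ y) ⊆ₛ M
          closed {x} {y} x∈ y∈ = meet (x ⊝ y) (card-≥2 (M ∩ₛ (M ⟫ (x ⊝ y)))
            (x∈ , y , y∈ , sym (x+[y-x] y x)) (h (x , x∈ , refl) , y ⊹ g , h (y , y∈ , refl) , trans (cong (_⊹ g) (sym (x+[y-x] y x))) (swapʳ y (x ⊝ y) g))
            λ e → g≢o (trans (sym (trans (cong (_⊝ x) (comm x g)) (x+g-g g x))) (trans (cong (_⊝ x) (sym e)) (inverseʳ x))))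

      -- For M = {a, b}, the translate of `T` by a and that of the ends by b are disjoint parts of M
      -- + T, which has at most κ + 1 elements.
      twoElements : card M ≤ 2 → Σ (Fin m) λ t → t ≢ o × card (ends t) ≤ 1
      twoElements r≤2 with pick₂ M r≥2
      ... | a , b , a∈ , b∈ , a≢b = b ⊝ a , (λ e → a≢b (sym (trans (sym (x-g+g b a)) (trans (cong (_⊹ a) e) (identityˡ a))))) ,
        lin≤ (card (ends (b ⊝ a)) ∷ κ ∷ card (M ⊞ T) ∷ r ∷ card (T ⟫ a) ∷ card (ends (b ⊝ a) ⟫ b) ∷ []) (# 0) (K 1)
          ((1 · # 2 ⊕ K 1 ≼ # 3 ⊕ # 1) ∷ (1 · # 3 ≼ K 2) ∷ (1 · # 4 ⊕ # 5 ≼ # 2) ∷ (1 · # 1 ≼ # 4) ∷ (1 · # 0 ≼ # 5) ∷ [])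
          (M-crit , r≤2 , card-disjoint (T ⟫ a) (ends (b ⊝ a) ⟫ b) (M ⊞ T)
              (λ { (x , x∈ , refl) → a , a∈ , x , x∈ , comm x a }) (λ { (x , (x∈ , _) , refl) → b , b∈ , x , x∈ , comm x b })
              (λ { (x , x∈ , refl) (y , (_ , y∉) , e) → y∉ (subst (_∈ₛ T) (trans (sym (x+g-g x a)) (trans (cong (_⊝ a) e) (assoc y b (neg a)))) x∈) }) ,
           ≤-reflexive (sym (card-⟫ T a)) , ≤-reflexive (sym (card-⟫ (ends (b ⊝ a)) b)) , tt)

      module Sidon (sidon : ∀ g → g ≢ o → card (M ∩ₛ (M ⟫ g)) ≤ 1) where

        meet≤1 : ∀ x y → x ≢ y → card ((M ⟫ x) ∩ₛ (M ⟫ y)) ≤ 1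
        meet≤1 = card-∩-translates M sidon

        -- Successive translates meet the earlier ones in at most 1, 2 and 3 points, so M + T has at
        -- least 4r - 6 elements, against at most r + κ - 1. The bound keeps the union of three
        -- translates of M, plus `T`, from filling a group with more than 2κ elements.
        fourTranslates : ∀ a b c d → a ≢ b → a ≢ c → a ≢ d → b ≢ c → b ≢ d → c ≢ d → a ∈ₛ T → b ∈ₛ T → c ∈ₛ T → d ∈ₛ T →
          3 * r ≤ κ + 5
        fourTranslates a b c d ab ac ad bc bd cd a∈ b∈ c∈ d∈ =
          lin≤ (r ∷ κ ∷ card (M ⊞ T) ∷ card (M ⟫ a) ∷ card U₂ ∷ card U₃ ∷ card U₄ ∷ []) (3 ⊗ # 0) (# 1 ⊕ K 5)
            ((1 · # 2 ⊕ K 1 ≼ # 0 ⊕ # 1) ∷ (1 · # 0 ≼ # 3) ∷ (1 · # 3 ⊕ # 0 ≼ # 4 ⊕ K 1) ∷ (1 · # 4 ⊕ # 0 ≼ # 5 ⊕ K 2) ∷ (1 · # 5 ⊕ # 0 ≼ # 6 ⊕ K 3) ∷ (1 · # 6 ≼ # 2) ∷ [])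
            (M-crit , ≤-reflexive (sym (card-⟫ M a)) ,
             card-∪-translate M (M ⟫ a) b 1 (meet≤1 a b ab) ,
             card-∪-translate M U₂ c 2 h₂ ,
             card-∪-translate M U₃ d 3 (≤-trans (card-∪∩≤ U₂ (M ⟫ c) (M ⟫ d)) (+-mono-≤ (≤-trans (card-∪∩≤ (M ⟫ a) (M ⟫ b) (M ⟫ d)) (+-mono-≤ (meet≤1 a d ad) (meet≤1 b d bd))) (meet≤1 c d cd))) ,
             card-mono U₄ (M ⊞ T) (λ { (inj₁ (inj₁ (inj₁ p))) → up a∈ p ; (inj₁ (inj₁ (inj₂ p))) → up b∈ p ; (inj₁ (inj₂ p)) → up c∈ p ; (inj₂ p) → up d∈ p }) , tt)
          where
            U₂ U₃ U₄ : DSet m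
            U₂ = (M ⟫ a) ∪ₛ (M ⟫ b)
            U₃ = U₂ ∪ₛ (M ⟫ c)
            U₄ = U₃ ∪ₛ (M ⟫ d)
            h₂ : card (U₂ ∩ₛ (M ⟫ c)) ≤ 2
            h₂ = ≤-trans (card-∪∩≤ (M ⟫ a) (M ⟫ b) (M ⟫ c)) (+-mono-≤ (meet≤1 a c ac) (meet≤1 b c bc))
            up : ∀ {g y} → g ∈ₛ T → y ∈ₛ (M ⟫ g) → y ∈ₛ M ⊞ T
            up {g} g∈ (x , x∈ , e) = x , x∈ , g , g∈ , e

        three-r : 3 * r ≤ κ + 5
        three-r = go (elems T) (∈-elems⁻ T) (elems-unique T) (≤-trans κ≥10 (card≤elems T))
          where
            go : ∀ xs → (∀ {x} → x ∈ xs → x ∈ₛ T) → Unique xs → 10 ≤ length xs → 3 * r ≤ κ + 5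
            go (a ∷ b ∷ c ∷ d ∷ _) f ((ab ∷ ac ∷ ad ∷ _) ∷ (bc ∷ bd ∷ _) ∷ (cd ∷ _) ∷ _) _ =
              fourTranslates a b c d ab ac ad bc bd cd (f (here refl)) (f (there (here refl))) (f (there (there (here refl)))) (f (there (there (there (here refl)))))
            go [] f _ ()
            go (_ ∷ []) f _ (s≤s ())
            go (_ ∷ _ ∷ []) f _ (s≤s (s≤s ()))
            go (_ ∷ _ ∷ _ ∷ []) f _ (s≤s (s≤s (s≤s ())))

        -- Of the translates M + x, M + y, M + z, the first two unite to a critical set that meets the third in just two
        -- points, and these would form a critical set smaller than M.
        contradiction : ∀ x y z → x ≢ y → x ≢ z → y ≢ z → x ∈ₛ M → y ∈ₛ M → z ∈ₛ M → 3 ≤ r → ⊥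
        contradiction x y z xy xz yz x∈ y∈ z∈ r≥3 = split (<-≤-connex (card (U ⊞ T)) m)
          where
            Y Z W U I : DSet m
            Y = (M ⟫ x) ∪ₛ (M ⟫ y)
            I = (M ⟫ x) ∩ₛ (M ⟫ y)
            Z = M ⟫ z
            W = Y ∩ₛ Z
            U = Y ∪ₛ Z
            W≥2 : 2 ≤ card W
            W≥2 = card-≥2 W {x ⊹ z} {y ⊹ z} (inj₁ (z , z∈ , comm x z) , (x , x∈ , refl)) (inj₂ (z , z∈ , comm y z) , (y , y∈ , refl))
              (λ e → xy (∙-cancelʳ z _ _ e))
            W≤2 : card W ≤ 2
            W≤2 = ≤-trans (card-∪∩≤ (M ⟫ x) (M ⟫ y) Z) (+-mono-≤ (meet≤1 x z xz) (meet≤1 y z yz))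
            κ≤I : κ ≤ card (I ⊞ T)
            κ≤I = ≤-trans (≤-reflexive (sym (card-⟫ T (x ⊹ y)))) (card-mono (T ⟫ (x ⊹ y)) (I ⊞ T)
              (λ { (s , s∈ , refl) → x ⊹ y , ((y , y∈ , comm x y) , (x , x∈ , refl)) , s , s∈ , comm s (x ⊹ y) }))
            μ : ℕ
            μ = card (M ⊞ T)
            W⊞≤ : card (W ⊞ T) ≤ μ
            W⊞≤ = ≤-trans (card-mono (W ⊞ T) (Z ⊞ T) (⊞-monoˡ {W} {Z} T proj₂)) (≤-reflexive (card-⟫⊞ M z T))
            W⊞ : κ + 2 ≤ card (W ⊞ T)
            W⊞ = ≮⇒≥ λ lt → <⇒≱ (≤-trans (s≤s W≤2) r≥3) (least-crit W W≥2 (≤-trans (s≤s W⊞≤) M<m)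
                   (lin≤ (card (W ⊞ T) ∷ κ ∷ card W ∷ []) (# 0 ⊕ K 1) (# 2 ⊕ # 1) ((1 · s⁺ (# 0) ≼ # 1 ⊕ K 2) ∷ (1 · K 2 ≼ # 2) ∷ []) (lt , W≥2 , tt)))
            Y⊞ : card (I ⊞ T) + card (Y ⊞ T) ≤ μ + μ
            Y⊞ = ≤-trans (submodular (M ⟫ x) (M ⟫ y) T) (≤-reflexive (cong₂ _+_ (card-⟫⊞ M x T) (card-⟫⊞ M y T)))
            U⊞ : card (W ⊞ T) + card (U ⊞ T) ≤ card (Y ⊞ T) + μ
            U⊞ = ≤-trans (submodular Y Z T) (≤-reflexive (cong (card (Y ⊞ T) +_) (card-⟫⊞ M z T)))
            Ycard : r + r ≤ card Y + 1
            Ycard = ≤-trans (≤-reflexive (cong (_+ r) (sym (card-⟫ M x)))) (card-∪-translate M (M ⟫ x) y 1 (meet≤1 x y xy))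
            Ucard : card Y + r ≤ card U + 2
            Ucard = card-∪-translate M Y z 2 W≤2
            split : card (U ⊞ T) < m ⊎ m ≤ card (U ⊞ T) → ⊥
            split (inj₁ u<) = lin⊥ (κ ∷ μ ∷ r ∷ card (I ⊞ T) ∷ card (Y ⊞ T) ∷ card (W ⊞ T) ∷ card (U ⊞ T) ∷ card Y ∷ card U ∷ [])
              ((1 · # 0 ≼ # 3) ∷ (1 · # 3 ⊕ # 4 ≼ # 1 ⊕ # 1) ∷ (1 · # 0 ⊕ K 2 ≼ # 5) ∷ (1 · # 5 ⊕ # 6 ≼ # 4 ⊕ # 1) ∷
               (1 · # 2 ⊕ # 2 ≼ # 7 ⊕ K 1) ∷ (1 · # 7 ⊕ # 2 ≼ # 8 ⊕ K 2) ∷ (1 · # 8 ⊕ # 0 ≼ # 6 ⊕ K 1) ∷ (3 · # 1 ⊕ K 1 ≼ # 2 ⊕ # 0) ∷ [])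
              (κ≤I , Y⊞ , W⊞ , U⊞ , Ycard , Ucard ,
               CD U (≤-trans (≤-trans (s≤s z≤n) W≥2) (card-mono W U λ p → inj₁ (proj₁ p)) , u<) , M-crit , tt)
            split (inj₂ u≥) = lin⊥ (κ ∷ μ ∷ r ∷ card (I ⊞ T) ∷ card (Y ⊞ T) ∷ card (W ⊞ T) ∷ card (U ⊞ T) ∷ m ∷ [])
              ((1 · # 0 ≼ # 3) ∷ (1 · # 3 ⊕ # 4 ≼ # 1 ⊕ # 1) ∷ (1 · # 0 ⊕ K 2 ≼ # 5) ∷ (1 · # 5 ⊕ # 6 ≼ # 4 ⊕ # 1) ∷
               (1 · # 7 ≼ # 6) ∷ (3 · # 1 ⊕ K 1 ≼ # 2 ⊕ # 0) ∷ (1 · s⁺ (2 ⊗ # 0) ≼ # 7) ∷ (1 · 3 ⊗ # 2 ≼ # 0 ⊕ K 5) ∷ [])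
              (κ≤I , Y⊞ , W⊞ , U⊞ , u≥ , M-crit , κ<m , three-r , tt)

      structure : Periodic ⊎ Σ (Fin m) λ t → t ≢ o × card (ends t) ≤ 1
      structure with F.any? (λ g → ¬? (g F.≟ o) ×-dec ⊆ₛ-dec (M ⟫ g) M)
      ... | yes (g , g≢o , h) = inj₁ (periodic g g≢o h)
      ... | no none with card M ≤? 2
      ...   | yes le = inj₂ (twoElements le)
      ...   | no gt with pick₃ M (≰⇒> gt)
      ...     | x , y , z , (x∈ , y∈ , z∈) , xy , xz , yz =
                ⊥-elim (Sidon.contradiction (λ g g≢o → ≤-pred (≰⇒> λ two → none (g , g≢o , meet g two))) x y z xy xz yz x∈ y∈ z∈ (≰⇒> gt))

    module Structure (κ≥10 : 10 ≤ κ) (κ<m : suc (2 * κ) ≤ m) (small : card (T ⊞ T) + 1 ≤ 2 * κ) where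

      T-proper : Proper T
      T-proper = ≤-trans (s≤s z≤n) κ≥10 ,
        lin≤ (card (T ⊞ T) ∷ κ ∷ m ∷ []) (s⁺ (# 0)) (# 2) ((1 · # 0 ⊕ K 1 ≼ 2 ⊗ # 1) ∷ (1 · s⁺ (2 ⊗ # 1) ≼ # 2) ∷ []) (small , κ<m , tt)

      Crit : DSet m → Set
      Crit X = 2 ≤ card X × card (X ⊞ T) < m × card (X ⊞ T) + 1 ≤ card X + κ

      Crit? : ∀ X → Dec (Crit X)
      Crit? X = (2 ≤? card X) ×-dec ((card (X ⊞ T) <? m) ×-dec (card (X ⊞ T) + 1 ≤? card X + κ))

      Crit-resp : ∀ {X Y} → X ⊆ₛ Y → Y ⊆ₛ X → Crit X → Crit Y
      Crit-resp {X} {Y} f g c = subst₂ (λ a b → 2 ≤ a × b < m × b + 1 ≤ a + κ) (card-cong X Y f g) (⊞-cong X Y f g) c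

      T-crit : Crit T
      T-crit = ≤-trans (s≤s (s≤s z≤n)) κ≥10 , proj₂ T-proper , ≤-trans small (≤-reflexive (cong (κ +_) (+-identityʳ κ)))

      Result : Set₁
      Result = Periodic ⊎ (CauchyDavenport × Σ (Fin m) λ t → t ≢ o × card (ends t) ≤ 1)

      critical : CauchyDavenport → (Σ (DSet m) λ M → Crit M × (∀ X → Crit X → card M ≤ card X)) → Result
      critical CD (M , (M≥2 , M< , Mc) , h) =
        [ inj₁ , (λ q → inj₂ (CD , q)) ]′ (Critical.structure κ≥10 κ<m CD M M≥2 M< Mc (h T T-crit) (λ X a b c → h X (a , b , c)))

      -- With at least two elements the minimal subgroup is a period, and comparison with `T` bounds
      -- its holes. With one element its excess is at least κ - 1, and its minimality is the
      -- Cauchy-Davenport inequality for all proper sets.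
      bySubgroup : (Σ (DSet m) λ H → IsSub H × Proper H × Minimal H) → Result
      bySubgroup (H , isSub , (H≥1 , H<) , minH) = split (≤-<-connex 2 (card H))
        where
          κ≤H : κ ≤ card (H ⊞ T)
          κ≤H = card-mono T (H ⊞ T) λ {x} p → o , IsSub.o∈ isSub , x , p , sym (identityˡ x)
          split : 2 ≤ card H ⊎ card H < 2 → Result
          split (inj₁ H≥2) = inj₁ (record { H = H ; isSub = isSub ; nontrivial = H≥2 ; proper = H< ; minimal = minH
            ; dense = lin≤ (card (H ⊞ T) ∷ κ ∷ card H ∷ card (T ⊞ T) ∷ []) (# 0 ⊕ K 1) (# 1 ⊕ # 2)
                ((1 · # 0 ⊕ # 1 ≼ # 3 ⊕ # 2) ∷ (1 · # 3 ⊕ K 1 ≼ 2 ⊗ # 1) ∷ []) (minH T T-proper , small , tt) })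
          split (inj₂ H<2) = critical
            (λ X c → lin≤ (card X ∷ κ ∷ card (X ⊞ T) ∷ card (H ⊞ T) ∷ card H ∷ []) (# 0 ⊕ # 1) (# 2 ⊕ K 1)
              ((1 · # 3 ⊕ # 0 ≼ # 2 ⊕ # 4) ∷ (1 · # 1 ≼ # 3) ∷ (1 · s⁺ (# 4) ≼ K 2) ∷ []) (minH X c , κ≤H , H<2 , tt))
            (leastSet Crit Crit? card (λ {X} {Y} → Crit-resp {X} {Y}) (λ {X} {Y} → card-cong X Y) T T-crit)

      structure : Result
      structure = bySubgroup (minimalSubgroup T T-proper)

-- Cosets of a subgroup and the periodic case

module Periodicity {m : ℕ} (_⊹_ : Fin m → Fin m → Fin m) (o : Fin m) (neg : Fin m → Fin m)
    (isAb : IsAbelianGroup _≡_ _⊹_ o neg) where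

  open ≡
  open LinearArithmetic
  open FiniteSets
  open Isoperimetry _⊹_ o neg isAb
  open IsAbelianGroup isAb using (assoc; comm; identityˡ; identityʳ; inverseʳ)
  open import Algebra.Properties.AbelianGroup 𝔾 using (⁻¹-involutive; ∙-cancelʳ; ⁻¹-∙-comm)

  module Cosets (H : DSet m) (isSub : IsSub H) where
    open IsSub isSub

    η : ℕ
    η = card H

    infix 4 _~_ _~?_
    _~_ : Fin m → Fin m → Set
    x ~ y = x ⊝ y ∈ₛ H

    _~?_ : ∀ x y → Dec (x ~ y)
    x ~? y = mem? H (x ⊝ y)

    ~-refl : ∀ {x} → x ~ x
    ~-refl {x} = subst (_∈ₛ H) (sym (inverseʳ x)) o∈

    neg-⊝ : ∀ x y → neg (x ⊝ y) ≡ y ⊝ x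
    neg-⊝ x y = trans (sym (⁻¹-∙-comm x (neg y))) (trans (comm _ _) (cong (_⊝ x) (⁻¹-involutive y)))

    ~-sym : ∀ {x y} → x ~ y → y ~ x
    ~-sym {x} {y} p = subst (_∈ₛ H) (neg-⊝ x y) (neg∈ p)

    ⊝-⊹-⊝ : ∀ x y z → (x ⊝ y) ⊹ (y ⊝ z) ≡ x ⊝ z
    ⊝-⊹-⊝ x y z = trans (sym (assoc (x ⊝ y) y (neg z))) (cong (_⊝ z) (x-g+g x y))

    ~-trans : ∀ {x y z} → x ~ y → y ~ z → x ~ z
    ~-trans {x} {y} {z} p q = subst (_∈ₛ H) (⊝-⊹-⊝ x y z) (add p q)

    ⊹-⊝-⊹ : ∀ x y z w → (x ⊝ z) ⊹ (y ⊝ w) ≡ (x ⊹ y) ⊝ (z ⊹ w)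
    ⊹-⊝-⊹ x y z w = begin
      (x ⊹ neg z) ⊹ (y ⊹ neg w) ≡⟨ sym (assoc (x ⊝ z) y (neg w)) ⟩
      ((x ⊹ neg z) ⊹ y) ⊹ neg w ≡⟨ cong (_⊹ neg w) (swapʳ x (neg z) y) ⟩
      ((x ⊹ y) ⊹ neg z) ⊹ neg w ≡⟨ assoc (x ⊹ y) (neg z) (neg w) ⟩
      (x ⊹ y) ⊹ (neg z ⊹ neg w) ≡⟨ cong ((x ⊹ y) ⊹_) (⁻¹-∙-comm z w) ⟩
      (x ⊹ y) ⊹ neg (z ⊹ w) ∎
      where open ≡-Reasoning

    ~-+ : ∀ {x y z w} → x ~ z → y ~ w → x ⊹ y ~ z ⊹ w
    ~-+ {x} {y} {z} {w} p q = subst (_∈ₛ H) (⊹-⊝-⊹ x y z w) (add p q)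

    ~-+ˡ : ∀ x {y w} → y ~ w → x ⊹ y ~ x ⊹ w
    ~-+ˡ x = ~-+ ~-refl

    ~-+ʳ : ∀ {x z} y → x ~ z → x ⊹ y ~ z ⊹ y
    ~-+ʳ y p = ~-+ p ~-refl

    ~-≡ : ∀ {x y} → x ≡ y → x ~ y
    ~-≡ refl = ~-refl

    ⊝o : ∀ x → x ⊝ o ≡ x
    ⊝o x = trans (cong (_⊝ o) (sym (identityʳ x))) (x+g-g x o)

    ∈H⇒~o : ∀ {x} → x ∈ₛ H → x ~ o
    ∈H⇒~o {x} = subst (_∈ₛ H) (sym (⊝o x))

    ~o⇒∈H : ∀ {x} → x ~ o → x ∈ₛ H
    ~o⇒∈H {x} = subst (_∈ₛ H) (⊝o x)

    coset : Fin m → DSet m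
    coset a .mem x = x ~ a
    coset a .mem? x = x ~? a

    card-coset : ∀ a → card (coset a) ≡ η
    card-coset a = ≤-antisym (card-inj (coset a) H (_⊝ a) (λ p → p) (λ _ _ → ∙-cancelʳ (neg a) _ _))
      (card-inj H (coset a) (_⊹ a) (λ {x} p → subst (_∈ₛ H) (sym (x+g-g x a)) p) (λ _ _ → ∙-cancelʳ a _ _))

    Saturated : DSet m → Set
    Saturated X = ∀ {x y} → x ∈ₛ X → y ~ x → y ∈ₛ X

    card-multiple : ∀ X → Saturated X → ∃ λ u → card X ≡ u * η
    card-multiple X = go X (<-wellFounded (card X))
      where
        go : ∀ X → Acc _<_ (card X) → Saturated X → ∃ λ u → card X ≡ u * η
        go X (acc rec) sat with ∃ₛ? X
        ... | no none = 0 , n≤0⇒n≡0 (≮⇒≥ λ h → none (pick X h))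
        ... | yes (a , a∈) with go (X ∖ₛ coset a) (rec smaller) (λ (p , q) r → sat p r , λ s → q (~-trans (~-sym r) s))
          where
            smaller : card (X ∖ₛ coset a) < card X
            smaller = card-strict (X ∖ₛ coset a) X proj₁ a∈ (λ (_ , q) → q ~-refl)
        ... | u , eq = suc u , trans (sym (card-∖ X (coset a))) (cong₂ _+_
                (trans (card-cong (X ∩ₛ coset a) (coset a) proj₂ (λ p → sat a∈ p , p)) (card-coset a)) eq)

  module PeriodicCase (T B : DSet m) (o∈T : o ∈ₛ T) (T⊆B : T ⊆ₛ B)
    (κ≥10 : 10 ≤ card T) (κ<m : suc (2 * card T) ≤ m)
    (budget : card (T ⊞ T) + card B + 1 ≤ 3 * card T)
    (rows : ∀ P Q → P ⊆ₛ T → Q ⊆ₛ T → 1 ≤ card P → 1 ≤ card Q → card P + card Q ≤ 1 + card (P ⊞ Q) + card (B ∩ₛ (P ⊞ Q)))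
    (generates : ∀ H → IsSub H → card H < m → ∃ λ x → x ∈ₛ T × x ∉ₛ H)
    (per : Atoms.Periodic T o∈T) where

    open Atoms T o∈T
    open Periodic per
    open IsSub isSub
    open Cosets H isSub

    -- Sums of two elements of `T` fall into the classes of 0, a and 2a, which these conditions make
    -- distinct. This is what will split the integer set.
    record TwoClasses : Set₁ where
      field
        V : DSet m
        V-sub : IsSub V
        a : Fin m
        a∈T : a ∈ₛ T
        a∉V : a ∉ₛ V
        a+a∉V : a ⊹ a ∉ₛ V
        classes : ∀ {x} → x ∈ₛ T → x ∈ₛ V ⊎ x ⊝ a ∈ₛ V

    -- `D` is the part of `B` that weighs on the budget beyond `T`: each element of it lowers the
    -- bound on |T + T| by one.
    HT TT HTT D : DSet m
    HT = H ⊞ T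
    TT = T ⊞ T
    HTT .mem y = ∃ λ x → x ∈ₛ TT × y ~ x
    HTT .mem? y = F.any? λ x → mem? TT x ×-dec (y ~? x)
    D = B ∖ₛ T

    σ hn : ℕ
    σ = card HT
    hn = card (HT ∖ₛ T)

    ∈HT : ∀ {x y} → x ∈ₛ T → y ~ x → y ∈ₛ HT
    ∈HT {x} {y} p q = y ⊝ x , q , x , p , sym (x-g+g y x)

    HT∈ : ∀ {y} → y ∈ₛ HT → ∃ λ x → x ∈ₛ T × y ~ x
    HT∈ (h , h∈ , x , x∈ , refl) = x , x∈ , subst (_∈ₛ H) (sym (x+g-g h x)) h∈

    σ≡ : κ + hn ≡ σ
    σ≡ = trans (cong (_+ hn) (card-cong T (HT ∩ₛ T) (λ p → ∈HT p ~-refl , p) proj₂)) (card-∖ HT T)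

    hn<η : suc hn ≤ η
    hn<η = lin≤ (hn ∷ η ∷ κ ∷ σ ∷ []) (s⁺ (# 0)) (# 1) ((1 · # 3 ⊕ K 1 ≼ # 2 ⊕ # 1) ∷ (1 · # 2 ⊕ # 0 ≼ # 3) ∷ [])
      (dense , ≤-reflexive σ≡ , tt)

    card-B : card B ≡ κ + card D
    card-B = trans (sym (card-∖ B T)) (cong (_+ card D) (card-cong (B ∩ₛ T) T proj₂ (λ p → T⊆B p , p)))

    budget′ : card TT + card D + 1 ≤ 2 * κ
    budget′ = lin≤ (card TT ∷ card D ∷ κ ∷ card B ∷ []) (# 0 ⊕ # 1 ⊕ K 1) (2 ⊗ # 2) ((1 · # 0 ⊕ # 3 ⊕ K 1 ≼ 3 ⊗ # 2) ∷ (1 · # 2 ⊕ # 1 ≼ # 3) ∷ [])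
      (budget , ≤-reflexive (sym card-B) , tt)

    row : Fin m → DSet m
    row a = T ∩ₛ coset a

    α hole : Fin m → ℕ
    α a = card (row a)
    hole a = card (coset a ∖ₛ T)

    α+hole : ∀ a → α a + hole a ≡ η
    α+hole a = trans (cong (_+ hole a) (card-cong (row a) (coset a ∩ₛ T) (λ (p , q) → q , p) (λ (p , q) → q , p))) (trans (card-∖ (coset a) T) (card-coset a))

    hole-cong : ∀ {a b} → a ~ b → hole a ≡ hole b
    hole-cong {a} {b} p = card-cong (coset a ∖ₛ T) (coset b ∖ₛ T) (λ (q , r) → ~-trans q p , r) (λ (q , r) → ~-trans q (~-sym p) , r)

    hole≤ : ∀ {a} → a ∈ₛ T → hole a ≤ hn
    hole≤ {a} a∈ = card-mono (coset a ∖ₛ T) (HT ∖ₛ T) (λ (p , q) → ∈HT a∈ p , q)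

    -- Different cosets draw on one stock of fewer than η holes, so two of them cannot both be half
    -- empty.
    hole+hole≤ : ∀ {a b} → a ∈ₛ T → b ∈ₛ T → ¬ a ~ b → hole a + hole b ≤ hn
    hole+hole≤ {a} {b} a∈ b∈ a≁b = card-disjoint (coset a ∖ₛ T) (coset b ∖ₛ T) (HT ∖ₛ T)
      (λ (p , q) → ∈HT a∈ p , q) (λ (p , q) → ∈HT b∈ p , q) (λ (p , _) (q , _) → a≁b (~-trans (~-sym p) q))

    -- The row of x and the reflection of the row of y through w lie in one coset and have more than
    -- η elements together, so they meet.
    full : ∀ {x y w} → suc η ≤ α x + α y → w ~ x ⊹ y → w ∈ₛ TT
    full {x} {y} {w} big w~ with ∃ₛ? (row x ∩ₛ R)
      where
        R : DSet m
        R .mem u = w ⊝ u ∈ₛ row y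
        R .mem? u = mem? (row y) (w ⊝ u)
    ... | yes (u , (u∈ , _) , (v∈ , _)) = u , u∈ , w ⊝ u , v∈ , sym (x+[y-x] u w)
    ... | no none = ⊥-elim (<⇒≱ big (≤-trans (+-monoʳ-≤ (α x) R≥) (≤-trans (card-disjoint (row x) R (coset x) proj₂ R⊆ (λ {u} p q → none (u , p , q))) (≤-reflexive (card-coset x)))))
      where
        R : DSet m
        R .mem u = w ⊝ u ∈ₛ row y
        R .mem? u = mem? (row y) (w ⊝ u)
        w-[w-z] : ∀ z → w ⊝ (w ⊝ z) ≡ z
        w-[w-z] z = trans (cong (w ⊹_) (neg-⊝ w z)) (x+[y-x] w z)
        R≥ : α y ≤ card R
        R≥ = card-inj (row y) R (w ⊝_) (λ {z} p → subst (_∈ₛ row y) (sym (w-[w-z] z)) p)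
          (λ {z} {z′} _ _ e → trans (sym (w-[w-z] z)) (trans (cong (w ⊝_) e) (w-[w-z] z′)))
        R⊆ : R ⊆ₛ coset x
        R⊆ {u} (_ , q) = subst (_~ x) (w-[w-z] u) (subst (_∈ₛ H) (begin
            (w ⊝ (x ⊹ y)) ⊝ ((w ⊝ u) ⊝ y)   ≡⟨ cong ((w ⊝ (x ⊹ y)) ⊹_) (neg-⊝ (w ⊝ u) y) ⟩
            (w ⊝ (x ⊹ y)) ⊹ (y ⊝ (w ⊝ u))   ≡⟨ ⊹-⊝-⊹ w y (x ⊹ y) (w ⊝ u) ⟩
            (w ⊹ y) ⊝ ((x ⊹ y) ⊹ (w ⊝ u))   ≡⟨ cong ((w ⊹ y) ⊝_) (trans (swapʳ x y (w ⊝ u)) (cong (_⊹ y) (comm x (w ⊝ u)))) ⟩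
            (w ⊹ y) ⊝ (((w ⊝ u) ⊹ x) ⊹ y)   ≡⟨ sym (⊹-⊝-⊹ w y ((w ⊝ u) ⊹ x) y) ⟩
            (w ⊝ ((w ⊝ u) ⊹ x)) ⊹ (y ⊝ y)   ≡⟨ trans (cong ((w ⊝ ((w ⊝ u) ⊹ x)) ⊹_) (inverseʳ y)) (identityʳ _) ⟩
            w ⊝ ((w ⊝ u) ⊹ x)               ≡⟨ cong (w ⊹_) (sym (⁻¹-∙-comm (w ⊝ u) x)) ⟩
            w ⊹ (neg (w ⊝ u) ⊹ neg x)       ≡⟨ sym (assoc w _ (neg x)) ⟩
            (w ⊝ (w ⊝ u)) ⊝ x               ∎) (sub w~ q))
          where open ≡-Reasoning

    saturated-HT : Saturated HT
    saturated-HT p r with HT∈ p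
    ... | x , x∈ , q = ∈HT x∈ (~-trans r q)

    card-HTT : card (HT ⊞ T) ≡ card HTT
    card-HTT = card-cong (HT ⊞ T) HTT
      (λ { (u , u∈ , t , t∈ , refl) → let (x , x∈ , q) = HT∈ u∈ in x ⊹ t , (x , x∈ , t , t∈ , refl) , ~-+ʳ t q })
      (λ { {y} (_ , (x , x∈ , t , t∈ , refl) , q) → y ⊝ t ,
            ∈HT x∈ (subst (y ⊝ t ~_) (x+g-g x t) (~-+ʳ (neg t) q)) , t , t∈ , sym (x-g+g y t) })

    T⊆HT : T ⊆ₛ HT
    T⊆HT p = ∈HT p ~-refl

    H⊆HT : H ⊆ₛ HT
    H⊆HT p = ∈HT o∈T (∈H⇒~o p)

    -- When HTT is everything, minimality says nothing, but m and σ are multiples of η.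
    2σ≤ : 2 * σ ≤ card HTT + η
    2σ≤ with <-≤-connex (card HTT) m
    ... | inj₁ lt = lin≤ (σ ∷ card HTT ∷ η ∷ card (HT ⊞ T) ∷ []) (2 ⊗ # 0) (# 1 ⊕ # 2) ((1 · # 0 ⊕ # 0 ≼ # 3 ⊕ # 2) ∷ (1 · # 3 ≼ # 1) ∷ [])
          (minimal HT (≤-trans (≤-trans (s≤s z≤n) κ≥10) (card-mono T HT T⊆HT) , ≤-trans (s≤s (≤-reflexive card-HTT)) lt) , ≤-reflexive card-HTT , tt)
    ... | inj₂ ge with card-multiple HT saturated-HT | card-multiple fullₛ (λ _ _ → tt)
    ...   | u , σ≡uη | p , m≡pη = ≤-trans le₂ (≤-trans le₁ (+-monoˡ-≤ η ge))
      where
        le₃ : 2 * (u * η) + 3 ≤ p * η + 2 * η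
        le₃ = subst₂ (λ a b → 2 * a + 3 ≤ b + 2 * η) σ≡uη (trans (sym card-full) m≡pη)
          (lin≤ (σ ∷ m ∷ η ∷ κ ∷ hn ∷ []) (2 ⊗ # 0 ⊕ K 3) (# 1 ⊕ 2 ⊗ # 2)
            ((1 · s⁺ (2 ⊗ # 3) ≼ # 1) ∷ (2 · s⁺ (# 4) ≼ # 2) ∷ (2 · # 0 ≼ # 3 ⊕ # 4) ∷ []) (κ<m , hn<η , ≤-reflexive (sym σ≡) , tt))
        up : 2 * u ≤ suc p
        up = ≮⇒≥ λ lt → <⇒≱ (≤-trans (≤-reflexive (+-comm 1 _)) (≤-trans (+-monoʳ-≤ (2 * (u * η)) (s≤s z≤n)) le₃))
               (≤-trans (≤-reflexive (sym (*-distribʳ-+ η p 2))) (≤-trans (*-monoˡ-≤ η (≤-trans (≤-reflexive (+-comm p 2)) lt)) (≤-reflexive (*-assoc 2 u η))))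
        le₁ : 2 * σ ≤ m + η
        le₁ = subst₂ (λ a b → 2 * a ≤ b + η) (sym σ≡uη) (trans (sym m≡pη) card-full)
          (≤-trans (≤-reflexive (sym (*-assoc 2 u η))) (≤-trans (*-monoˡ-≤ η up) (≤-reflexive (+-comm η (p * η)))))
        le₂ : 2 * σ ≤ 2 * σ
        le₂ = ≤-refl

    extra : ∀ {X Y : DSet m} → card X < card Y → ∃ λ y → y ∈ₛ Y × y ∉ₛ X
    extra {X} {Y} lt with ⊆ₛ? Y X
    ... | inj₁ p = p
    ... | inj₂ f = ⊥-elim (<⇒≱ lt (card-mono Y X f))

    -- The sums of the two rows occupy at most η residues; whatever the integer bound demands beyond
    -- that must be second lifts.
    rows-coset : ∀ {i j} → i ∈ₛ T → j ∈ₛ T → α i + α j ≤ 1 + η + card (B ∩ₛ coset (i ⊹ j))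
    rows-coset {i} {j} i∈ j∈ = ≤-trans (rows (row i) (row j) proj₁ proj₁ (card-≥1 (row i) (i∈ , ~-refl)) (card-≥1 (row j) (j∈ , ~-refl)))
      (+-mono-≤ (s≤s (≤-trans (card-mono (row i ⊞ row j) (coset (i ⊹ j)) in-coset) (≤-reflexive (card-coset (i ⊹ j)))))
        (card-mono (B ∩ₛ (row i ⊞ row j)) (B ∩ₛ coset (i ⊹ j)) (λ (p , q) → p , in-coset q)))
      where
        in-coset : ∀ {y} → y ∈ₛ row i ⊞ row j → y ~ i ⊹ j
        in-coset (x , (_ , p) , z , (_ , q) , refl) = ~-+ p q

    disjoint-T : ∀ {w x} → w ∉ₛ HT → x ~ w → x ∉ₛ T
    disjoint-T w∉ p q = w∉ (∈HT q (~-sym p))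

    module ThreeCosets (σ≥ : 3 * η ≤ σ) where

      module Full (HTT⊆ : HTT ⊆ₛ TT) where

        2σ≤TT : 2 * σ ≤ card TT + η
        2σ≤TT = ≤-trans 2σ≤ (+-monoˡ-≤ η (card-mono HTT TT HTT⊆))

        HT<TT : card HT < card TT
        HT<TT = lin≤ (σ ∷ η ∷ card TT ∷ []) (s⁺ (# 0)) (# 2) ((1 · 2 ⊗ # 0 ≼ # 2 ⊕ # 1) ∷ (1 · 3 ⊗ # 1 ≼ # 0) ∷ (1 · K 2 ≼ # 1) ∷ [])
          (2σ≤TT , σ≥ , nontrivial , tt)

        sum₀ : ∃ λ w → w ∈ₛ TT × w ∉ₛ HT
        sum₀ = extra {HT} {TT} HT<TT

        w₀ : Fin m
        w₀ = proj₁ sum₀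

        sum₁ : ∃ λ w → w ∈ₛ TT × w ∉ₛ (HT ∪ₛ coset w₀)
        sum₁ = extra {HT ∪ₛ coset w₀} {TT} (lin≤ (σ ∷ η ∷ card TT ∷ card (HT ∪ₛ coset w₀) ∷ card (coset w₀) ∷ []) (s⁺ (# 3)) (# 2)
          ((1 · 2 ⊗ # 0 ≼ # 2 ⊕ # 1) ∷ (1 · 3 ⊗ # 1 ≼ # 0) ∷ (1 · K 2 ≼ # 1) ∷ (1 · # 3 ≼ # 0 ⊕ # 4) ∷ (1 · # 4 ≼ # 1) ∷ [])
          (2σ≤TT , σ≥ , nontrivial , card-cover HT (coset w₀) (HT ∪ₛ coset w₀) (λ p → p) , ≤-reflexive (card-coset w₀) , tt))

        2holes : ∀ {i j} → i ∈ₛ T → j ∈ₛ T → hole i + hole j ≤ 2 * hn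
        2holes i∈ j∈ = ≤-trans (+-mono-≤ (hole≤ i∈) (hole≤ j∈)) (≤-reflexive (cong (hn +_) (sym (+-identityʳ hn))))

        -- Two cosets of sums outside H + T each force at least η - 1 elements of `D` less the holes
        -- of their summands, while 2σ ≤ |T + T| + η and the budget leave at most η - 1 - 2hn
        -- elements in all.
        impossible : ⊥
        impossible with sum₀ | sum₁
        ... | w₀ , (i , i∈ , j , j∈ , refl) , w₀∉ | w₁ , (k , k∈ , l , l∈ , refl) , w₁∉ =
            -- The bounds 2η - 2 - 3hn from below and η - 1 - 2hn from above on |D| get weights 2
            -- and 3, so that hn cancels; what remains is η ≤ 1.
            lin⊥ (σ ∷ η ∷ card TT ∷ card D ∷ κ ∷ hn ∷ α i ∷ α j ∷ α k ∷ α l ∷ hole i ∷ hole j ∷ hole k ∷ hole l ∷ card D₀ ∷ card D₁ ∷ [])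
              ((3 · 2 ⊗ # 0 ≼ # 2 ⊕ # 1) ∷ (3 · # 2 ⊕ # 3 ⊕ K 1 ≼ 2 ⊗ # 4) ∷ (6 · # 4 ⊕ # 5 ≼ # 0) ∷
               (2 · # 6 ⊕ # 7 ≼ K 1 ⊕ # 1 ⊕ # 14) ∷ (2 · # 8 ⊕ # 9 ≼ K 1 ⊕ # 1 ⊕ # 15) ∷ (2 · # 14 ⊕ # 15 ≼ # 3) ∷
               (2 · # 1 ≼ # 6 ⊕ # 10) ∷ (2 · # 1 ≼ # 7 ⊕ # 11) ∷ (2 · # 1 ≼ # 8 ⊕ # 12) ∷ (2 · # 1 ≼ # 9 ⊕ # 13) ∷
               (2 · # 10 ⊕ # 11 ⊕ (# 12 ⊕ # 13) ≼ 3 ⊗ # 5) ∷ (1 · K 2 ≼ # 1) ∷ [])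
              (2σ≤TT , budget′ , ≤-reflexive σ≡ , rows-coset i∈ j∈ , rows-coset k∈ l∈ ,
               card-disjoint D₀ D₁ D (λ (p , q) → p , disjoint-T w₀∉ q) (λ (p , q) → p , disjoint-T (λ r → w₁∉ (inj₁ r)) q)
                 (λ (_ , p) (_ , q) → w₁∉ (inj₂ (~-trans (~-sym q) p))) ,
               ≤-reflexive (sym (α+hole i)) , ≤-reflexive (sym (α+hole j)) , ≤-reflexive (sym (α+hole k)) , ≤-reflexive (sym (α+hole l)) ,
               holes , nontrivial , tt)
          where
            D₀ D₁ : DSet m
            D₀ = B ∩ₛ coset (i ⊹ j)
            D₁ = B ∩ₛ coset (k ⊹ l)
            holes : hole i + hole j + (hole k + hole l) ≤ 3 * hn
            holes with i ~? j | k ~? l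
            ... | no p | _ = ≤-trans (+-mono-≤ (hole+hole≤ i∈ j∈ p) (2holes k∈ l∈)) ≤-refl
            ... | yes _ | no q = ≤-trans (+-mono-≤ (2holes i∈ j∈) (hole+hole≤ k∈ l∈ q)) (≤-reflexive (+-comm (2 * hn) hn))
            -- The cosets of i and k differ, since those of i + j and k + l do; so the four terms
            -- are twice a pair for different cosets.
            ... | yes p | yes q = lin≤ (hole i ∷ hole j ∷ hole k ∷ hole l ∷ hn ∷ []) (# 0 ⊕ # 1 ⊕ (# 2 ⊕ # 3)) (3 ⊗ # 4)
                  ((1 · # 1 ≼ # 0) ∷ (1 · # 3 ≼ # 2) ∷ (2 · # 0 ⊕ # 2 ≼ # 4) ∷ [])
                  (≤-reflexive (sym (hole-cong p)) , ≤-reflexive (sym (hole-cong q)) ,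
                   hole+hole≤ i∈ k∈ (λ r → w₁∉ (inj₂ (~-+ (~-sym r) (~-trans (~-sym q) (~-trans (~-sym r) p))))) , tt)

      -- The coset of a + a can only fail to be covered because T has at most half of the coset of a.
      module Bad (a : Fin m) (a∈ : a ∈ₛ T) (y : Fin m) (y~ : y ~ a ⊹ a) (y∉ : y ∉ₛ TT) (2hole : η ≤ 2 * hole a) where

        Ca D₂ : DSet m
        Ca = coset (a ⊹ a)
        D₂ = B ∩ₛ Ca

        -- An uncovered x + z would need η holes in two different cosets, or η / 2 holes in the
        -- coset of x on top of those at a; hn < η allows neither.
        full-other : ∀ {x z w} → x ∈ₛ T → z ∈ₛ T → ¬ x ~ a → w ~ x ⊹ z → w ∈ₛ TT
        full-other {x} {z} {w} x∈ z∈ x≁a w~ with <-≤-connex η (α x + α z)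
        ... | inj₁ big = full big w~
        ... | inj₂ small with x ~? z
        ...   | no x≁z = ⊥-elim (lin⊥ (η ∷ α x ∷ α z ∷ hole x ∷ hole z ∷ hn ∷ [])
                  ((1 · # 1 ⊕ # 2 ≼ # 0) ∷ (1 · # 0 ≼ # 1 ⊕ # 3) ∷ (1 · # 0 ≼ # 2 ⊕ # 4) ∷ (1 · # 3 ⊕ # 4 ≼ # 5) ∷ (1 · s⁺ (# 5) ≼ # 0) ∷ [])
                  (small , ≤-reflexive (sym (α+hole x)) , ≤-reflexive (sym (α+hole z)) , hole+hole≤ x∈ z∈ x≁z , hn<η , tt))
        ...   | yes x~z = ⊥-elim (lin⊥ (η ∷ α x ∷ α z ∷ hole x ∷ hole z ∷ hn ∷ hole a ∷ [])
                  ((1 · # 1 ⊕ # 2 ≼ # 0) ∷ (1 · # 0 ≼ # 1 ⊕ # 3) ∷ (1 · # 0 ≼ # 2 ⊕ # 4) ∷ (1 · # 4 ≼ # 3) ∷ (2 · # 3 ⊕ # 6 ≼ # 5) ∷ (1 · # 0 ≼ 2 ⊗ # 6) ∷ (2 · s⁺ (# 5) ≼ # 0) ∷ [])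
                  (small , ≤-reflexive (sym (α+hole x)) , ≤-reflexive (sym (α+hole z)) , ≤-reflexive (sym (hole-cong x~z)) , hole+hole≤ x∈ a∈ x≁a , 2hole , hn<η , tt))

        full-else : ∀ {x z w} → x ∈ₛ T → z ∈ₛ T → ¬ w ~ a ⊹ a → w ~ x ⊹ z → w ∈ₛ TT
        full-else {x} {z} {w} x∈ z∈ w≁ w~ with x ~? a | z ~? a
        ... | no p | _ = full-other x∈ z∈ p w~
        ... | yes _ | no q = full-other z∈ x∈ q (~-trans w~ (~-≡ (comm x z)))
        ... | yes p | yes q = ⊥-elim (w≁ (~-trans w~ (~-+ p q)))

        p : ℕ
        p = card (TT ∩ₛ Ca)

        HTT≤ : card HTT + p ≤ card TT + η
        HTT≤ = lin≤ (card HTT ∷ p ∷ card TT ∷ η ∷ card (Ca ∖ₛ TT) ∷ []) (# 0 ⊕ # 1) (# 2 ⊕ # 3)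
          ((1 · # 0 ≼ # 2 ⊕ # 4) ∷ (1 · # 1 ⊕ # 4 ≼ # 3) ∷ [])
          (card-cover TT (Ca ∖ₛ TT) HTT cover ,
           ≤-trans (≤-reflexive (trans (cong (_+ card (Ca ∖ₛ TT)) (card-cong (TT ∩ₛ Ca) (Ca ∩ₛ TT) (λ (q , r) → r , q) (λ (q , r) → r , q))) (card-∖ Ca TT))) (≤-reflexive (card-coset (a ⊹ a))) , tt)
          where
            cover : ∀ {w} → w ∈ₛ HTT → w ∈ₛ TT ⊎ w ∈ₛ (Ca ∖ₛ TT)
            cover {w} (_ , (x , x∈ , z , z∈ , refl) , w~) with mem? TT w
            ... | yes q = inj₁ q
            ... | no q = inj₂ (decidable-stable (w ~? a ⊹ a) (λ w≁ → q (full-else x∈ z∈ w≁ w~)) , q)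

        α≤p : α a ≤ p
        α≤p = card-inj (row a) (TT ∩ₛ Ca) (a ⊹_) (λ (x∈ , x~) → (a , a∈ , _ , x∈ , refl) , ~-+ˡ a x~)
          (λ {x} {x′} _ _ e → ∙-cancelʳ a x x′ (trans (comm x a) (trans e (comm a x′))))

        -- If a were in H, a sum i + j outside H + T would have neither summand in the class of a,
        -- so both rows would be spared the holes at a. Their sum then forces more of `D` than the
        -- budget leaves.
        a∉H : a ∉ₛ H
        a∉H a∈H with extra {HT} {HTT} (lin≤ (σ ∷ card HTT ∷ η ∷ []) (s⁺ (# 0)) (# 1) ((1 · 2 ⊗ # 0 ≼ # 1 ⊕ # 2) ∷ (1 · 3 ⊗ # 2 ≼ # 0) ∷ (1 · K 2 ≼ # 2) ∷ []) (2σ≤ , σ≥ , nontrivial , tt))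
        ... | w , (_ , (i , i∈ , j , j∈ , refl) , w~) , w∉ =
          lin⊥ (σ ∷ card HTT ∷ η ∷ p ∷ card TT ∷ card D ∷ κ ∷ hn ∷ α a ∷ hole a ∷ α i ∷ α j ∷ hole i ∷ hole j ∷ card D₀ ∷ [])
            ((2 · 2 ⊗ # 0 ≼ # 1 ⊕ # 2) ∷ (2 · # 1 ⊕ # 3 ≼ # 4 ⊕ # 2) ∷ (2 · # 8 ≼ # 3) ∷ (2 · # 4 ⊕ # 5 ⊕ K 1 ≼ 2 ⊗ # 6) ∷ (4 · # 6 ⊕ # 7 ≼ # 0) ∷
             (2 · # 2 ≼ # 8 ⊕ # 9) ∷ (2 · # 10 ⊕ # 11 ≼ K 1 ⊕ # 2 ⊕ # 14) ∷ (2 · # 2 ≼ # 10 ⊕ # 12) ∷ (2 · # 2 ≼ # 11 ⊕ # 13) ∷ (2 · # 14 ≼ # 5) ∷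
             (2 · # 12 ⊕ # 9 ≼ # 7) ∷ (2 · # 13 ⊕ # 9 ≼ # 7) ∷ (1 · # 2 ≼ 2 ⊗ # 9) ∷ (1 · K 2 ≼ # 2) ∷ [])
            (2σ≤ , HTT≤ , α≤p , budget′ , ≤-reflexive σ≡ , ≤-reflexive (sym (α+hole a)) , rows-coset i∈ j∈ ,
             ≤-reflexive (sym (α+hole i)) , ≤-reflexive (sym (α+hole j)) ,
             card-mono D₀ D (λ (q , r) → q , disjoint-T w′∉ r) ,
             hole+hole≤ i∈ a∈ i≁a , hole+hole≤ j∈ a∈ j≁a , 2hole , nontrivial , tt)
          where
            D₀ : DSet m
            D₀ = B ∩ₛ coset (i ⊹ j)
            w′∉ : i ⊹ j ∉ₛ HT
            w′∉ q = w∉ (saturated-HT q w~)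
            a~o : a ~ o
            a~o = ∈H⇒~o a∈H
            i≁a : ¬ i ~ a
            i≁a q = w′∉ (∈HT j∈ (~-trans (~-+ʳ j (~-trans q a~o)) (~-≡ (identityˡ j))))
            j≁a : ¬ j ~ a
            j≁a q = w′∉ (∈HT i∈ (~-trans (~-+ˡ i (~-trans q a~o)) (~-≡ (identityʳ i))))

        o≁a : ¬ o ~ a
        o≁a q = a∉H (~o⇒∈H (~-sym q))

        2a-free : ∀ {t} → t ∈ₛ T → ¬ t ~ a ⊹ a
        2a-free {t} t∈ q = y∉ (full-other o∈T t∈ o≁a (~-trans y~ (~-trans (~-sym q) (~-≡ (sym (identityˡ t))))))

        2α≤ : α a + α a ≤ 1 + p + card D₂
        2α≤ = ≤-trans (rows (row a) (row a) proj₁ proj₁ (card-≥1 (row a) (a∈ , ~-refl)) (card-≥1 (row a) (a∈ , ~-refl)))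
          (+-mono-≤ (s≤s (card-mono (row a ⊞ row a) (TT ∩ₛ Ca) inn)) (card-mono (B ∩ₛ (row a ⊞ row a)) D₂ (λ (q , r) → q , proj₂ (inn r))))
          where
            inn : ∀ {w} → w ∈ₛ row a ⊞ row a → w ∈ₛ TT ∩ₛ Ca
            inn (u , (u∈ , u~) , z , (z∈ , z~) , refl) = (u , u∈ , z , z∈ , refl) , ~-+ u~ z~

        D₂⊆D : D₂ ⊆ₛ D
        D₂⊆D (q , r) = q , λ t∈ → 2a-free t∈ r

        facts : List Hyp
        facts = (1 · 2 ⊗ # 0 ≼ # 1 ⊕ # 2) ∷ (1 · # 1 ⊕ # 3 ≼ # 4 ⊕ # 2) ∷ (1 · # 4 ⊕ # 5 ⊕ K 1 ≼ 2 ⊗ # 6) ∷ (2 · # 6 ⊕ # 7 ≼ # 0) ∷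
                (2 · # 2 ≼ # 8 ⊕ # 9) ∷ (1 · # 8 ⊕ # 8 ≼ K 1 ⊕ # 3 ⊕ # 10) ∷ []

        env : List ℕ
        env = σ ∷ card HTT ∷ η ∷ p ∷ card TT ∷ card D ∷ κ ∷ hn ∷ α a ∷ hole a ∷ card D₂ ∷ []

        holds : Holds env facts
        holds = 2σ≤ , HTT≤ , budget′ , ≤-reflexive σ≡ , ≤-reflexive (sym (α+hole a)) , 2α≤ , tt

        -- Here the count becomes exact. The budget gives |D| ≤ 2η - 2hn - p - 1, and the integer
        -- bound for the row of a with itself gives |D₂| ≥ 2η - 2 hole a - p - 1. So all holes sit
        -- in the coset of a and all of `D` in that of a + a.
        hn≤hole : hn ≤ hole a
        hn≤hole = *-cancelˡ-≤ 2 (lin≤ env (2 ⊗ # 7) (2 ⊗ # 9) ((1 · # 10 ≼ # 5) ∷ facts) (card-mono D₂ D D₂⊆D , holds))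

        D⊆D₂ : D ⊆ₛ D₂
        D⊆D₂ = ⊆-card D₂ D D₂⊆D (lin≤ env (# 5) (# 10) ((2 · # 9 ≼ # 7) ∷ facts) (hole≤ a∈ , holds))

        B⊆ : ∀ {z} → z ∈ₛ B → ¬ z ~ a ⊹ a → z ∈ₛ T
        B⊆ {z} z∈ z≁ = decidable-stable (mem? T z) λ z∉ → z≁ (proj₂ (D⊆D₂ (z∈ , z∉)))

        hole≡0 : ∀ {c} → c ∈ₛ T → ¬ c ~ a → hole c ≡ 0
        hole≡0 {c} c∈ c≁a = n≤0⇒n≡0 (lin≤ (hole c ∷ hole a ∷ hn ∷ []) (# 0) (K 0) ((1 · # 0 ⊕ # 1 ≼ # 2) ∷ (1 · # 2 ≼ # 1) ∷ [])
          (hole+hole≤ c∈ a∈ c≁a , hn≤hole , tt))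

        α≡η : ∀ {c} → c ∈ₛ T → ¬ c ~ a → η ≤ α c
        α≡η {c} c∈ c≁a = ≤-reflexive (trans (sym (α+hole c)) (trans (cong (α c +_) (hole≡0 c∈ c≁a)) (+-identityʳ (α c))))

        full-row : ∀ {c x} → c ∈ₛ T → ¬ c ~ a → x ~ c → x ∈ₛ T
        full-row {c} {x} c∈ c≁a x~ = decidable-stable (mem? T x) λ x∉ →
          <⇒≱ (card-≥1 (coset c ∖ₛ T) (x~ , x∉)) (≤-reflexive (hole≡0 c∈ c≁a))

        V : DSet m
        V = T ∖ₛ coset a

        saturated-V : Saturated V
        saturated-V (c∈ , c≁) x~ = full-row c∈ c≁ x~ , λ q → c≁ (~-trans (~-sym x~) q)

        o∈V : o ∈ₛ V
        o∈V = o∈T , o≁a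

        -- Two full rows put at least η - 1 > 0 elements of `B` into the coset of c + d. Outside H +
        -- T these could only lie in the coset of a + a, which would then be covered as that of c +
        -- d, although y is missing from it.
        V+V⊆HT : ∀ {c d} → c ∈ₛ V → d ∈ₛ V → c ⊹ d ∈ₛ HT
        V+V⊆HT {c} {d} (c∈ , c≁) (d∈ , d≁) = decidable-stable (mem? HT (c ⊹ d)) λ cd∉ →
          let z , z∈ , z~ = pick D₀ (lin≤ (η ∷ α c ∷ α d ∷ card D₀ ∷ []) (K 1) (# 3) ((1 · # 0 ≼ # 1) ∷ (1 · # 0 ≼ # 2) ∷ (1 · # 1 ⊕ # 2 ≼ K 1 ⊕ # 0 ⊕ # 3) ∷ (1 · K 2 ≼ # 0) ∷ [])
                (α≡η c∈ c≁ , α≡η d∈ d≁ , rows-coset c∈ d∈ , nontrivial , tt))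
              2a~ = decidable-stable (z ~? a ⊹ a) λ z≁ → disjoint-T cd∉ z~ (B⊆ z∈ z≁)
          in y∉ (full-other c∈ d∈ c≁ (~-trans y~ (~-trans (~-sym 2a~) z~)))
          where
            D₀ : DSet m
            D₀ = B ∩ₛ coset (c ⊹ d)

        V+V : ∀ {c d} → c ∈ₛ V → d ∈ₛ V → c ⊹ d ∈ₛ V ⊎ c ⊹ d ~ a
        V+V c∈ d∈ = split (HT∈ (V+V⊆HT c∈ d∈))
          where
            split : ∀ {z} → (∃ λ x → x ∈ₛ T × z ~ x) → z ∈ₛ V ⊎ z ~ a
            split (t , t∈ , q) with t ~? a
            ... | yes r = inj₂ (~-trans q r)
            ... | no r = inj₁ (saturated-V (t∈ , r) q)

        -- In a finite set closed under addition, V + c fills V, so 0 has the form x + c.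
        V-closed⇒sub : (∀ {c d} → c ∈ₛ V → d ∈ₛ V → c ⊹ d ∈ₛ V) → IsSub V
        V-closed⇒sub cl = record { o∈ = o∈V ; sub = λ p q → cl p (neg∈V q) }
          where
            neg∈V : ∀ {c} → c ∈ₛ V → neg c ∈ₛ V
            neg∈V {c} c∈ = from (⊆-card (V ⟫ c) V (λ { (x , x∈ , refl) → cl x∈ c∈ }) (≤-reflexive (sym (card-⟫ V c))) {o} o∈V)
              where
                from : o ∈ₛ (V ⟫ c) → neg c ∈ₛ V
                from (x , x∈ , e) = subst (_∈ₛ V) (sym (trans (sym (identityˡ (neg c))) (trans (cong (_⊝ c) e) (x+g-g x c)))) x∈

        -- If c + d ~ a, the integer bound leaves at most one hole in the coset of a, so η ≤ 2. At
        -- most two cosets of sums lie outside H + T, whence σ ≤ 3η ≤ 6, too few for the ten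
        -- elements of `T`.
        small-case : ∀ {c d} → c ∈ₛ V → d ∈ₛ V → c ⊹ d ~ a → ⊥
        small-case {c} {d} (c∈ , c≁) (d∈ , d≁) cd~a =
          lin⊥ (σ ∷ card HTT ∷ η ∷ κ ∷ α a ∷ hole a ∷ α c ∷ α d ∷ card D₀ ∷ hn ∷ [])
            ((1 · 2 ⊗ # 0 ≼ # 1 ⊕ # 2) ∷ (1 · # 1 ≼ # 0 ⊕ (# 2 ⊕ # 2)) ∷ (1 · # 3 ⊕ # 9 ≼ # 0) ∷ (1 · K 10 ≼ # 3) ∷
             (6 · # 2 ≼ # 6) ∷ (6 · # 2 ≼ # 7) ∷ (6 · # 6 ⊕ # 7 ≼ K 1 ⊕ # 2 ⊕ # 8) ∷ (6 · # 8 ≼ # 4) ∷ (6 · # 4 ⊕ # 5 ≼ # 2) ∷ (3 · # 2 ≼ # 5 ⊕ # 5) ∷ [])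
            (2σ≤ , HTT≤σ+2η , ≤-reflexive σ≡ , κ≥10 , α≡η c∈ c≁ , α≡η d∈ d≁ , rows-coset c∈ d∈ ,
             card-mono D₀ (row a) (λ (z∈ , z~) → B⊆ z∈ (λ q → a≁2a (~-trans (~-sym cd~a) (~-trans (~-sym z~) q))) , ~-trans z~ cd~a) ,
             ≤-reflexive (α+hole a) , ≤-trans 2hole (≤-reflexive (cong (hole a +_) (+-identityʳ (hole a)))) , tt)
          where
            D₀ C₁ C₂ : DSet m
            D₀ = B ∩ₛ coset (c ⊹ d)
            C₁ = coset (a ⊹ a)
            C₂ = coset ((a ⊹ a) ⊝ d)
            a≁2a : ¬ a ~ a ⊹ a
            a≁2a = 2a-free a∈
            -- z + v ~ c + (d + v) stays in H + T unless d + v ~ a, and this exception fixes the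
            -- coset of v: it is the origin of `C₂`.
            with-a : ∀ {z v} → z ~ a → v ∈ₛ T → (z ⊹ v) ∈ₛ HT ⊎ z ⊹ v ∈ₛ C₁ ∪ₛ C₂
            with-a {z} {v} z~ v∈ with v ~? a
            ... | yes q = inj₂ (inj₁ (~-+ z~ q))
            ... | no q = [ (λ r → inj₁ (saturated-HT (V+V⊆HT (c∈ , c≁) r) (~-trans (~-+ʳ v (~-trans z~ (~-sym cd~a))) (~-≡ (assoc c d v))))) ,
                           (λ r → inj₂ (inj₂ (~-trans (~-+ z~ (~-trans (~-≡ (trans (sym (x+g-g v d)) (cong (_⊝ d) (comm v d)))) (~-+ʳ (neg d) r))) (~-≡ (sym (assoc a a (neg d))))))) ]′
                         (V+V (d∈ , d≁) (v∈ , q))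
            HTT≤σ+2η : card HTT ≤ σ + (η + η)
            HTT≤σ+2η = ≤-trans (card-cover HT (C₁ ∪ₛ C₂) HTT cover) (+-monoʳ-≤ σ
                (≤-trans (card-cover C₁ C₂ (C₁ ∪ₛ C₂) (λ q → q)) (≤-reflexive (cong₂ _+_ (card-coset (a ⊹ a)) (card-coset _)))))
              where
                sat : ∀ {w z} → w ~ z → z ∈ₛ HT ⊎ z ∈ₛ C₁ ∪ₛ C₂ → w ∈ₛ HT ⊎ w ∈ₛ C₁ ∪ₛ C₂
                sat q (inj₁ r) = inj₁ (saturated-HT r q)
                sat q (inj₂ (inj₁ r)) = inj₂ (inj₁ (~-trans q r))
                sat q (inj₂ (inj₂ r)) = inj₂ (inj₂ (~-trans q r))
                cover : ∀ {w} → w ∈ₛ HTT → w ∈ₛ HT ⊎ w ∈ₛ C₁ ∪ₛ C₂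
                cover (_ , (x , x∈ , z , z∈ , refl) , w~) with x ~? a | z ~? a
                ... | yes q | _ = sat w~ (with-a q z∈)
                ... | no _ | yes r = sat (~-trans w~ (~-≡ (comm x z))) (with-a r x∈)
                ... | no q | no r = inj₁ (saturated-HT (V+V⊆HT (x∈ , q) (z∈ , r)) w~)

        twoClasses : TwoClasses
        twoClasses = record
          { V = V
          ; V-sub = V-closed⇒sub (λ c∈ d∈ → [ (λ q → q) , (λ q → ⊥-elim (small-case c∈ d∈ q)) ]′ (V+V c∈ d∈))
          ; a = a ; a∈T = a∈
          ; a∉V = λ (_ , q) → q ~-refl
          ; a+a∉V = λ (q , _) → 2a-free q ~-refl
          ; classes = λ {x} x∈ → classify x∈ (x ~? a) }
          where
            classify : ∀ {x} → x ∈ₛ T → Dec (x ~ a) → x ∈ₛ V ⊎ x ⊝ a ∈ₛ V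
            classify x∈ (yes q) = inj₂ (saturated-V o∈V (∈H⇒~o q))
            classify x∈ (no q) = inj₁ (x∈ , q)

      conclusion : TwoClasses
      conclusion with ⊆ₛ? HTT TT
      ... | inj₂ h = ⊥-elim (Full.impossible h)
      ... | inj₁ (y , (_ , (a , a∈ , b , b∈ , refl) , y~) , y∉) with a ~? b
      ...   | yes q = Bad.twoClasses a a∈ y (~-trans y~ (~-+ˡ a (~-sym q))) y∉
                (lin≤ (η ∷ α a ∷ α b ∷ hole a ∷ hole b ∷ []) (# 0) (2 ⊗ # 3) ((1 · # 1 ⊕ # 2 ≼ # 0) ∷ (1 · # 0 ≼ # 1 ⊕ # 3) ∷ (1 · # 0 ≼ # 2 ⊕ # 4) ∷ (1 · # 4 ≼ # 3) ∷ [])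
                  (≮⇒≥ (λ big → y∉ (full big y~)) , ≤-reflexive (sym (α+hole a)) , ≤-reflexive (sym (α+hole b)) , ≤-reflexive (sym (hole-cong q)) , tt))
      ...   | no q = ⊥-elim (lin⊥ (η ∷ α a ∷ α b ∷ hole a ∷ hole b ∷ hn ∷ [])
                ((1 · # 1 ⊕ # 2 ≼ # 0) ∷ (1 · # 0 ≼ # 1 ⊕ # 3) ∷ (1 · # 0 ≼ # 2 ⊕ # 4) ∷ (1 · # 3 ⊕ # 4 ≼ # 5) ∷ (1 · s⁺ (# 5) ≼ # 0) ∷ [])
                (≮⇒≥ (λ big → y∉ (full big y~)) , ≤-reflexive (sym (α+hole a)) , ≤-reflexive (sym (α+hole b)) , hole+hole≤ a∈ b∈ q , hn<η , tt))

    twoClasses : TwoClasses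
    twoClasses with generates H isSub (≤-trans (s≤s (card-mono H HT H⊆HT)) proper)
    ... | a , a∈ , a∉ with ⊆ₛ? T (H ∪ₛ coset a)
    ...   | inj₁ (b , b∈ , b∉) = ThreeCosets.conclusion (lin≤ (σ ∷ η ∷ card (H ∪ₛ coset a) ∷ card (coset a) ∷ card (coset b) ∷ []) (3 ⊗ # 1) (# 0)
              ((1 · # 1 ⊕ # 3 ≼ # 2) ∷ (1 · # 2 ⊕ # 4 ≼ # 0) ∷ (1 · # 1 ≼ # 3) ∷ (1 · # 1 ≼ # 4) ∷ [])
              (card-disjoint H (coset a) (H ∪ₛ coset a) inj₁ inj₂ disj ,
               card-disjoint (H ∪ₛ coset a) (coset b) HT (λ { (inj₁ q) → H⊆HT q ; (inj₂ q) → ∈HT a∈ q }) (∈HT b∈)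
                 (λ { (inj₁ q) r → b∉ (inj₁ (~o⇒∈H (~-trans (~-sym r) (∈H⇒~o q)))) ; (inj₂ q) r → b∉ (inj₂ (~-trans (~-sym r) q)) }) ,
               ≤-reflexive (sym (card-coset a)) , ≤-reflexive (sym (card-coset b)) , tt))
      where
        disj : ∀ {x} → x ∈ₛ H → x ~ a → ⊥
        disj q r = a∉ (~o⇒∈H (~-trans (~-sym r) (∈H⇒~o q)))
    ...   | inj₂ f = record { V = H ; V-sub = isSub ; a = a ; a∈T = a∈ ; a∉V = a∉ ; a+a∉V = 2a∉ ; classes = f }
      where
        -- Otherwise all sums lie in two cosets, and 2σ ≤ 3η although σ ≥ 2η.
        2a∉ : a ⊹ a ∉ₛ H
        2a∉ q = lin⊥ (σ ∷ η ∷ card HTT ∷ card (coset a) ∷ [])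
          ((1 · 2 ⊗ # 0 ≼ # 2 ⊕ # 1) ∷ (1 · # 2 ≼ # 1 ⊕ # 3) ∷ (2 · # 1 ⊕ # 3 ≼ # 0) ∷ (1 · # 1 ≼ # 3) ∷ (1 · K 2 ≼ # 1) ∷ [])
          (2σ≤ , card-cover H (coset a) HTT cover ,
           card-disjoint H (coset a) HT H⊆HT (∈HT a∈) (λ q r → a∉ (~o⇒∈H (~-trans (~-sym r) (∈H⇒~o q)))) , ≤-reflexive (sym (card-coset a)) , nontrivial , tt)
          where
            cover : ∀ {w} → w ∈ₛ HTT → w ∈ₛ H ⊎ w ∈ₛ coset a
            cover {w} (_ , (x , x∈ , z , z∈ , refl) , w~) with f x∈ | f z∈
            ... | inj₁ p | inj₁ r = inj₁ (~o⇒∈H (~-trans w~ (∈H⇒~o (add p r))))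
            ... | inj₁ p | inj₂ r = inj₂ (~-trans w~ (~-trans (~-+ (∈H⇒~o p) r) (~-≡ (identityˡ a))))
            ... | inj₂ p | inj₁ r = inj₂ (~-trans w~ (~-trans (~-+ p (∈H⇒~o r)) (~-≡ (identityʳ a))))
            ... | inj₂ p | inj₂ r = inj₁ (~o⇒∈H (~-trans w~ (~-trans (~-+ p r) (∈H⇒~o q))))

-- Sets with at most one end for a difference t

module Arcs {m : ℕ} (_⊹_ : Fin m → Fin m → Fin m) (o : Fin m) (neg : Fin m → Fin m)
    (isAb : IsAbelianGroup _≡_ _⊹_ o neg) where

  open import Data.Nat.DivMod using (_%_; _/_; m%n<n; m≡m%n+[m/n]*n)
  open ≡
  open LinearArithmetic
  open FiniteSets
  open Isoperimetry _⊹_ o neg isAb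
  open Periodicity _⊹_ o neg isAb using (module Cosets)
  open IsAbelianGroup isAb using (assoc; comm; identityˡ; identityʳ)
  open import Algebra.Properties.AbelianGroup 𝔾 using (∙-cancelˡ; ⁻¹-∙-comm; ε⁻¹≈ε)

  infixl 25 _·_
  _·_ : ℕ → Fin m → Fin m
  zero · t = o
  suc j · t = j · t ⊹ t

  ·-+ : ∀ i j t → (i + j) · t ≡ i · t ⊹ j · t
  ·-+ zero j t = sym (identityˡ _)
  ·-+ (suc i) j t = trans (cong (_⊹ t) (·-+ i j t)) (swapʳ (i · t) (j · t) t)

  ·-neg : ∀ j t → j · neg t ≡ neg (j · t)
  ·-neg zero t = sym ε⁻¹≈ε
  ·-neg (suc j) t = trans (cong (_⊹ neg t) (·-neg j t)) (⁻¹-∙-comm (j · t) t)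

  ·-*o : ∀ k p t → p · t ≡ o → (k * p) · t ≡ o
  ·-*o zero p t e = refl
  ·-*o (suc k) p t e = trans (·-+ p (k * p) t) (trans (cong₂ _⊹_ e (·-*o k p t e)) (identityˡ o))

  ·-cancel : ∀ i j t → i · t ≡ (i + j) · t → j · t ≡ o
  ·-cancel i j t e = sym (∙-cancelˡ (i · t) o (j · t) (trans (identityʳ _) (trans e (·-+ i j t))))

  ·-period : ∀ t p .{{_ : NonZero p}} → p · t ≡ o → ∀ j → j · t ≡ (j % p) · t
  ·-period t p e j = trans (cong (_· t) (m≡m%n+[m/n]*n j p)) (trans (·-+ (j % p) _ t) (trans (cong ((j % p) · t ⊹_) (·-*o (j / p) p t e)) (identityʳ _)))

  period : ∀ t → ∃ λ p → suc p ≤ m × suc p · t ≡ o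
  period t with F.pigeonhole (n<1+n m) (λ (i : Fin (suc m)) → toℕ i · t)
  ... | i , j , i<j , e = d , bound , cancel
    where
      d : ℕ
      d = toℕ j ∸ suc (toℕ i)
      j≡ : toℕ i + suc d ≡ toℕ j
      j≡ = trans (+-suc (toℕ i) d) (m+[n∸m]≡n i<j)
      bound : suc d ≤ m
      bound = ≤-trans (m≤n+m (suc d) (toℕ i)) (≤-trans (≤-reflexive j≡) (≤-pred (F.toℕ<n j)))
      cancel : suc d · t ≡ o
      cancel = ·-cancel (toℕ i) (suc d) t (trans e (cong (_· t) (sym j≡)))

  firstFail : ∀ (X : DSet m) (f : ℕ → Fin m) n → f 0 ∈ₛ X → f n ∉ₛ X →
    ∃ λ k → k < n × (∀ j → j ≤ k → f j ∈ₛ X) × f (suc k) ∉ₛ X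
  firstFail X f zero p q = ⊥-elim (q p)
  firstFail X f (suc n) p q with mem? X (f n)
  ... | no r = let k , k< , h , s = firstFail X f n p r in k , m<n⇒m<1+n k< , h , s
  ... | yes r with go n r
    where
      go : ∀ n → f n ∈ₛ X → (∃ λ k → k < n × (∀ j → j ≤ k → f j ∈ₛ X) × f (suc k) ∉ₛ X) ⊎ (∀ j → j ≤ n → f j ∈ₛ X)
      go zero r = inj₂ λ { zero z≤n → r }
      go (suc n) r with mem? X (f n)
      ... | no s = let k , k< , h , s′ = firstFail X f n p s in inj₁ (k , m<n⇒m<1+n k< , h , s′)
      ... | yes s with go n s
      ...   | inj₁ (k , k< , h , s′) = inj₁ (k , m<n⇒m<1+n k< , h , s′)
      ...   | inj₂ h = inj₂ λ j le → [ (λ lt → h j (≤-pred lt)) , (λ { refl → r }) ]′ (m≤n⇒m<n∨m≡n le)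
  ... | inj₁ (k , k< , h , s) = k , m<n⇒m<1+n k< , h , s
  ... | inj₂ h = n , ≤-refl , h , q

  module ArcCase (T : DSet m) (o∈T : o ∈ₛ T) (κ<m : suc (2 * card T) ≤ m)
    (t : Fin m) (t≢o : t ≢ o) where
    open Atoms T o∈T

    -- `T` runs from - J₂ t through 0 to J₁ t. The two arms are kept apart because they will lift to
    -- progressions starting from the opposite ends 0 and m.
    record IsArc (J₁ J₂ : ℕ) : Set where
      field
        order : ∀ {n} → 0 < n → n < m → n · t ≢ o
        up : ∀ {j} → j ≤ J₁ → j · t ∈ₛ T
        down : ∀ {j} → j ≤ J₂ → j · neg t ∈ₛ T
        exhaust : ∀ {x} → x ∈ₛ T → (∃ λ j → j ≤ J₁ × x ≡ j · t) ⊎ (∃ λ j → j ≤ J₂ × x ≡ j · neg t)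
        count : J₁ + J₂ + 1 ≤ κ

    p : ℕ
    p = proj₁ (period t)

    p<m : suc p ≤ m
    p<m = proj₁ (proj₂ (period t))

    pt : suc p · t ≡ o
    pt = proj₂ (proj₂ (period t))

    ⟨t⟩ : DSet m
    ⟨t⟩ .mem x = ∃ λ (j : Fin m) → x ≡ toℕ j · t
    ⟨t⟩ .mem? x = F.any? λ j → x F.≟ toℕ j · t

    multiple : ∀ j → j · t ∈ₛ ⟨t⟩
    multiple j = fromℕ< lt , trans (·-period t (suc p) pt j) (cong (_· t) (sym (F.toℕ-fromℕ< lt)))
      where
        lt : j % suc p < m
        lt = <-≤-trans (m%n<n j (suc p)) p<m

    neg-multiple : ∀ j → neg (j · t) ≡ (j * p) · t
    neg-multiple j = sym (begin
        (j * p) · t                                 ≡⟨ sym (x+g-g _ (j · t)) ⟩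
        ((j * p) · t ⊹ j · t) ⊝ j · t               ≡⟨ cong (_⊝ j · t) (trans (sym (·-+ (j * p) j t)) (cong (_· t) (trans (+-comm (j * p) j) (sym (*-suc j p))))) ⟩
        (j * suc p) · t ⊝ j · t                     ≡⟨ cong (_⊝ j · t) (·-*o j (suc p) t pt) ⟩
        o ⊝ j · t                                   ≡⟨ identityˡ _ ⟩
        neg (j · t)                                 ∎)
      where open ≡-Reasoning

    ⟨t⟩-sub : IsSub ⟨t⟩
    ⟨t⟩-sub = record
      { o∈ = multiple 0
      ; sub = λ { (i , refl) (j , refl) → subst (_∈ₛ ⟨t⟩) (trans (·-+ (toℕ i) (toℕ j * p) t) (cong (toℕ i · t ⊹_) (sym (neg-multiple (toℕ j))))) (multiple (toℕ i + toℕ j * p)) } }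

    open Cosets ⟨t⟩ ⟨t⟩-sub

    exit : ∀ n x → x ∈ₛ T → x ⊹ n · t ∉ₛ T → ∃ λ k → k < n × x ⊹ k · t ∈ₛ ends t
    exit n x x∈ n∉ with firstFail T (λ j → x ⊹ j · t) n (subst (_∈ₛ T) (sym (identityʳ x)) x∈) n∉
    ... | k , k< , h , s = k , k< , h k ≤-refl , λ q → s (subst (_∈ₛ T) (assoc x (k · t) t) q)

    module Proper⟨t⟩ (one-end : card (ends t) ≤ 1) (CD : CauchyDavenport) (η<m : η < m) where

      HT : DSet m
      HT = ⟨t⟩ ⊞ T

      exit-coset : ∀ {y} → y ∈ₛ HT → y ∉ₛ T → ∃ λ e → e ∈ₛ ends t × y ~ e
      exit-coset (_ , (j , refl) , x , x∈ , refl) y∉ with exit (toℕ j) x x∈ (λ q → y∉ (subst (_∈ₛ T) (comm x _) q))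
      ... | k , _ , e∈ = x ⊹ k · t , e∈ , ~-trans (~-+ʳ x (∈H⇒~o (multiple (toℕ j)))) (~-trans (~-≡ (trans (comm o x) refl)) (~-+ˡ x (~-sym (∈H⇒~o (multiple k)))))

      -- Walking by t from `T` into a hole passes an end in the same coset. So all holes share the
      -- coset of the only end, which is itself no hole.
      holes<η : suc (card (HT ∖ₛ T)) ≤ η
      holes<η with ∃ₛ? (ends t)
      ... | no none = ≤-trans (s≤s (≮⇒≥ λ h → let y , y∈ , y∉ = pick (HT ∖ₛ T) h ; e , e∈ , _ = exit-coset y∈ y∉ in none (e , e∈))) (card-≥1 ⟨t⟩ (multiple 0))
      ... | yes (e , e∈T , e∉) = ≤-trans (≤-reflexive (cong (_+ card (HT ∖ₛ T)) (sym (card-single e))))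
          (≤-trans (card-disjoint (single e) (HT ∖ₛ T) (coset e) (λ { refl → ~-refl }) inn (λ { refl (_ , q) → q e∈T })) (≤-reflexive (card-coset e)))
        where
          unique : ∀ {e′} → e′ ∈ₛ ends t → e′ ≡ e
          unique {e′} q = decidable-stable (e′ F.≟ e) λ ne → <⇒≱ (card-≥2 (ends t) q (e∈T , e∉) ne) one-end
          inn : ∀ {y} → y ∈ₛ (HT ∖ₛ T) → y ~ e
          inn (y∈ , y∉) = let e′ , e′∈ , q = exit-coset y∈ y∉ in subst (_ ~_) (unique e′∈) q

      κ+holes : κ + card (HT ∖ₛ T) ≡ card HT
      κ+holes = trans (cong (_+ card (HT ∖ₛ T)) (card-cong T (HT ∩ₛ T) (λ {x} q → (o , multiple 0 , x , q , sym (identityˡ x)) , q) proj₂)) (card-∖ HT T)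

      2η≤m : 2 * η ≤ m
      2η≤m = from (card-multiple fullₛ (λ _ _ → tt))
        where
          from : (∃ λ u → card (fullₛ {m}) ≡ u * η) → 2 * η ≤ m
          from (zero , e) = ⊥-elim (<⇒≱ η<m (≤-trans (≤-reflexive (trans (sym card-full) e)) z≤n))
          from (suc zero , e) = ⊥-elim (<⇒≢ η<m (sym (trans (sym card-full) (trans e (*-identityˡ η)))))
          from (suc (suc u) , e) = ≤-trans (*-monoˡ-≤ η {2} {suc (suc u)} (s≤s (s≤s z≤n))) (≤-reflexive (sym (trans (sym card-full) e)))

      -- With fewer than η holes the excess of ⟨t⟩ is at most κ - 1, the least that Cauchy-Davenport
      -- allows; so ⟨t⟩ is minimal. It is proper because 2η ≤ m and 2κ < m.
      periodic : Periodic
      periodic = record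
        { H = ⟨t⟩
        ; isSub = ⟨t⟩-sub
        ; nontrivial = card-≥2 ⟨t⟩ (multiple 0) (multiple 1) (λ e → t≢o (sym (trans e (identityˡ t))))
        ; proper = ≰⇒> λ le → lin⊥ (card HT ∷ κ ∷ card (HT ∖ₛ T) ∷ η ∷ m ∷ [])
            ((2 · # 0 ≼ # 1 ⊕ # 2) ∷ (2 · s⁺ (# 2) ≼ # 3) ∷ (1 · 2 ⊗ # 3 ≼ # 4) ∷ (1 · s⁺ (2 ⊗ # 1) ≼ # 4) ∷ (2 · # 4 ≼ # 0) ∷ [])
            (≤-reflexive (sym κ+holes) , holes<η , 2η≤m , κ<m , le , tt)
        ; dense = lin≤ (card HT ∷ κ ∷ card (HT ∖ₛ T) ∷ η ∷ []) (# 0 ⊕ K 1) (# 1 ⊕ # 3)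
            ((1 · # 0 ≼ # 1 ⊕ # 2) ∷ (1 · s⁺ (# 2) ≼ # 3) ∷ []) (≤-reflexive (sym κ+holes) , holes<η , tt)
        ; minimal = λ X c → lin≤ (card HT ∷ κ ∷ card (HT ∖ₛ T) ∷ η ∷ card X ∷ card (X ⊞ T) ∷ []) (# 0 ⊕ # 4) (# 5 ⊕ # 3)
            ((1 · # 0 ≼ # 1 ⊕ # 2) ∷ (1 · s⁺ (# 2) ≼ # 3) ∷ (1 · # 4 ⊕ # 1 ≼ # 5 ⊕ K 1) ∷ [])
            (≤-reflexive (sym κ+holes) , holes<η , CD X c , tt) }

    module Full⟨t⟩ (one-end : card (ends t) ≤ 1) (m≤η : m ≤ η) where

      order : ∀ {n} → 0 < n → n < m → n · t ≢ o
      order {suc n} _ n<m e = <⇒≱ n<m (≤-trans m≤η (≤-trans (card-inj ⟨t⟩ (fullₛ {suc n}) index (λ _ → tt) inj) (≤-reflexive card-full)))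
        where
          h : ∀ x → ∃ λ j → j < suc n × (x ∈ₛ ⟨t⟩ → x ≡ j · t)
          h x with mem? ⟨t⟩ x
          ... | yes (j , eq) = toℕ j % suc n , m%n<n (toℕ j) (suc n) , λ _ → trans eq (·-period t (suc n) e (toℕ j))
          ... | no q = 0 , s≤s z≤n , λ r → ⊥-elim (q r)
          index : Fin m → Fin (suc n)
          index x = fromℕ< (proj₁ (proj₂ (h x)))
          inj : ∀ {x x′} → x ∈ₛ ⟨t⟩ → x′ ∈ₛ ⟨t⟩ → index x ≡ index x′ → x ≡ x′
          inj {x} {x′} p q eq = trans (proj₂ (proj₂ (h x)) p) (trans (cong (_· t)
            (trans (sym (F.toℕ-fromℕ< (proj₁ (proj₂ (h x))))) (trans (cong toℕ eq) (F.toℕ-fromℕ< (proj₁ (proj₂ (h x′))))))) (sym (proj₂ (proj₂ (h x′)) q)))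

      mt : m · t ≡ o
      mt with m≤n⇒m<n∨m≡n p<m
      ... | inj₁ lt = ⊥-elim (order (s≤s z≤n) lt pt)
      ... | inj₂ eq = subst (λ k → k · t ≡ o) eq pt

      all : ∀ x → x ∈ₛ ⟨t⟩
      all x = ⊆-card ⟨t⟩ fullₛ (λ _ → tt) (≤-trans (≤-reflexive card-full) m≤η) {x} tt

      distinct : ∀ {i j} → i ≤ j → j < m → i · t ≡ j · t → i ≡ j
      distinct {i} {j} i≤j j<m e with m≤n⇒m<n∨m≡n i≤j
      ... | inj₂ eq = eq
      ... | inj₁ lt = ⊥-elim (order (m<n⇒0<n∸m lt) (≤-<-trans (m∸n≤m j i) j<m) (·-cancel i (j ∸ i) t (trans e (cong (_· t) (sym (m+[n∸m]≡n i≤j))))))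

      opposite : ∀ {j} → j ≤ m → j · neg t ≡ (m ∸ j) · t
      opposite {j} le = trans (·-neg j t) (sym (begin
        (m ∸ j) · t                        ≡⟨ sym (x+g-g _ (j · t)) ⟩
        ((m ∸ j) · t ⊹ j · t) ⊝ j · t      ≡⟨ cong (_⊝ j · t) (trans (sym (·-+ (m ∸ j) j t)) (trans (cong (_· t) (m∸n+n≡m le)) mt)) ⟩
        o ⊝ j · t                          ≡⟨ identityˡ _ ⟩
        neg (j · t)                        ∎))
        where open ≡-Reasoning

      outside : ∃ λ x → x ∉ₛ T
      outside with ⊆ₛ? fullₛ T
      ... | inj₁ (x , _ , q) = x , q
      ... | inj₂ f = ⊥-elim (<⇒≱ (≤-trans (s≤s (m≤m+n κ (κ + 0))) κ<m) (≤-trans (≤-reflexive (sym card-full)) (card-mono fullₛ T f)))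

      arc : ∃ λ J₁ → ∃ λ J₂ → IsArc J₁ J₂
      arc with outside
      ... | x , x∉ with all x
      ... | j₀ , refl with firstFail T (_· t) (toℕ j₀) o∈T x∉
      -- Going back m - (J₁ + 1) steps reaches (J₁ + 1) t, where the forward arm failed. So the
      -- backward arm stops earlier and the arms do not overlap.
      ... | J₁ , J₁<j₀ , up , fail₁ with firstFail T (_· neg t) (m ∸ suc J₁) o∈T
            (λ q → fail₁ (subst (_∈ₛ T) (trans (opposite (m∸n≤m m (suc J₁))) (cong (_· t) (m∸[m∸n]≡n (≤-trans (≤-trans J₁<j₀ (<⇒≤ (F.toℕ<n j₀))) ≤-refl)))) q))
      ... | J₂ , J₂< , down , fail₂ = J₁ , J₂ , record
        { order = order ; up = up _ ; down = down _ ; exhaust = exhaust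
        ; count = ≤-trans (≤-reflexive (sym card-full)) (card-inj (fullₛ {J₁ + J₂ + 1}) T f (λ {i} _ → f∈ (toℕ i) (F.toℕ<n i)) (λ {i} {i′} _ _ e → F.toℕ-injective (f-inj (toℕ i) (toℕ i′) (F.toℕ<n i) (F.toℕ<n i′) e))) }
        where
          J< : suc (J₁ + J₂ + 1) ≤ m
          J< = ≤-trans (≤-reflexive (cong suc (trans (cong (_+ 1) (+-comm J₁ J₂)) (trans (+-assoc J₂ J₁ 1) (cong (J₂ +_) (+-comm J₁ 1))))))
            (≤-trans (+-monoˡ-≤ (suc J₁) J₂<) (≤-reflexive (m∸n+n≡m (≤-trans J₁<j₀ (<⇒≤ (F.toℕ<n j₀))))))
          -- The arc listed from its lower end: as m t = 0, this is (i - J₂) t.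
          g : ℕ → Fin m
          g i = (m ∸ J₂ + i) · t
          f : Fin (J₁ + J₂ + 1) → Fin m
          f i = g (toℕ i)
          J₂≤m : J₂ ≤ m
          J₂≤m = ≤-trans (<⇒≤ J₂<) (m∸n≤m m (suc J₁))
          f∈ : ∀ i → i < J₁ + J₂ + 1 → g i ∈ₛ T
          f∈ i i< with ≤-total i J₂
          ... | inj₁ le = subst (_∈ₛ T) (trans (opposite (≤-trans (m∸n≤m J₂ i) J₂≤m)) (cong (_· t) (trans (m∸[n∸o]≡o+[m∸n] le) (+-comm i _)))) (down (J₂ ∸ i) (m∸n≤m J₂ i))
            where
              m∸[n∸o]≡o+[m∸n] : i ≤ J₂ → m ∸ (J₂ ∸ i) ≡ i + (m ∸ J₂)
              m∸[n∸o]≡o+[m∸n] le = +-cancelʳ-≡ (J₂ ∸ i) _ _ (trans (m∸n+n≡m (≤-trans (m∸n≤m J₂ i) J₂≤m))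
                (sym (trans (cong (_+ (J₂ ∸ i)) (+-comm i (m ∸ J₂))) (trans (+-assoc (m ∸ J₂) i (J₂ ∸ i)) (trans (cong (m ∸ J₂ +_) (m+[n∸m]≡n le)) (m∸n+n≡m J₂≤m))))))
          ... | inj₂ ge = subst (_∈ₛ T) (sym (trans (cong (_· t) e) (trans (·-+ m (i ∸ J₂) t) (trans (cong (_⊹ (i ∸ J₂) · t) mt) (identityˡ _)))))
                (up (i ∸ J₂) (≤-trans (∸-monoˡ-≤ J₂ (≤-pred (≤-trans i< (≤-reflexive (+-comm _ 1))))) (≤-reflexive (m+n∸n≡m J₁ J₂))))
            where
              e : m ∸ J₂ + i ≡ m + (i ∸ J₂)
              e = trans (cong (m ∸ J₂ +_) (sym (m+[n∸m]≡n ge))) (trans (sym (+-assoc (m ∸ J₂) J₂ (i ∸ J₂))) (cong (_+ (i ∸ J₂)) (m∸n+n≡m J₂≤m)))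
          shift : ∀ {i i′} → g i ≡ g i′ → i · t ≡ i′ · t
          shift {i} {i′} e = ∙-cancelˡ ((m ∸ J₂) · t) _ _ (trans (sym (·-+ (m ∸ J₂) i t)) (trans e (·-+ (m ∸ J₂) i′ t)))
          f-inj : ∀ i i′ → i < J₁ + J₂ + 1 → i′ < J₁ + J₂ + 1 → g i ≡ g i′ → i ≡ i′
          f-inj i i′ i< i′< e with ≤-total i i′
          ... | inj₁ le = distinct le (<-≤-trans i′< (<⇒≤ J<)) (shift e)
          ... | inj₂ ge = sym (distinct ge (<-≤-trans i< (<⇒≤ J<)) (sym (shift e)))
          J₁-end : J₁ · t ∈ₛ ends t
          J₁-end = up J₁ ≤-refl , fail₁
          exhaust : ∀ {x} → x ∈ₛ T → (∃ λ j → j ≤ J₁ × x ≡ j · t) ⊎ (∃ λ j → j ≤ J₂ × x ≡ j · neg t)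
          exhaust {x} x∈ with all x
          ... | j , refl with ≤-<-connex (toℕ j) J₁
          ...   | inj₁ le = inj₁ (toℕ j , le , refl)
          ...   | inj₂ J₁<j with ≤-<-connex (m ∸ J₂) (toℕ j)
          ...     | inj₁ le = inj₂ (m ∸ toℕ j , ≤-trans (∸-monoʳ-≤ m le) (≤-reflexive (m∸[m∸n]≡n J₂≤m)) ,
                    sym (trans (opposite (m∸n≤m m (toℕ j))) (cong (_· t) (m∸[m∸n]≡n (<⇒≤ (F.toℕ<n j))))))
          -- A point of `T` strictly between the arms would lead to a second end before - (J₂ + 1)
          -- t, which lies outside `T`.
          ...     | inj₂ gt with exit ((m ∸ suc J₂) ∸ toℕ j) (toℕ j · t) x∈ (λ q → fail₂ (subst (_∈ₛ T)
                      (trans (sym (·-+ (toℕ j) _ t)) (trans (cong (_· t) (m+[n∸m]≡n le′)) (sym (opposite (≤-trans J₂< (m∸n≤m m (suc J₁))))))) q))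
                    where
                      le′ : toℕ j ≤ m ∸ suc J₂
                      le′ = ≤-trans (<⇒≤pred gt) (≤-reflexive (pred[m∸n]≡m∸[1+n] m J₂))
          ...       | k , k< , e∈ = ⊥-elim (card-≥2-contra)
            where
              le′ : toℕ j ≤ m ∸ suc J₂
              le′ = ≤-trans (<⇒≤pred gt) (≤-reflexive (pred[m∸n]≡m∸[1+n] m J₂))
              jk<m : toℕ j + k < m
              jk<m = <-≤-trans (+-monoʳ-< (toℕ j) k<) (≤-trans (≤-reflexive (m+[n∸m]≡n le′)) (m∸n≤m m (suc J₂)))
              ne : J₁ · t ≢ toℕ j · t ⊹ k · t
              ne e = <⇒≢ (<-≤-trans J₁<j (m≤m+n (toℕ j) k)) (distinct (<⇒≤ (<-≤-trans J₁<j (m≤m+n (toℕ j) k))) jk<m (trans e (sym (·-+ (toℕ j) k t))))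
              card-≥2-contra : ⊥
              card-≥2-contra = <⇒≱ (card-≥2 (ends t) J₁-end e∈ ne) one-end

    arcOrPeriodic : CauchyDavenport → card (ends t) ≤ 1 → Periodic ⊎ (∃ λ J₁ → ∃ λ J₂ → IsArc J₁ J₂)
    arcOrPeriodic CD one-end = [ (λ lt → inj₁ (Proper⟨t⟩.periodic one-end CD lt)) , (λ ge → inj₂ (Full⟨t⟩.arc one-end ge)) ]′ (<-≤-connex η m)

-- Sumsets of finite sets of natural numbers

module IntegerSets where
  open ≡
  open LinearArithmetic
  open FiniteSets using (length-⊆; least)

  InSum : List ℕ → List ℕ → ℕ → Set
  InSum P Q z = ∃ λ p → ∃ λ q → p ∈ P × q ∈ Q × z ≡ p + q

  inSum? : ∀ P Q z → Dec (InSum P Q z)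
  inSum? P Q z = map′
    (λ h → let p , p∈ , h′ = find h ; q , q∈ , e = find h′ in p , q , p∈ , q∈ , e)
    (λ { (p , q , p∈ , q∈ , e) → lose p∈ (lose q∈ e) })
    (any? (λ p → any? (λ q → z ≟ p + q) Q) P)

  -- Sumsets enter only through lists of distinct sums: a lower bound exhibits one, an upper bound
  -- limits the length of all.
  SumList : List ℕ → List ℕ → List ℕ → Set
  SumList P Q zs = Unique zs × (∀ {z} → z ∈ zs → InSum P Q z)

  minimum : ∀ {P : List ℕ} {p} → p ∈ P → ∃ λ u → u ∈ P × (∀ {x} → x ∈ P → u ≤ x)
  minimum {P} = least id P

  maximum : ∀ {P : List ℕ} {p} → p ∈ P → ∃ λ w → w ∈ P × (∀ {x} → x ∈ P → x ≤ w)
  maximum {x ∷ []} _ = x , here refl , λ { (here refl) → ≤-refl }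
  maximum {x ∷ y ∷ P} _ with maximum {y ∷ P} (here refl)
  ... | w , w∈ , h with ≤-total x w
  ... | inj₁ le = w , there w∈ , λ { (here refl) → le ; (there q) → h q }
  ... | inj₂ ge = x , here refl , λ { (here refl) → ≤-refl ; (there q) → ≤-trans (h q) ge }

  without : ℕ → List ℕ → List ℕ
  without p = filter (λ x → ¬? (x ≟ p))

  length-without : ∀ {P} p → Unique P → length P ≤ suc (length (without p P))
  length-without {P} p u = length-⊆ u split
    where
      split : ∀ {x} → x ∈ P → x ∈ p ∷ without p P
      split {x} x∈ with x ≟ p
      ... | yes e = here e
      ... | no ne = there (∈-filter⁺ _ x∈ ne)

  ∈-without⁻ : ∀ P {p x} → x ∈ without p P → x ∈ P × x ≢ p
  ∈-without⁻ P {p} = ∈-filter⁻ (λ x → ¬? (x ≟ p)) {xs = P}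

  -- The sums p + q₀ (p ∈ P) followed by the sums w + q (q ≠ q₀) increase strictly from one family to the other.
  chain : List ℕ → List ℕ → ℕ → ℕ → List ℕ
  chain P Q w q₀ = map (_+ q₀) P ++ map (w +_) (without q₀ Q)

  module _ {P Q : List ℕ} (uP : Unique P) (uQ : Unique Q) {w q₀ : ℕ} (w∈ : w ∈ P) (w-max : ∀ {x} → x ∈ P → x ≤ w)
    (q₀∈ : q₀ ∈ Q) (q₀-min : ∀ {x} → x ∈ Q → q₀ ≤ x) where

    chain-sums : SumList P Q (chain P Q w q₀)
    chain-sums = U.++⁺ (U.map⁺ (+-cancelʳ-≡ q₀ _ _) uP) (U.map⁺ (+-cancelˡ-≡ w _ _) (U.filter⁺ _ uQ)) disj , sums
      where
        disj : ∀ {z} → z ∈ map (_+ q₀) P × z ∈ map (w +_) (without q₀ Q) → ⊥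
        disj (h₁ , h₂) with ∈-map⁻ (_+ q₀) h₁ | ∈-map⁻ (w +_) h₂
        ... | p , p∈ , refl | q , q∈ , e = <⇒≢ (+-mono-≤-< (w-max p∈) (≤∧≢⇒< (q₀-min (proj₁ (∈-without⁻ Q q∈))) (proj₂ (∈-without⁻ Q q∈) ∘ sym))) e
        sums : ∀ {z} → z ∈ chain P Q w q₀ → InSum P Q z
        sums h with ∈-++⁻ (map (_+ q₀) P) h
        ... | inj₁ h₁ = let p , p∈ , e = ∈-map⁻ (_+ q₀) h₁ in p , q₀ , p∈ , q₀∈ , e
        ... | inj₂ h₂ = let q , q∈ , e = ∈-map⁻ (w +_) h₂ in w , q , w∈ , proj₁ (∈-without⁻ Q q∈) , e

    length-chain : length P + length Q ≤ suc (length (chain P Q w q₀))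
    length-chain = lin≤ (length P ∷ length Q ∷ length (chain P Q w q₀) ∷ length (without q₀ Q) ∷ []) (# 0 ⊕ # 1) (s⁺ (# 2))
      ((1 · # 0 ⊕ # 3 ≼ # 2) ∷ (1 · # 1 ≼ s⁺ (# 3)) ∷ [])
      (≤-reflexive (sym (trans (length-++ (map (_+ q₀) P)) (cong₂ _+_ (length-map (_+ q₀) P) (length-map (w +_) (without q₀ Q))))) , length-without q₀ uQ , tt)

    -- Tightness leaves no sum outside the chain. With q₁ = q₀ + τ the second smallest element of Q
    -- and x < w, the sum x + q₁ is below every w + q with q ≠ q₀, so it must be some p + q₀.
    gap-closed : (∀ zs → SumList P Q zs → suc (length zs) ≤ length P + length Q) →
      ∀ {τ} → q₀ + τ ∈ Q → (∀ {x} → x ∈ Q → x ≢ q₀ → q₀ + τ ≤ x) → ∀ {x} → x ∈ P → x ≢ w → x + τ ∈ P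
    gap-closed tight {τ} q₁∈ q₁-min {x} x∈ x≢w = conclude (decidable-stable (any? ((x + (q₀ + τ)) ≟_) (chain P Q w q₀)) λ z∉ →
        <⇒≱ (tight ((x + (q₀ + τ)) ∷ chain P Q w q₀) ((All.tabulate (λ y∈ e → z∉ (subst (_∈ chain P Q w q₀) (sym e) y∈)) ∷ proj₁ chain-sums) ,
          λ { (here e) → x , q₀ + τ , x∈ , q₁∈ , e ; (there h) → proj₂ chain-sums h }))
          length-chain)
      where
        conclude : x + (q₀ + τ) ∈ chain P Q w q₀ → x + τ ∈ P
        conclude h with ∈-++⁻ (map (_+ q₀) P) h
        ... | inj₁ h₁ = let p , p∈ , e = ∈-map⁻ (_+ q₀) h₁ in
              subst (_∈ P) (sym (+-cancelʳ-≡ q₀ (x + τ) p (trans (trans (+-assoc x τ q₀) (cong (x +_) (+-comm τ q₀))) e))) p∈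
        ... | inj₂ h₂ = let q , q∈ , e = ∈-map⁻ (w +_) h₂ in
              ⊥-elim (<⇒≢ (+-mono-<-≤ (≤∧≢⇒< (w-max x∈) x≢w) (q₁-min (proj₁ (∈-without⁻ Q q∈)) (proj₂ (∈-without⁻ Q q∈)))) e)

  sumList : ∀ {P Q} → Unique P → Unique Q → 1 ≤ length P → 1 ≤ length Q →
    ∃ λ zs → SumList P Q zs × length P + length Q ≤ suc (length zs)
  sumList {p ∷ P} {q ∷ Q} uP uQ _ _ with maximum {p ∷ P} (here refl) | minimum {q ∷ Q} (here refl)
  ... | w , w∈ , w-max | q₀ , q₀∈ , q₀-min = chain (p ∷ P) (q ∷ Q) w q₀ , chain-sums uP uQ w∈ w-max q₀∈ q₀-min , length-chain uP uQ w∈ w-max q₀∈ q₀-min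

  InAP : ℕ → ℕ → ℕ → ℕ → Set
  InAP u τ l x = ∃ λ i → i < l × x ≡ u + i * τ

  progression : ℕ → ℕ → ℕ → List ℕ
  progression u τ l = map (λ i → u + i * τ) (upTo l)

  length-progression : ∀ u τ l → length (progression u τ l) ≡ l
  length-progression u τ l = trans (length-map _ (upTo l)) (length-upTo l)

  ∈-progression⁻ : ∀ {u τ l x} → x ∈ progression u τ l → InAP u τ l x
  ∈-progression⁻ {u} {τ} h = let i , i∈ , e = ∈-map⁻ (λ i → u + i * τ) h in i , ∈-upTo⁻ i∈ , e

  ∈-progression⁺ : ∀ {u τ l x} → InAP u τ l x → x ∈ progression u τ l
  ∈-progression⁺ {u} {τ} (i , i< , refl) = ∈-map⁺ (λ i → u + i * τ) (∈-upTo⁺ i<)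

  progression-unique : ∀ u τ l → 0 < τ → Unique (progression u τ l)
  progression-unique u (suc τ) l _ = U.map⁺ (λ {i} {j} e → *-cancelʳ-≡ i j (suc τ) (+-cancelˡ-≡ u _ _ e)) (U.upTo⁺ l)

  -- Climbing by τ from any element ends at w, so every element is a multiple of τ below w and the
  -- climb from the minimum meets them all.
  closed⇒progression : ∀ {P τ w} → Unique P → 0 < τ → w ∈ P → (∀ {x} → x ∈ P → x ≤ w) →
    (∀ {x} → x ∈ P → x ≢ w → x + τ ∈ P) →
    ∃ λ u → (∀ {x} → x ∈ P → InAP u τ (length P) x) × (∀ {x} → InAP u τ (length P) x → x ∈ P)
  closed⇒progression {P} {τ} {w} uP τ>0 w∈ w-max step = describe (minimum w∈)
    where
      climb : ∀ {x} → Acc _<_ (w ∸ x) → x ∈ P → ∃ λ j → x + j * τ ≡ w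
      climb {x} (acc rec) x∈ with x ≟ w
      ... | yes refl = 0 , +-identityʳ x
      ... | no ne with climb (rec (∸-monoʳ-< (m<m+n x τ>0) (w-max (step x∈ ne)))) (step x∈ ne)
      ...   | j , e = suc j , trans (sym (+-assoc x τ (j * τ))) e
      describe : (∃ λ u → u ∈ P × (∀ {x} → x ∈ P → u ≤ x)) → ∃ λ u → (∀ {x} → x ∈ P → InAP u τ (length P) x) × (∀ {x} → InAP u τ (length P) x → x ∈ P)
      describe (u , u∈ , u-min) with climb (<-wellFounded (w ∸ u)) u∈
      ... | J , eJ = u , subst (λ l → ∀ {x} → x ∈ P → InAP u τ l x) len inn , subst (λ l → ∀ {x} → InAP u τ l x → x ∈ P) len (λ { (i , i< , refl) → on i (≤-pred i<) })
        where
          on : ∀ i → i ≤ J → u + i * τ ∈ P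
          on zero _ = subst (_∈ P) (sym (+-identityʳ u)) u∈
          on (suc i) i<J = subst (_∈ P) (trans (+-assoc u (i * τ) τ) (cong (u +_) (+-comm (i * τ) τ)))
            (step (on i (<⇒≤ i<J)) (λ e → <⇒≢ (+-monoʳ-< u (*-monoˡ-< τ {{>-nonZero τ>0}} i<J)) (trans e (sym eJ))))
          inn : ∀ {x} → x ∈ P → InAP u τ (suc J) x
          inn {x} x∈ with climb (<-wellFounded (w ∸ x)) x∈
          ... | j , e = J ∸ j , s≤s (m∸n≤m J j) , +-cancelʳ-≡ (j * τ) x (u + (J ∸ j) * τ) (trans e (trans (sym eJ)
                (sym (trans (+-assoc u _ _) (cong (u +_) (trans (sym (*-distribʳ-+ τ (J ∸ j) j)) (cong (_* τ) (m∸n+n≡m j≤J))))))))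
            where
              j≤J : j ≤ J
              j≤J = ≮⇒≥ λ J<j → <⇒≱ (+-mono-≤-< (u-min x∈) (*-monoˡ-< τ {{>-nonZero τ>0}} J<j)) (≤-reflexive (trans e (sym eJ)))
          len : suc J ≡ length P
          len = ≤-antisym
            (≤-trans (≤-reflexive (sym (length-progression u τ (suc J)))) (length-⊆ (progression-unique u τ (suc J) τ>0) (λ h → let i , i< , e = ∈-progression⁻ h in subst (_∈ P) (sym e) (on i (≤-pred i<)))))
            (≤-trans (length-⊆ uP (λ h → ∈-progression⁺ (inn h))) (≤-reflexive (length-progression u τ (suc J))))

  record BiAP (bs : List ℕ) : Set where
    field
      u₁ u₂ τ l₁ l₂ : ℕ
      τ>0 : 0 < τ
      l₁>0 : 0 < l₁
      l₂>0 : 0 < l₂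
      l₁+l₂ : l₁ + l₂ ≡ length bs
      cover : ∀ {x} → x ∈ bs → InAP u₁ τ l₁ x ⊎ InAP u₂ τ l₂ x
      inside : ∀ {x} → InAP u₁ τ l₁ x ⊎ InAP u₂ τ l₂ x → x ∈ bs

  Small : List ℕ → Set
  Small bs = ∀ zs → SumList bs bs zs → length zs + 3 ≤ 3 * length bs

  module TwoClassSets (bs A₀ A₁ : List ℕ) (u₀ : Unique A₀) (u₁ : Unique A₁)
    (len : length A₀ + length A₁ ≡ length bs) (A₀⊆ : ∀ {x} → x ∈ A₀ → x ∈ bs) (A₁⊆ : ∀ {x} → x ∈ A₁ → x ∈ bs)
    (cover : ∀ {x} → x ∈ bs → x ∈ A₀ ⊎ x ∈ A₁) (small : Small bs) (big : 3 ≤ length bs)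
    (nonempty₀ : 1 ≤ length A₀) (nonempty₁ : 1 ≤ length A₁)
    (d₀₁ : ∀ {z} → InSum A₀ A₀ z → InSum A₀ A₁ z → ⊥) (d₀₂ : ∀ {z} → InSum A₀ A₀ z → InSum A₁ A₁ z → ⊥) (d₁₂ : ∀ {z} → InSum A₀ A₁ z → InSum A₁ A₁ z → ⊥) where

    α₀ α₁ : ℕ
    α₀ = length A₀
    α₁ = length A₁

    -- The least sizes 2α₀ - 1, α₀ + α₁ - 1 and 2α₁ - 1 of the three disjoint sumsets add up to
    -- exactly 3 |bs| - 3, so each of them must be attained.
    total : ∀ {xs ys zs} → SumList A₀ A₀ xs → SumList A₀ A₁ ys → SumList A₁ A₁ zs →
      length xs + (length ys + length zs) + 3 ≤ 3 * α₀ + 3 * α₁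
    total {xs} {ys} {zs} (ux , hx) (uy , hy) (uz , hz) = ≤-trans
      (≤-trans (≤-reflexive (cong (_+ 3) (sym (trans (length-++ xs) (cong (length xs +_) (length-++ ys))))))
        (small (xs ++ (ys ++ zs)) (U.++⁺ ux (U.++⁺ uy uz (λ (p , q) → d₁₂ (hy p) (hz q)))
          (λ (p , q) → [ d₀₁ (hx p) ∘ hy , d₀₂ (hx p) ∘ hz ]′ (∈-++⁻ ys q)) , sums)))
      (≤-reflexive (trans (cong (3 *_) (sym len)) (*-distribˡ-+ 3 α₀ α₁)))
      where
        lift : ∀ {P Q z} → (∀ {x} → x ∈ P → x ∈ bs) → (∀ {x} → x ∈ Q → x ∈ bs) → InSum P Q z → InSum bs bs z
        lift f g (p , q , p∈ , q∈ , e) = p , q , f p∈ , g q∈ , e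
        sums : ∀ {z} → z ∈ xs ++ (ys ++ zs) → InSum bs bs z
        sums h with ∈-++⁻ xs h
        ... | inj₁ q = lift A₀⊆ A₀⊆ (hx q)
        ... | inj₂ q with ∈-++⁻ ys q
        ...   | inj₁ r = lift A₀⊆ A₁⊆ (hy r)
        ...   | inj₂ r = lift A₁⊆ A₁⊆ (hz r)

    c₀₀ = sumList u₀ u₀ nonempty₀ nonempty₀
    c₀₁ = sumList u₀ u₁ nonempty₀ nonempty₁
    c₁₁ = sumList u₁ u₁ nonempty₁ nonempty₁

    tight₀₀ : ∀ xs → SumList A₀ A₀ xs → suc (length xs) ≤ α₀ + α₀
    tight₀₀ xs h = lin≤ (length xs ∷ α₀ ∷ α₁ ∷ length (proj₁ c₀₁) ∷ length (proj₁ c₁₁) ∷ []) (s⁺ (# 0)) (# 1 ⊕ # 1)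
      ((1 · # 0 ⊕ (# 3 ⊕ # 4) ⊕ K 3 ≼ 3 ⊗ # 1 ⊕ 3 ⊗ # 2) ∷ (1 · # 1 ⊕ # 2 ≼ s⁺ (# 3)) ∷ (1 · # 2 ⊕ # 2 ≼ s⁺ (# 4)) ∷ [])
      (total h (proj₁ (proj₂ c₀₁)) (proj₁ (proj₂ c₁₁)) , proj₂ (proj₂ c₀₁) , proj₂ (proj₂ c₁₁) , tt)

    tight₀₁ : ∀ xs → SumList A₀ A₁ xs → suc (length xs) ≤ α₀ + α₁
    tight₀₁ xs h = lin≤ (length xs ∷ α₀ ∷ α₁ ∷ length (proj₁ c₀₀) ∷ length (proj₁ c₁₁) ∷ []) (s⁺ (# 0)) (# 1 ⊕ # 2)
      ((1 · # 3 ⊕ (# 0 ⊕ # 4) ⊕ K 3 ≼ 3 ⊗ # 1 ⊕ 3 ⊗ # 2) ∷ (1 · # 1 ⊕ # 1 ≼ s⁺ (# 3)) ∷ (1 · # 2 ⊕ # 2 ≼ s⁺ (# 4)) ∷ [])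
      (total (proj₁ (proj₂ c₀₀)) h (proj₁ (proj₂ c₁₁)) , proj₂ (proj₂ c₀₀) , proj₂ (proj₂ c₁₁) , tt)

    tight₁₁ : ∀ xs → SumList A₁ A₁ xs → suc (length xs) ≤ α₁ + α₁
    tight₁₁ xs h = lin≤ (length xs ∷ α₀ ∷ α₁ ∷ length (proj₁ c₀₀) ∷ length (proj₁ c₀₁) ∷ []) (s⁺ (# 0)) (# 2 ⊕ # 2)
      ((1 · # 3 ⊕ (# 4 ⊕ # 0) ⊕ K 3 ≼ 3 ⊗ # 1 ⊕ 3 ⊗ # 2) ∷ (1 · # 1 ⊕ # 1 ≼ s⁺ (# 3)) ∷ (1 · # 1 ⊕ # 2 ≼ s⁺ (# 4)) ∷ [])
      (total (proj₁ (proj₂ c₀₀)) (proj₁ (proj₂ c₀₁)) h , proj₂ (proj₂ c₀₀) , proj₂ (proj₂ c₀₁) , tt)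

    tight₁₀ : ∀ xs → SumList A₁ A₀ xs → suc (length xs) ≤ α₁ + α₀
    tight₁₀ xs (u , h) = ≤-trans (tight₀₁ xs (u , λ z∈ → let p , q , p∈ , q∈ , e = h z∈ in q , p , q∈ , p∈ , trans e (+-comm p q))) (≤-reflexive (+-comm α₀ α₁))

    someElement : ∀ {P : List ℕ} → 1 ≤ length P → ∃ λ p → p ∈ P
    someElement {p ∷ P} _ = p , here refl

    module _ {Q : List ℕ} (uQ : Unique Q) (two : 2 ≤ length Q)
      (t₀ : ∀ xs → SumList A₀ Q xs → suc (length xs) ≤ α₀ + length Q)
      (t₁ : ∀ xs → SumList A₁ Q xs → suc (length xs) ≤ α₁ + length Q) where

      -- One gap of Q, between its two smallest elements, serves A₀ and A₁ alike; this gives both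
      -- progressions the same difference.
      fromGap : BiAP bs
      fromGap = build (minimum (proj₂ (someElement (≤-trans (s≤s z≤n) two))))
        where
          build : (∃ λ u → u ∈ Q × (∀ {x} → x ∈ Q → u ≤ x)) → BiAP bs
          build (q₀ , q₀∈ , q₀-min) = build₂ (minimum (proj₂ (someElement (≤-pred (≤-trans two (length-without q₀ uQ))))))
            where
              build₂ : (∃ λ u → u ∈ without q₀ Q × (∀ {x} → x ∈ without q₀ Q → u ≤ x)) → BiAP bs
              build₂ (q₁ , q₁∈ , q₁-min) = record
                { u₁ = proj₁ ap₀ ; u₂ = proj₁ ap₁ ; τ = τ ; l₁ = α₀ ; l₂ = α₁ ; τ>0 = τ>0 ; l₁>0 = nonempty₀ ; l₂>0 = nonempty₁ ; l₁+l₂ = len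
                ; cover = λ h → [ inj₁ ∘ proj₁ (proj₂ ap₀) , inj₂ ∘ proj₁ (proj₂ ap₁) ]′ (cover h)
                ; inside = [ A₀⊆ ∘ proj₂ (proj₂ ap₀) , A₁⊆ ∘ proj₂ (proj₂ ap₁) ]′ }
                where
                  q₀<q₁ : q₀ < q₁
                  q₀<q₁ = ≤∧≢⇒< (q₀-min (proj₁ (∈-without⁻ Q q₁∈))) (proj₂ (∈-without⁻ Q q₁∈) ∘ sym)
                  τ : ℕ
                  τ = q₁ ∸ q₀
                  τ>0 : 0 < τ
                  τ>0 = m<n⇒0<n∸m q₀<q₁
                  q₀+τ : q₀ + τ ≡ q₁
                  q₀+τ = m+[n∸m]≡n (<⇒≤ q₀<q₁)
                  gap∈ : q₀ + τ ∈ Q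
                  gap∈ = subst (_∈ Q) (sym q₀+τ) (proj₁ (∈-without⁻ Q q₁∈))
                  gap-min : ∀ {x} → x ∈ Q → x ≢ q₀ → q₀ + τ ≤ x
                  gap-min x∈ ne = ≤-trans (≤-reflexive q₀+τ) (q₁-min (∈-filter⁺ _ x∈ ne))
                  AP : List ℕ → Set
                  AP P = ∃ λ u → (∀ {x} → x ∈ P → InAP u τ (length P) x) × (∀ {x} → InAP u τ (length P) x → x ∈ P)
                  ap : ∀ {P} → Unique P → 1 ≤ length P → (∀ xs → SumList P Q xs → suc (length xs) ≤ length P + length Q) → AP P
                  ap {P} uP ne t = go (maximum (proj₂ (someElement ne)))
                    where
                      go : (∃ λ w → w ∈ P × (∀ {x} → x ∈ P → x ≤ w)) → AP P
                      go (w , w∈ , w-max) = closed⇒progression uP τ>0 w∈ w-max (gap-closed uP uQ w∈ w-max q₀∈ q₀-min t gap∈ gap-min)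
                  ap₀ = ap u₀ nonempty₀ t₀
                  ap₁ = ap u₁ nonempty₁ t₁

    biAP : BiAP bs
    biAP with ≤-<-connex 2 α₁
    ... | inj₁ two = fromGap u₁ two tight₀₁ tight₁₁
    ... | inj₂ α₁<2 = fromGap u₀ (lin≤ (α₀ ∷ α₁ ∷ length bs ∷ []) (K 2) (# 0) ((1 · K 3 ≼ # 2) ∷ (1 · # 2 ≼ # 0 ⊕ # 1) ∷ (1 · s⁺ (# 1) ≼ K 2) ∷ [])
          (big , ≤-reflexive (sym len) , α₁<2 , tt)) tight₀₀ tight₁₀

-- Reduction modulo the largest element

module ReductionModulo where
  open import Data.Nat.DivMod
  open import Data.Nat.Tactic.RingSolver using (solve-∀)
  open import Data.Nat.Divisibility using (_∣_; m%n≡0⇒n∣m)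
  open import Data.List.Membership.DecPropositional Data.Nat._≟_ using (_∈?_)
  open ≡
  open LinearArithmetic
  open FiniteSets
  open IntegerSets

  module Residues (n : ℕ) where

    m : ℕ
    m = suc n

    abstract
      r : ℕ → Fin m
      r j = j mod m

      toℕ-r : ∀ j → toℕ (r j) ≡ j % m
      toℕ-r j = F.toℕ-fromℕ< (m%n<n j m)

      toℕ-r< : ∀ {j} → j < m → toℕ (r j) ≡ j
      toℕ-r< {j} lt = trans (toℕ-r j) (m<n⇒m%n≡m lt)

      r-toℕ : ∀ x → r (toℕ x) ≡ x
      r-toℕ x = F.toℕ-injective (toℕ-r< (F.toℕ<n x))

      _⊹_ : Fin m → Fin m → Fin m
      x ⊹ y = r (toℕ x + toℕ y)

      o : Fin m
      o = r 0

      neg : Fin m → Fin m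
      neg x = r (m ∸ toℕ x)

      r-+ : ∀ a b → r (a + b) ≡ r a ⊹ r b
      r-+ a b = F.toℕ-injective (trans (toℕ-r (a + b)) (trans (%-distribˡ-+ a b m)
        (sym (trans (toℕ-r (toℕ (r a) + toℕ (r b))) (cong₂ (λ p q → (p + q) % m) (toℕ-r a) (toℕ-r b))))))

      r-m : r m ≡ o
      r-m = F.toℕ-injective (trans (toℕ-r m) (trans (n%n≡0 m) (sym (toℕ-r 0))))

      ⊹-comm : ∀ x y → x ⊹ y ≡ y ⊹ x
      ⊹-comm x y = cong r (+-comm (toℕ x) (toℕ y))

      ⊹-assoc : ∀ x y z → (x ⊹ y) ⊹ z ≡ x ⊹ (y ⊹ z)
      ⊹-assoc x y z = begin
        r (toℕ x + toℕ y) ⊹ z           ≡⟨ cong (r (toℕ x + toℕ y) ⊹_) (sym (r-toℕ z)) ⟩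
        r (toℕ x + toℕ y) ⊹ r (toℕ z)   ≡⟨ sym (r-+ (toℕ x + toℕ y) (toℕ z)) ⟩
        r (toℕ x + toℕ y + toℕ z)       ≡⟨ cong r (+-assoc (toℕ x) (toℕ y) (toℕ z)) ⟩
        r (toℕ x + (toℕ y + toℕ z))     ≡⟨ r-+ (toℕ x) (toℕ y + toℕ z) ⟩
        r (toℕ x) ⊹ (y ⊹ z)             ≡⟨ cong (_⊹ (y ⊹ z)) (r-toℕ x) ⟩
        x ⊹ (y ⊹ z)                     ∎
        where open ≡-Reasoning

      ⊹-identityˡ : ∀ x → o ⊹ x ≡ x
      ⊹-identityˡ x = trans (cong (o ⊹_) (sym (r-toℕ x))) (trans (sym (r-+ 0 (toℕ x))) (r-toℕ x))

      ⊹-inverseˡ : ∀ x → neg x ⊹ x ≡ o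
      ⊹-inverseˡ x = trans (cong (neg x ⊹_) (sym (r-toℕ x))) (trans (sym (r-+ (m ∸ toℕ x) (toℕ x)))
        (trans (cong r (m∸n+n≡m (<⇒≤ (F.toℕ<n x)))) r-m))

      isAbelianGroup : IsAbelianGroup _≡_ _⊹_ o neg
      isAbelianGroup = record
        { isGroup = record
          { isMonoid = record
            { isSemigroup = record { isMagma = record { isEquivalence = isEquivalence ; ∙-cong = cong₂ _⊹_ } ; assoc = ⊹-assoc }
            ; identity = ⊹-identityˡ , λ x → trans (⊹-comm x o) (⊹-identityˡ x) }
          ; inverse = ⊹-inverseˡ , λ x → trans (⊹-comm x (neg x)) (⊹-inverseˡ x)
          ; ⁻¹-cong = cong neg }
        ; comm = ⊹-comm }

      sum-lift : ∀ x y → toℕ x + toℕ y ≡ toℕ (x ⊹ y) ⊎ toℕ x + toℕ y ≡ toℕ (x ⊹ y) + m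
      sum-lift x y with <-≤-connex (toℕ x + toℕ y) m
      ... | inj₁ lt = inj₁ (sym (toℕ-r< {toℕ x + toℕ y} lt))
      ... | inj₂ ge = inj₂ (sym (trans (cong (_+ m) (trans (toℕ-r (toℕ x + toℕ y)) (trans (sym (m≤n⇒[n∸m]%m≡n%m {m} {toℕ x + toℕ y} ge)) (m<n⇒m%n≡m lt)))) (m∸n+n≡m ge)))
        where
          lt : toℕ x + toℕ y ∸ m < m
          lt = ≤-trans (∸-monoˡ-< (+-mono-< (F.toℕ<n x) (F.toℕ<n y)) ge) (≤-reflexive (m+n∸n≡m m m))

      o≡r0 : o ≡ r 0
      o≡r0 = refl

      toℕ-o : toℕ o ≡ 0
      toℕ-o = toℕ-r< {0} (s≤s z≤n)

      neg-lift : ∀ x → x ≢ o → toℕ x + toℕ (neg x) ≡ m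
      neg-lift x x≢o = trans (cong (toℕ x +_) (toℕ-r< (∸-monoʳ-< x>0 (<⇒≤ (F.toℕ<n x))))) (m+[n∸m]≡n (<⇒≤ (F.toℕ<n x)))
        where
          x>0 : 0 < toℕ x
          x>0 = n≢0⇒n>0 λ e → x≢o (F.toℕ-injective (trans e (sym toℕ-o)))

  leastℕ : ∀ {P : ℕ → Set} (P? : ∀ j → Dec (P j)) k → P k → ∃ λ d → d ≤ k × P d × (∀ {j} → j < d → ¬ P j)
  leastℕ {P} P? k pk = go k 0 refl (λ ())
    where
      go : ∀ f d → d + f ≡ k → (∀ {j} → j < d → ¬ P j) → ∃ λ d → d ≤ k × P d × (∀ {j} → j < d → ¬ P j)
      go f d e h with P? d
      ... | yes p = d , ≤-trans (m≤m+n d f) (≤-reflexive e) , p , h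
      go zero d e h | no ¬p = ⊥-elim (¬p (subst P (trans (sym e) (+-identityʳ d)) pk))
      go (suc f) d e h | no ¬p = go f (suc d) (trans (sym (+-suc d f)) e)
        λ {j} lt → [ h , (λ { refl → ¬p }) ]′ (m≤n⇒m<n∨m≡n (≤-pred lt))

  -- Normalised sets whose maximum m is at least 2k - 1

  module Sparse (n : ℕ) (bs : List ℕ) (unique : Unique bs) (0∈ : 0 ∈ bs) (m∈ : suc n ∈ bs)
    (≤m : ∀ {b} → b ∈ bs → b ≤ suc n) (small : Small bs) (k≥11 : 11 ≤ length bs) (sparse : 2 * length bs ≤ suc (suc n))
    (coprime : ∀ d → (∀ {b} → b ∈ bs → d ∣ b) → d ≡ 1) where

    open Residues n
    open Isoperimetry _⊹_ o neg isAbelianGroup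
    open Periodicity _⊹_ o neg isAbelianGroup
    open Arcs _⊹_ o neg isAbelianGroup
    open IsAbelianGroup isAbelianGroup using (identityˡ)
    open import Algebra.Properties.AbelianGroup 𝔾 using (⁻¹-involutive)

    Sum : ℕ → Set
    Sum = InSum bs bs

    -- 0 and m share a residue, so `T` has k - 1 elements; and each b below m lifts its residue
    -- twice, as b + 0 and b + m.
    T B : DSet m
    T .mem x = toℕ x ∈ bs
    T .mem? x = toℕ x ∈? bs
    B .mem y = Sum (toℕ y) × Sum (toℕ y + m)
    B .mem? y = inSum? bs bs (toℕ y) ×-dec inSum? bs bs (toℕ y + m)

    o∈T : o ∈ₛ T
    o∈T = subst (_∈ bs) (sym toℕ-o) 0∈

    open Atoms T o∈T

    T⊆B : T ⊆ₛ B
    T⊆B {x} x∈ = (toℕ x , 0 , x∈ , 0∈ , sym (+-identityʳ _)) , toℕ x , m , x∈ , m∈ , refl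

    r∈T : ∀ {b} → b ∈ bs → r b ∈ₛ T
    r∈T {b} b∈ with m≤n⇒m<n∨m≡n (≤m b∈)
    ... | inj₁ lt = subst (_∈ bs) (sym (toℕ-r< lt)) b∈
    ... | inj₂ refl = subst (_∈ₛ T) (sym r-m) o∈T

    residues : ∀ (X : DSet m) → List ℕ
    residues X = map toℕ (elems X)

    residues-unique : ∀ X → Unique (residues X)
    residues-unique X = U.map⁺ F.toℕ-injective (elems-unique X)

    length-residues : ∀ X → length (residues X) ≡ card X
    length-residues X = trans (length-map toℕ (elems X)) (≤-antisym (elems≤card X) (card≤elems X))

    ∈-residues⁻ : ∀ X {z} → z ∈ residues X → ∃ λ x → x ∈ₛ X × z ≡ toℕ x
    ∈-residues⁻ X h = let x , x∈ , e = ∈-map⁻ toℕ h in x , ∈-elems⁻ X x∈ , e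

    κ+1 : suc κ ≡ length bs
    κ+1 = ≤-antisym
      (≤-trans (≤-reflexive (cong suc (sym (length-residues T))))
        (length-⊆ {xs = m ∷ residues T} (All.tabulate (λ h e → let x , _ , e′ = ∈-residues⁻ T h in <⇒≢ (F.toℕ<n x) (sym (trans e e′))) ∷ residues-unique T)
          (λ { (here refl) → m∈ ; (there h) → let x , x∈ , e = ∈-residues⁻ T h in subst (_∈ bs) (sym e) x∈ })))
      (≤-trans (length-⊆ {ys = m ∷ residues T} unique (λ {b} b∈ → [ (λ lt → there (subst (_∈ residues T) (toℕ-r< lt) (∈-map⁺ toℕ (∈-elems⁺ T (r∈T b∈))))) , here ]′ (m≤n⇒m<n∨m≡n (≤m b∈))))
        (≤-reflexive (cong suc (length-residues T))))

    κ≥10 : 10 ≤ κ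
    κ≥10 = ≤-pred (≤-trans k≥11 (≤-reflexive (sym κ+1)))

    κ<m : suc (2 * κ) ≤ m
    κ<m = lin≤ (κ ∷ length bs ∷ m ∷ []) (s⁺ (2 ⊗ # 0)) (# 2) ((2 · s⁺ (# 0) ≼ # 1) ∷ (1 · 2 ⊗ # 1 ≼ s⁺ (# 2)) ∷ []) (≤-reflexive κ+1 , sparse , tt)

    lower : ∀ {y} → y ∈ₛ T ⊞ T → Sum (toℕ y) ⊎ Sum (toℕ y + m)
    lower (x , x∈ , z , z∈ , refl) with sum-lift x z
    ... | inj₁ e = inj₁ (toℕ x , toℕ z , x∈ , z∈ , sym e)
    ... | inj₂ e = inj₂ (toℕ x , toℕ z , x∈ , z∈ , sym e)

    -- For a residue of T + T the default y + m is a sum too, since then one of the two lifts must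
    -- be.
    rep : Fin m → ℕ
    rep y with inSum? bs bs (toℕ y)
    ... | yes _ = toℕ y
    ... | no _ = toℕ y + m

    rep-spec : ∀ y → (rep y ≡ toℕ y × Sum (toℕ y)) ⊎ (rep y ≡ toℕ y + m × ¬ Sum (toℕ y))
    rep-spec y with inSum? bs bs (toℕ y)
    ... | yes p = inj₁ (refl , p)
    ... | no p = inj₂ (refl , p)

    y+m≢ : ∀ (x y : Fin m) → toℕ x ≢ toℕ y + m
    y+m≢ x y e = <⇒≱ (F.toℕ<n x) (≤-trans (m≤n+m m (toℕ y)) (≤-reflexive (sym e)))

    rep-inj : ∀ {x y} → rep x ≡ rep y → x ≡ y
    rep-inj {x} {y} e with rep-spec x | rep-spec y
    ... | inj₁ (p , _) | inj₁ (q , _) = F.toℕ-injective (trans (sym p) (trans e q))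
    ... | inj₂ (p , _) | inj₂ (q , _) = F.toℕ-injective (+-cancelʳ-≡ m _ _ (trans (sym p) (trans e q)))
    ... | inj₁ (p , _) | inj₂ (q , _) = ⊥-elim (y+m≢ x y (trans (sym p) (trans e q)))
    ... | inj₂ (p , _) | inj₁ (q , _) = ⊥-elim (y+m≢ y x (trans (sym q) (trans (sym e) p)))

    -- 2B contains 2m, one lift of every residue in T + T and a second lift of every residue in B.
    budget : card (T ⊞ T) + card B + 1 ≤ 3 * κ
    budget = lin≤ (card (T ⊞ T) ∷ card B ∷ κ ∷ length bs ∷ length zs ∷ []) (# 0 ⊕ # 1 ⊕ K 1) (3 ⊗ # 2)
      ((1 · # 4 ⊕ K 3 ≼ 3 ⊗ # 3) ∷ (3 · # 3 ≼ s⁺ (# 2)) ∷ (1 · s⁺ (# 0 ⊕ # 1) ≼ # 4) ∷ [])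
      (small zs (uz , sums) , ≤-reflexive (sym κ+1) , ≤-reflexive (sym len) , tt)
      where
        l₁ l₂ zs : List ℕ
        l₁ = map rep (elems (T ⊞ T))
        l₂ = map (_+ m) (residues B)
        zs = m + m ∷ l₁ ++ l₂
        ∈l₁ : ∀ {z} → z ∈ l₁ → ∃ λ y → y ∈ₛ T ⊞ T × z ≡ rep y
        ∈l₁ h = let y , y∈ , e = ∈-map⁻ rep h in y , ∈-elems⁻ (T ⊞ T) y∈ , e
        ∈l₂ : ∀ {z} → z ∈ l₂ → ∃ λ y → y ∈ₛ B × z ≡ toℕ y + m
        ∈l₂ h = let b , b∈ , e = ∈-map⁻ (_+ m) h ; y , y∈ , e′ = ∈-residues⁻ B b∈ in y , y∈ , trans e (cong (_+ m) e′)
        len : length zs ≡ suc (card (T ⊞ T) + card B)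
        len = cong suc (trans (length-++ l₁) (cong₂ _+_ (trans (length-map rep (elems (T ⊞ T))) (≤-antisym (elems≤card (T ⊞ T)) (card≤elems (T ⊞ T)))) (trans (length-map (_+ m) (residues B)) (length-residues B))))
        rep< : ∀ y → rep y < m + m
        rep< y with rep-spec y
        ... | inj₁ (e , _) = subst (_< m + m) (sym e) (<-≤-trans (F.toℕ<n y) (m≤m+n m m))
        ... | inj₂ (e , _) = subst (_< m + m) (sym e) (+-monoˡ-< m (F.toℕ<n y))
        uz : Unique zs
        uz = All.tabulate (λ h e → [ (λ h₁ → let y , _ , e′ = ∈l₁ h₁ in <⇒≢ (rep< y) (sym (trans e e′))) ,
                                     (λ h₂ → let y , _ , e′ = ∈l₂ h₂ in <⇒≢ (+-monoˡ-< m (F.toℕ<n y)) (sym (trans e e′))) ]′ (∈-++⁻ l₁ h))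
           ∷ U.++⁺ (U.map⁺ rep-inj (elems-unique (T ⊞ T))) (U.map⁺ (+-cancelʳ-≡ m _ _) (residues-unique B)) disj
          where
            disj : ∀ {z} → z ∈ l₁ × z ∈ l₂ → ⊥
            disj (h₁ , h₂) with ∈l₁ h₁ | ∈l₂ h₂
            ... | y , _ , refl | y′ , (s , _) , e with rep-spec y
            ...   | inj₁ (e′ , _) = y+m≢ y y′ (trans (sym e′) e)
            ...   | inj₂ (e′ , ¬s) = ¬s (subst Sum (+-cancelʳ-≡ m _ _ (trans (sym e) e′)) s)
        sums : ∀ {z} → z ∈ zs → Sum z
        sums (here e) = m , m , m∈ , m∈ , e
        sums (there h) with ∈-++⁻ l₁ h
        ... | inj₂ h₂ = let y , (_ , s) , e = ∈l₂ h₂ in subst Sum (sym e) s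
        ... | inj₁ h₁ with ∈l₁ h₁
        ...   | y , y∈ , refl with rep-spec y | lower y∈
        ...     | inj₁ (e , s) | _ = subst Sum (sym e) s
        ...     | inj₂ (e , ¬s) | inj₁ s = ⊥-elim (¬s s)
        ...     | inj₂ (e , _) | inj₂ s = subst Sum (sym e) s

    -- As integer sets, P and Q have at least |P| + |Q| - 1 sums. Each residue of P + Q accounts for
    -- one of them, and for a second only if it is in `B`.
    rows : ∀ P Q → P ⊆ₛ T → Q ⊆ₛ T → 1 ≤ card P → 1 ≤ card Q → card P + card Q ≤ 1 + card (P ⊞ Q) + card (B ∩ₛ (P ⊞ Q))
    rows P Q P⊆ Q⊆ p q = from (sumList (residues-unique P) (residues-unique Q) (≤-trans p (≤-reflexive (sym (length-residues P)))) (≤-trans q (≤-reflexive (sym (length-residues Q)))))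
      where
        ys : List (Fin m ⊎ Fin m)
        ys = map inj₁ (elems (P ⊞ Q)) ++ map inj₂ (elems (B ∩ₛ (P ⊞ Q)))
        len : length ys ≤ card (P ⊞ Q) + card (B ∩ₛ (P ⊞ Q))
        len = ≤-trans (≤-reflexive (trans (length-++ (map inj₁ (elems (P ⊞ Q)))) (cong₂ _+_ (length-map inj₁ (elems (P ⊞ Q))) (length-map inj₂ (elems (B ∩ₛ (P ⊞ Q)))))))
          (+-mono-≤ (elems≤card (P ⊞ Q)) (elems≤card (B ∩ₛ (P ⊞ Q))))
        -- The first copy of y takes the upper lift only if the lower one is no sum of `bs`, which
        -- keeps two lifts from sharing a copy.
        R : ℕ → Fin m ⊎ Fin m → Set
        R z (inj₁ y) = z ≡ toℕ y ⊎ (z ≡ toℕ y + m × ¬ Sum (toℕ y))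
        R z (inj₂ y) = z ≡ toℕ y + m
        from : (∃ λ zs → SumList (residues P) (residues Q) zs × length (residues P) + length (residues Q) ≤ suc (length zs)) → card P + card Q ≤ 1 + card (P ⊞ Q) + card (B ∩ₛ (P ⊞ Q))
        from (zs , (uz , hz) , long) = ≤-trans (≤-reflexive (sym (cong₂ _+_ (length-residues P) (length-residues Q))))
            (≤-trans long (s≤s (≤-trans (pigeonhole R zs ys uz target injective) len)))
          where
            split : ∀ {z} → z ∈ zs → Sum z × ∃ λ y → y ∈ₛ P ⊞ Q × (z ≡ toℕ y ⊎ z ≡ toℕ y + m)
            split z∈ with hz z∈
            ... | a , b , a∈ , b∈ , refl with ∈-residues⁻ P a∈ | ∈-residues⁻ Q b∈
            ... | x , x∈ , refl | x′ , x′∈ , refl = (toℕ x , toℕ x′ , P⊆ x∈ , Q⊆ x′∈ , refl) , x ⊹ x′ , (x , x∈ , x′ , x′∈ , refl) , sum-lift x x′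
            target : ∀ {z} → z ∈ zs → ∃ λ y → y ∈ ys × R z y
            target z∈ with split z∈
            ... | s , y , y∈ , inj₁ e = inj₁ y , ∈-++⁺ˡ (∈-map⁺ inj₁ (∈-elems⁺ (P ⊞ Q) y∈)) , inj₁ e
            ... | s , y , y∈ , inj₂ e with inSum? bs bs (toℕ y)
            ...   | yes s′ = inj₂ y , ∈-++⁺ʳ (map inj₁ (elems (P ⊞ Q))) (∈-map⁺ inj₂ (∈-elems⁺ (B ∩ₛ (P ⊞ Q)) ((s′ , subst Sum e s) , y∈))) , e
            ...   | no ¬s = inj₁ y , ∈-++⁺ˡ (∈-map⁺ inj₁ (∈-elems⁺ (P ⊞ Q) y∈)) , inj₂ (e , ¬s)
            injective : ∀ {z z′ y} → z ∈ zs → z′ ∈ zs → R z y → R z′ y → z ≡ z′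
            injective {y = inj₁ y} _ _ (inj₁ e) (inj₁ e′) = trans e (sym e′)
            injective {y = inj₁ y} _ _ (inj₂ (e , _)) (inj₂ (e′ , _)) = trans e (sym e′)
            injective {y = inj₁ y} z∈ _ (inj₁ e) (inj₂ (_ , ¬s)) = ⊥-elim (¬s (subst Sum e (proj₁ (split z∈))))
            injective {y = inj₁ y} _ z∈ (inj₂ (_ , ¬s)) (inj₁ e) = ⊥-elim (¬s (subst Sum e (proj₁ (split z∈))))
            injective {y = inj₂ y} _ _ e e′ = trans e (sym e′)

    -- If H contained `T`, the least d ≥ 1 with residue in H would divide every element of `bs`, by
    -- division with remainder. Coprimality makes it 1, and H would be everything.
    generates : ∀ H → IsSub H → card H < m → ∃ λ x → x ∈ₛ T × x ∉ₛ H
    generates H isSub H<m with ⊆ₛ? T H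
    ... | inj₁ h = h
    ... | inj₂ T⊆H = ⊥-elim (fromGenerator (leastℕ (λ d → (1 ≤? d) ×-dec mem? H (r d)) m (s≤s z≤n , subst (_∈ₛ H) (sym r-m) (IsSub.o∈ isSub))))
      where
        open IsSub isSub
        fromGenerator : (∃ λ d → d ≤ m × (1 ≤ d × r d ∈ₛ H) × (∀ {j} → j < d → ¬ (1 ≤ j × r j ∈ₛ H))) → ⊥
        fromGenerator (suc d , _ , (_ , d∈) , d-least) = <⇒≱ H<m (≤-trans (≤-reflexive (sym card-full)) (card-mono fullₛ H λ {x} _ → subst (_∈ₛ H) (r-toℕ x) (all (toℕ x))))
          where
            mult : ∀ q → r (q * suc d) ∈ₛ H
            mult zero = subst (_∈ₛ H) o≡r0 o∈
            mult (suc q) = subst (_∈ₛ H) (sym (r-+ (suc d) (q * suc d))) (add d∈ (mult q))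
            dvd : ∀ {b} → r b ∈ₛ H → suc d ∣ b
            dvd {b} b∈ = m%n≡0⇒n∣m b (suc d) (n≤0⇒n≡0 (≮⇒≥ λ pos → d-least (m%n<n b (suc d)) (pos ,
              subst (_∈ₛ H) (trans (cong (_⊝ r (b / suc d * suc d)) (trans (cong r (m≡m%n+[m/n]*n b (suc d))) (r-+ (b % suc d) _))) (x+g-g (r (b % suc d)) _)) (sub b∈ (mult (b / suc d))))))
            d≡1 : suc d ≡ 1
            d≡1 = coprime (suc d) (λ b∈ → dvd (T⊆H (r∈T b∈)))
            all : ∀ x → r x ∈ₛ H
            all x = subst (λ y → r y ∈ₛ H) (trans (cong (x *_) d≡1) (*-identityʳ x)) (mult x)

    ofPeriodic : Periodic → BiAP bs
    ofPeriodic per = byClasses (PeriodicCase.twoClasses T B o∈T T⊆B κ≥10 κ<m budget rows generates per)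
      where
        byClasses : PeriodicCase.TwoClasses T B o∈T T⊆B κ≥10 κ<m budget rows generates per → BiAP bs
        byClasses tc = TwoClassSets.biAP bs A₀ A₁ (U.filter⁺ in₀? unique) (U.filter⁺ in₁? unique) len (proj₁ ∘ ∈A₀) (proj₁ ∘ ∈A₁) cover small
            (≤-trans (s≤s (s≤s (s≤s z≤n))) k≥11) (∈-length (∈-filter⁺ in₀? 0∈ (subst (_~ o) o≡r0 ~-refl))) (∈-length (∈-filter⁺ in₁? a∈T (λ p → a∉V (~o⇒∈H (subst (_~ o) (r-toℕ a) p)))))
            (λ p q → a∉V (~o⇒∈H (~-trans (~-sym (sum₀₁ q)) (sum₀₀ p))))
            (λ p q → a+a∉V (~o⇒∈H (~-trans (~-sym (sum₁₁ q)) (sum₀₀ p))))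
            (λ p q → a∉V (~o⇒∈H (cancel-a (~-trans (~-sym (sum₁₁ q)) (sum₀₁ p)))))
          where
            open PeriodicCase.TwoClasses tc
            open Cosets V V-sub
            in₀? : ∀ b → Dec (r b ~ o)
            in₀? b = r b ~? o
            in₁? : ∀ b → Dec (¬ r b ~ o)
            in₁? b = ¬? (in₀? b)
            A₀ A₁ : List ℕ
            A₀ = filter in₀? bs
            A₁ = filter in₁? bs
            ∈A₀ : ∀ {x} → x ∈ A₀ → x ∈ bs × r x ~ o
            ∈A₀ = ∈-filter⁻ in₀? {xs = bs}
            ∈A₁ : ∀ {x} → x ∈ A₁ → x ∈ bs × ¬ r x ~ o
            ∈A₁ = ∈-filter⁻ in₁? {xs = bs}
            cover : ∀ {x} → x ∈ bs → x ∈ A₀ ⊎ x ∈ A₁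
            cover {x} x∈ with in₀? x
            ... | yes p = inj₁ (∈-filter⁺ in₀? x∈ p)
            ... | no p = inj₂ (∈-filter⁺ in₁? x∈ p)
            len : length A₀ + length A₁ ≡ length bs
            len = trans (sym (length-++ A₀)) (≤-antisym
              (length-⊆ (U.++⁺ (U.filter⁺ in₀? unique) (U.filter⁺ in₁? unique) (λ (p , q) → proj₂ (∈A₁ q) (proj₂ (∈A₀ p)))) (λ h → [ proj₁ ∘ ∈A₀ , proj₁ ∘ ∈A₁ ]′ (∈-++⁻ A₀ h)))
              (length-⊆ unique (λ h → [ ∈-++⁺ˡ , ∈-++⁺ʳ A₀ ]′ (cover h))))
            class₁ : ∀ {x} → x ∈ A₁ → r x ~ a
            class₁ {x} h with classes (r∈T (proj₁ (∈A₁ h)))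
            ... | inj₁ p = ⊥-elim (proj₂ (∈A₁ h) (∈H⇒~o p))
            ... | inj₂ p = p
            sum₀₀ : ∀ {z} → InSum A₀ A₀ z → r z ~ o
            sum₀₀ (x , y , x∈ , y∈ , refl) = ~-trans (~-≡ (r-+ x y)) (~-trans (~-+ (proj₂ (∈A₀ x∈)) (proj₂ (∈A₀ y∈))) (~-≡ (identityˡ o)))
            sum₀₁ : ∀ {z} → InSum A₀ A₁ z → r z ~ a
            sum₀₁ (x , y , x∈ , y∈ , refl) = ~-trans (~-≡ (r-+ x y)) (~-trans (~-+ (proj₂ (∈A₀ x∈)) (class₁ y∈)) (~-≡ (identityˡ a)))
            sum₁₁ : ∀ {z} → InSum A₁ A₁ z → r z ~ a ⊹ a
            sum₁₁ (x , y , x∈ , y∈ , refl) = ~-trans (~-≡ (r-+ x y)) (~-+ (class₁ x∈) (class₁ y∈))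
            cancel-a : a ⊹ a ~ a → a ~ o
            cancel-a p = ~-trans (~-≡ (sym (x+g-g a a))) (~-trans (~-+ʳ (neg a) p) (~-≡ (IsAbelianGroup.inverseʳ isAbelianGroup a)))

    -- The progressions grow from 0 and from m. As they cover `bs`, the hypothesis on J₁ + J₂ forces
    -- their lengths to add up to |bs|.
    twoProgressions : ∀ J₁ J₂ ξ → 0 < ξ → J₁ + J₂ + 1 ≤ κ → (∀ {j} → j ≤ J₁ → j * ξ ∈ bs) → (∀ {j} → j ≤ J₂ → ∃ λ z → z ∈ bs × z + j * ξ ≡ m) →
      (∀ {b} → b ∈ bs → (∃ λ j → j ≤ J₁ × b ≡ j * ξ) ⊎ (∃ λ j → j ≤ J₂ × b + j * ξ ≡ m)) → BiAP bs
    twoProgressions J₁ J₂ ξ ξ>0 count up down exhaust = record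
      { u₁ = 0 ; u₂ = m ∸ J₂ * ξ ; τ = ξ ; l₁ = suc J₁ ; l₂ = suc J₂ ; τ>0 = ξ>0 ; l₁>0 = s≤s z≤n ; l₂>0 = s≤s z≤n
      ; l₁+l₂ = ≤-antisym
          (lin≤ (J₁ ∷ J₂ ∷ κ ∷ length bs ∷ []) (s⁺ (# 0) ⊕ s⁺ (# 1)) (# 3) ((1 · # 0 ⊕ # 1 ⊕ K 1 ≼ # 2) ∷ (1 · s⁺ (# 2) ≼ # 3) ∷ []) (count , ≤-reflexive κ+1 , tt))
          (≤-trans (length-⊆ unique (λ h → [ ∈-++⁺ˡ ∘ ∈-progression⁺ , ∈-++⁺ʳ (progression 0 ξ (suc J₁)) ∘ ∈-progression⁺ ]′ (cover h)))
            (≤-reflexive (trans (length-++ (progression 0 ξ (suc J₁))) (cong₂ _+_ (length-progression 0 ξ (suc J₁)) (length-progression (m ∸ J₂ * ξ) ξ (suc J₂))))))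
      ; cover = cover
      ; inside = λ { (inj₁ (i , s≤s le , refl)) → up le ; (inj₂ (i , s≤s le , e)) → inside₂ i le e } }
      where
        J₂ξ≤m : J₂ * ξ ≤ m
        J₂ξ≤m = let z , _ , e = down ≤-refl in ≤-trans (m≤n+m (J₂ * ξ) z) (≤-reflexive e)
        top : ∀ {j} → j ≤ J₂ → (m ∸ J₂ * ξ) + (J₂ ∸ j) * ξ + j * ξ ≡ m
        top {j} le = trans (+-assoc (m ∸ J₂ * ξ) _ _) (trans (cong (m ∸ J₂ * ξ +_) (trans (sym (*-distribʳ-+ ξ (J₂ ∸ j) j)) (cong (_* ξ) (m∸n+n≡m le)))) (m∸n+n≡m J₂ξ≤m))
        cover : ∀ {x} → x ∈ bs → InAP 0 ξ (suc J₁) x ⊎ InAP (m ∸ J₂ * ξ) ξ (suc J₂) x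
        cover {x} x∈ with exhaust x∈
        ... | inj₁ (j , le , e) = inj₁ (j , s≤s le , e)
        ... | inj₂ (j , le , e) = inj₂ (J₂ ∸ j , s≤s (m∸n≤m J₂ j) , +-cancelʳ-≡ (j * ξ) _ _ (trans e (sym (top le))))
        inside₂ : ∀ {x} i → i ≤ J₂ → x ≡ m ∸ J₂ * ξ + i * ξ → x ∈ bs
        inside₂ {x} i le e with down (m∸n≤m J₂ i)
        ... | z , z∈ , e′ = subst (_∈ bs) (+-cancelʳ-≡ ((J₂ ∸ i) * ξ) z x (trans e′ (sym (trans (cong (_+ (J₂ ∸ i) * ξ) e)
                (trans (cong (λ j → m ∸ J₂ * ξ + j * ξ + (J₂ ∸ i) * ξ) (sym (m∸[m∸n]≡n le))) (top (m∸n≤m J₂ i))))))) z∈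

    module OfArc (CD : CauchyDavenport) (t : Fin m) (t≢o : t ≢ o) where
      open ArcCase T o∈T κ<m t t≢o using (IsArc)

      -- Cauchy–Davenport uses up the whole budget on T + T, so a residue outside T has only one lift in 2B.
      B⊆T : B ⊆ₛ T
      B⊆T = ⊆-card T B T⊆B (lin≤ (card (T ⊞ T) ∷ card B ∷ κ ∷ []) (# 1) (# 2)
        ((1 · # 0 ⊕ # 1 ⊕ K 1 ≼ 3 ⊗ # 2) ∷ (1 · # 2 ⊕ # 2 ≼ # 0 ⊕ K 1) ∷ []) (budget , CD T T-proper , tt))
        where
          T-proper : Proper T
          T-proper = ≤-trans (s≤s z≤n) κ≥10 , lin≤ (card (T ⊞ T) ∷ card B ∷ κ ∷ m ∷ []) (s⁺ (# 0)) (# 3)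
            ((1 · # 0 ⊕ # 1 ⊕ K 1 ≼ 3 ⊗ # 2) ∷ (1 · # 2 ≼ # 1) ∷ (1 · s⁺ (2 ⊗ # 2) ≼ # 3) ∷ [])
            (budget , card-mono T B T⊆B , κ<m , tt)

      -- A residue outside `T` is not in `B`, so it has at most one lift that is a sum, and an
      -- equation of residues becomes one of integers.
      rigid : ∀ {x y x′ y′} → x ∈ₛ T → y ∈ₛ T → x′ ∈ₛ T → y′ ∈ₛ T → x ⊹ y ≡ x′ ⊹ y′ → x ⊹ y ∉ₛ T → toℕ x + toℕ y ≡ toℕ x′ + toℕ y′
      rigid {x} {y} {x′} {y′} x∈ y∈ x′∈ y′∈ e ∉T with sum-lift x y | sum-lift x′ y′
      ... | inj₁ p | inj₁ q = trans p (trans (cong toℕ e) (sym q))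
      ... | inj₂ p | inj₂ q = trans p (trans (cong (λ w → toℕ w + m) e) (sym q))
      ... | inj₁ p | inj₂ q = ⊥-elim (∉T (B⊆T ((toℕ x , toℕ y , x∈ , y∈ , sym p) , toℕ x′ , toℕ y′ , x′∈ , y′∈ , trans (cong (λ w → toℕ w + m) e) (sym q))))
      ... | inj₂ p | inj₁ q = ⊥-elim (∉T (B⊆T ((toℕ x′ , toℕ y′ , x′∈ , y′∈ , trans (cong toℕ e) (sym q)) , toℕ x , toℕ y , x∈ , y∈ , sym p)))

      -- With ξ = toℕ s, the lifts of the multiples go up from 0 in steps of ξ or down from m in
      -- steps of m - ξ. The latter omits j = 0, which lifts to 0 and not to m.
      Rising Falling : Fin m → ℕ → Set
      Rising s J = ∀ {j} → j ≤ J → toℕ (j · s) ≡ j * toℕ s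
      Falling s J = ∀ {j} → 1 ≤ j → j ≤ J → toℕ (j · s) + j * toℕ (neg s) ≡ m

      rising₁ : ∀ s {J} → J ≤ 1 → Rising s J
      rising₁ s J≤1 {zero} _ = toℕ-o
      rising₁ s J≤1 {suc zero} _ = trans (cong toℕ (identityˡ s)) (sym (+-identityʳ (toℕ s)))
      rising₁ s J≤1 {suc (suc j)} le = ⊥-elim (<⇒≱ (≤-trans (s≤s (s≤s z≤n)) le) J≤1)

      falling₁ : ∀ s {J} → s ≢ o → J ≤ 1 → Falling s J
      falling₁ s s≢o J≤1 {suc zero} _ _ = trans (cong₂ _+_ (cong toℕ (identityˡ s)) (+-identityʳ (toℕ (neg s)))) (neg-lift s s≢o)
      falling₁ s s≢o J≤1 {suc (suc j)} _ le = ⊥-elim (<⇒≱ (≤-trans (s≤s (s≤s z≤n)) le) J≤1)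

      -- js + Js = (j + 1)s + (J - 1)s lies outside `T`, so by `rigid` all steps between consecutive
      -- lifts from s on equal the last one. That is toℕ s or toℕ s - m, according to whether the
      -- last addition wraps round.
      monotone : ∀ s J → s ≢ o → (∀ {j} → j ≤ J → j · s ∈ₛ T) → (∀ {j} → 1 ≤ j → j < J → (j + J) · s ∉ₛ T) → Rising s J ⊎ Falling s J
      monotone s zero s≢o on off = inj₁ (rising₁ s z≤n)
      monotone s (suc zero) s≢o on off = inj₁ (rising₁ s ≤-refl)
      monotone s (suc (suc J)) s≢o on off = byLast (sum-lift (suc J · s) s)
        where
          J⁺ : ℕ
          J⁺ = suc (suc J)
          same : ∀ {j} → 1 ≤ j → j < J⁺ → toℕ (j · s) + toℕ (J⁺ · s) ≡ toℕ (suc j · s) + toℕ (suc J · s)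
          same {j} j≥1 j<J = rigid (on (<⇒≤ j<J)) (on ≤-refl) (on j<J) (on (n≤1+n _))
            (trans (sym (·-+ j J⁺ s)) (trans (cong (_· s) (+-suc j (suc J))) (·-+ (suc j) (suc J) s)))
            (λ q → off j≥1 j<J (subst (_∈ₛ T) (sym (·-+ j J⁺ s)) q))
          byLast : toℕ (suc J · s) + toℕ s ≡ toℕ (J⁺ · s) ⊎ toℕ (suc J · s) + toℕ s ≡ toℕ (J⁺ · s) + m → Rising s J⁺ ⊎ Falling s J⁺
          byLast (inj₁ e) = inj₁ rise
            where
              rise : Rising s J⁺
              rise {zero} _ = toℕ-o
              rise {suc zero} _ = rising₁ s ≤-refl {1} ≤-refl
              rise {suc (suc j)} le = +-cancelʳ-≡ (toℕ (suc J · s)) _ _ (begin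
                toℕ (suc (suc j) · s) + toℕ (suc J · s)            ≡⟨ sym (same (s≤s z≤n) le) ⟩
                toℕ (suc j · s) + toℕ (J⁺ · s)                     ≡⟨ cong₂ _+_ (rise (<⇒≤ le)) (sym e) ⟩
                suc j * toℕ s + (toℕ (suc J · s) + toℕ s)          ≡⟨ cong (suc j * toℕ s +_) (+-comm _ (toℕ s)) ⟩
                suc j * toℕ s + (toℕ s + toℕ (suc J · s))          ≡⟨ sym (+-assoc (suc j * toℕ s) (toℕ s) _) ⟩
                suc j * toℕ s + toℕ s + toℕ (suc J · s)            ≡⟨ cong (_+ toℕ (suc J · s)) (+-comm (suc j * toℕ s) (toℕ s)) ⟩
                suc (suc j) * toℕ s + toℕ (suc J · s)              ∎)
                where open ≡-Reasoning
          byLast (inj₂ e) = inj₂ fall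
            where
              fall : Falling s J⁺
              fall {suc zero} p q = falling₁ s s≢o ≤-refl p ≤-refl
              fall {suc (suc j)} _ le = +-cancelʳ-≡ (toℕ (suc J · s) + toℕ s) _ _ (begin
                a₂ + suc (suc j) * ζ + (aJ + ξ)       ≡⟨ shuffle₁ a₂ (suc j * ζ) ζ aJ ξ ⟩
                a₂ + aJ + (suc j * ζ + (ξ + ζ))       ≡⟨ cong₂ (λ p q → p + (suc j * ζ + q)) (sym (same (s≤s z≤n) le)) (neg-lift s s≢o) ⟩
                a₁ + aL + (suc j * ζ + m)             ≡⟨ shuffle₂ a₁ aL (suc j * ζ) m ⟩
                a₁ + suc j * ζ + (aL + m)             ≡⟨ cong₂ _+_ (fall (s≤s z≤n) (<⇒≤ le)) (sym e) ⟩
                m + (aJ + ξ)                          ∎)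
                where
                  open ≡-Reasoning
                  ξ ζ a₁ a₂ aJ aL : ℕ
                  ξ = toℕ s
                  ζ = toℕ (neg s)
                  a₁ = toℕ (suc j · s)
                  a₂ = toℕ (suc (suc j) · s)
                  aJ = toℕ (suc J · s)
                  aL = toℕ (J⁺ · s)
                  shuffle₁ : ∀ a b z c x → a + (z + b) + (c + x) ≡ a + c + (b + (x + z))
                  shuffle₁ = solve-∀
                  shuffle₂ : ∀ a b c d → a + b + (c + d) ≡ a + c + (b + d)
                  shuffle₂ = solve-∀

      module _ {J₁ J₂ : ℕ} (arc : IsArc J₁ J₂) where
        open IsArc arc

        neg-neg : neg (neg t) ≡ t
        neg-neg = ⁻¹-involutive t

        nt≢o : neg t ≢ o
        nt≢o e = t≢o (trans (sym neg-neg) (trans (cong neg e) (trans (sym (identityˡ (neg o))) (IsAbelianGroup.inverseʳ isAbelianGroup o))))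

        neg-o : neg o ≡ o
        neg-o = trans (sym (identityˡ (neg o))) (IsAbelianGroup.inverseʳ isAbelianGroup o)

        toℕ>0 : ∀ {x} → x ≢ o → 0 < toℕ x
        toℕ>0 x≢o = n≢0⇒n>0 λ e → x≢o (F.toℕ-injective (trans e (sym toℕ-o)))

        vanish : ∀ i j → i · t ≡ j · neg t → (i + j) · t ≡ o
        vanish i j e = trans (·-+ i j t) (trans (cong (_⊹ j · t) (trans e (·-neg j t))) (⊹-inverseˡ (j · t)))

        -- j + J₁ steps lead beyond the forward arm but, as j + J₁ + J₂ < m, not round to the
        -- backward one.
        off₁ : ∀ {j} → 1 ≤ j → j < J₁ → (j + J₁) · t ∉ₛ T
        off₁ {j} j≥1 j<J q with exhaust q
        ... | inj₁ (i , i≤ , e) = order {j + J₁ ∸ i} (m<n⇒0<n∸m (≤-<-trans i≤ (m<n+m J₁ j≥1)))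
              (≤-<-trans (m∸n≤m _ i) (lin≤ (j ∷ J₁ ∷ J₂ ∷ κ ∷ m ∷ []) (s⁺ (# 0 ⊕ # 1)) (# 4) ((1 · s⁺ (# 0) ≼ # 1) ∷ (2 · # 1 ⊕ # 2 ⊕ K 1 ≼ # 3) ∷ (1 · s⁺ (2 ⊗ # 3) ≼ # 4) ∷ []) (j<J , count , κ<m , tt)))
              (·-cancel i (j + J₁ ∸ i) t (trans (sym e) (cong (_· t) (sym (m+[n∸m]≡n (≤-trans i≤ (m≤n+m J₁ j)))))))
        ... | inj₂ (i , i≤ , e) = order {j + J₁ + i} (≤-trans j≥1 (≤-trans (m≤m+n j J₁) (m≤m+n (j + J₁) i)))
              (lin≤ (j ∷ J₁ ∷ J₂ ∷ κ ∷ m ∷ i ∷ []) (s⁺ (# 0 ⊕ # 1 ⊕ # 5)) (# 4) ((1 · s⁺ (# 0) ≼ # 1) ∷ (2 · # 1 ⊕ # 2 ⊕ K 1 ≼ # 3) ∷ (1 · s⁺ (2 ⊗ # 3) ≼ # 4) ∷ (1 · # 5 ≼ # 2) ∷ []) (j<J , count , κ<m , i≤ , tt))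
              (vanish (j + J₁) i e)

        off₂ : ∀ {j} → 1 ≤ j → j < J₂ → (j + J₂) · neg t ∉ₛ T
        off₂ {j} j≥1 j<J q with exhaust q
        ... | inj₂ (i , i≤ , e) = order {j + J₂ ∸ i} (m<n⇒0<n∸m (≤-<-trans i≤ (m<n+m J₂ j≥1)))
              (≤-<-trans (m∸n≤m _ i) (lin≤ (j ∷ J₁ ∷ J₂ ∷ κ ∷ m ∷ []) (s⁺ (# 0 ⊕ # 2)) (# 4) ((1 · s⁺ (# 0) ≼ # 2) ∷ (2 · # 1 ⊕ # 2 ⊕ K 1 ≼ # 3) ∷ (1 · s⁺ (2 ⊗ # 3) ≼ # 4) ∷ []) (j<J , count , κ<m , tt)))
              (trans (sym (⁻¹-involutive _)) (trans (cong neg (trans (sym (·-neg (j + J₂ ∸ i) t)) zero′)) neg-o))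
          where
            zero′ : (j + J₂ ∸ i) · neg t ≡ o
            zero′ = ·-cancel i (j + J₂ ∸ i) (neg t) (trans (sym e) (cong (_· neg t) (sym (m+[n∸m]≡n (≤-trans i≤ (m≤n+m J₂ j))))))
        ... | inj₁ (i , i≤ , e) = order {i + (j + J₂)} (≤-trans j≥1 (≤-trans (m≤m+n j J₂) (m≤n+m (j + J₂) i)))
              (lin≤ (j ∷ J₁ ∷ J₂ ∷ κ ∷ m ∷ i ∷ []) (s⁺ (# 5 ⊕ (# 0 ⊕ # 2))) (# 4) ((1 · s⁺ (# 0) ≼ # 2) ∷ (2 · # 1 ⊕ # 2 ⊕ K 1 ≼ # 3) ∷ (1 · s⁺ (2 ⊗ # 3) ≼ # 4) ∷ (1 · # 5 ≼ # 1) ∷ []) (j<J , count , κ<m , i≤ , tt))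
              (vanish i (j + J₂) (sym e))

        straight : Rising t J₁ → Falling (neg t) J₂ → BiAP bs
        straight rise fall = twoProgressions J₁ J₂ (toℕ t) (toℕ>0 t≢o) count
          (λ le → subst (_∈ bs) (rise le) (up le))
          (λ { {zero} _ → m , m∈ , +-identityʳ m ; {suc j} le → toℕ (suc j · neg t) , down le , trans (cong (λ x → toℕ (suc j · neg t) + suc j * toℕ x) (sym neg-neg)) (fall (s≤s z≤n) le) })
          λ {b} b∈ → place b∈ (m≤n⇒m<n∨m≡n (≤m b∈))
          where
            place : ∀ {b} → b ∈ bs → b < m ⊎ b ≡ m → (∃ λ j → j ≤ J₁ × b ≡ j * toℕ t) ⊎ (∃ λ j → j ≤ J₂ × b + j * toℕ t ≡ m)
            place b∈ (inj₂ e) = inj₂ (0 , z≤n , trans (+-identityʳ _) e)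
            place {b} b∈ (inj₁ lt) with exhaust (r∈T b∈)
            ... | inj₁ (j , le , e) = inj₁ (j , le , trans (sym (toℕ-r< lt)) (trans (cong toℕ e) (rise le)))
            ... | inj₂ (zero , le , e) = inj₁ (0 , z≤n , trans (sym (toℕ-r< lt)) (trans (cong toℕ e) toℕ-o))
            ... | inj₂ (suc j , le , e) = inj₂ (suc j , le , trans (cong₂ (λ p q → p + suc j * toℕ q) (trans (sym (toℕ-r< lt)) (cong toℕ e)) (sym neg-neg)) (fall (s≤s z≤n) le))

        crossed : Falling t J₁ → Rising (neg t) J₂ → BiAP bs
        crossed fall rise = twoProgressions J₂ J₁ (toℕ (neg t)) (toℕ>0 nt≢o) (≤-trans (≤-reflexive (cong (_+ 1) (+-comm J₂ J₁))) count)
          (λ le → subst (_∈ bs) (rise le) (down le))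
          (λ { {zero} _ → m , m∈ , +-identityʳ m ; {suc j} le → toℕ (suc j · t) , up le , fall (s≤s z≤n) le })
          λ {b} b∈ → place b∈ (m≤n⇒m<n∨m≡n (≤m b∈))
          where
            place : ∀ {b} → b ∈ bs → b < m ⊎ b ≡ m → (∃ λ j → j ≤ J₂ × b ≡ j * toℕ (neg t)) ⊎ (∃ λ j → j ≤ J₁ × b + j * toℕ (neg t) ≡ m)
            place b∈ (inj₂ e) = inj₂ (0 , z≤n , trans (+-identityʳ _) e)
            place {b} b∈ (inj₁ lt) with exhaust (r∈T b∈)
            ... | inj₂ (j , le , e) = inj₁ (j , le , trans (sym (toℕ-r< lt)) (trans (cong toℕ e) (rise le)))
            ... | inj₁ (zero , le , e) = inj₁ (0 , z≤n , trans (sym (toℕ-r< lt)) (trans (cong toℕ e) toℕ-o))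
            ... | inj₁ (suc j , le , e) = inj₂ (suc j , le , trans (cong (_+ suc j * toℕ (neg t)) (trans (sym (toℕ-r< lt)) (cong toℕ e))) (fall (s≤s z≤n) le))

        -- The two arms of the arc cannot both rise, or both fall, past their first step: t and - t lift to ξ and m - ξ.
        biAP : BiAP bs
        biAP = combine (monotone t J₁ t≢o up off₁) (monotone (neg t) J₂ nt≢o down off₂)
          where
            ξ+ζ : toℕ t + toℕ (neg t) ≡ m
            ξ+ζ = neg-lift t t≢o
            combine : Rising t J₁ ⊎ Falling t J₁ → Rising (neg t) J₂ ⊎ Falling (neg t) J₂ → BiAP bs
            combine (inj₁ rise) (inj₂ fall) = straight rise fall
            combine (inj₂ fall) (inj₁ rise) = crossed fall rise
            combine (inj₁ rise₁) (inj₁ rise₂) with ≤-<-connex J₁ 1 | ≤-<-connex J₂ 1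
            ... | inj₁ le | _ = crossed (falling₁ t t≢o le) rise₂
            ... | inj₂ _ | inj₁ le = straight rise₁ (falling₁ (neg t) nt≢o le)
            ... | inj₂ J₁≥2 | inj₂ J₂≥2 = ⊥-elim (lin⊥ (toℕ t ∷ toℕ (neg t) ∷ m ∷ toℕ (2 · t) ∷ toℕ (2 · neg t) ∷ [])
                  ((2 · # 2 ≼ # 0 ⊕ # 1) ∷ (1 · 2 ⊗ # 0 ≼ # 3) ∷ (1 · 2 ⊗ # 1 ≼ # 4) ∷ (1 · s⁺ (# 3) ≼ # 2) ∷ (1 · s⁺ (# 4) ≼ # 2) ∷ [])
                  (≤-reflexive (sym ξ+ζ) , ≤-reflexive (sym (rise₁ J₁≥2)) , ≤-reflexive (sym (rise₂ J₂≥2)) , F.toℕ<n (2 · t) , F.toℕ<n (2 · neg t) , tt))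
            combine (inj₂ fall₁) (inj₂ fall₂) with ≤-<-connex J₁ 1 | ≤-<-connex J₂ 1
            ... | inj₁ le | _ = straight (rising₁ t le) fall₂
            ... | inj₂ _ | inj₁ le = crossed fall₁ (rising₁ (neg t) le)
            ... | inj₂ J₁≥2 | inj₂ J₂≥2 = ⊥-elim (order {2} (s≤s z≤n) (lin≤ (κ ∷ m ∷ []) (K 3) (# 1) ((2 · K 10 ≼ # 0) ∷ (1 · s⁺ (2 ⊗ # 0) ≼ # 1) ∷ []) (κ≥10 , κ<m , tt))
                  (F.toℕ-injective (trans (n≤0⇒n≡0 (lin≤ (toℕ t ∷ toℕ (neg t) ∷ m ∷ toℕ (2 · t) ∷ toℕ (2 · neg t) ∷ toℕ (neg (neg t)) ∷ []) (# 3) (K 0)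
                    ((2 · # 2 ≼ # 0 ⊕ # 1) ∷ (1 · # 3 ⊕ 2 ⊗ # 1 ≼ # 2) ∷ (1 · # 4 ⊕ 2 ⊗ # 5 ≼ # 2) ∷ (2 · # 0 ≼ # 5) ∷ [])
                    (≤-reflexive (sym ξ+ζ) , ≤-reflexive (fall₁ (s≤s z≤n) J₁≥2) , ≤-reflexive (fall₂ (s≤s z≤n) J₂≥2) , ≤-reflexive (cong toℕ (sym neg-neg)) , tt))) (sym toℕ-o))))

    biAP : BiAP bs
    biAP = [ ofPeriodic , (λ { (CD , t , t≢o , one-end) → [ ofPeriodic , (λ (J₁ , J₂ , arc) → OfArc.biAP CD t t≢o arc) ]′ (ArcCase.arcOrPeriodic T o∈T κ<m t t≢o CD one-end) }) ]′
      (Atoms.Structure.structure T o∈T κ≥10 κ<m (lin≤ (card (T ⊞ T) ∷ card B ∷ κ ∷ []) (# 0 ⊕ K 1) (2 ⊗ # 2)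
        ((1 · # 0 ⊕ # 1 ⊕ K 1 ≼ 3 ⊗ # 2) ∷ (1 · # 2 ≼ # 1) ∷ []) (budget , card-mono T B T⊆B , tt)))

-- Natural numbers: a short progression or two progressions

module IntegerTheorem where
  open import Data.Nat.Divisibility
  open import Data.Nat.GCD using (gcd; gcd[m,n]∣m; gcd[m,n]∣n; gcd-greatest)
  open import Data.List.Membership.DecPropositional Data.Nat._≟_ using (_∈?_)
  open import Data.Nat.DivMod using (_/_; m/n*n≡m)
  open ≡
  open LinearArithmetic
  open FiniteSets using (pigeonhole)
  open IntegerSets
  open ReductionModulo

  -- Indices up to 2k - 2 mean length 2k - 1. The pair a, a + g realises the difference inside the
  -- set, so that a quotient of two elements of S can serve as ratio.
  record Dense (bs : List ℕ) : Set where
    field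
      g : ℕ
      index : ∀ {b} → b ∈ bs → ∃ λ i → b ≡ i * g × i + 2 ≤ 2 * length bs
      a : ℕ
      a∈ : a ∈ bs
      a+g∈ : a + g ∈ bs

  private
    ⌊/2⌋-twins : ∀ a b → ⌊ a /2⌋ ≡ ⌊ b /2⌋ → a < b → suc a ≡ b
    ⌊/2⌋-twins zero (suc zero) _ _ = refl
    ⌊/2⌋-twins (suc zero) (suc zero) _ (s≤s ())
    ⌊/2⌋-twins (suc (suc a)) (suc zero) () _
    ⌊/2⌋-twins zero (suc (suc b)) () _
    ⌊/2⌋-twins (suc zero) (suc (suc b)) () _
    ⌊/2⌋-twins (suc (suc a)) (suc (suc b)) e (s≤s (s≤s lt)) = cong (suc ∘ suc) (⌊/2⌋-twins a b (suc-injective e) lt)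

    ⌊/2⌋-< : ∀ a l → a < 2 * l → ⌊ a /2⌋ < l
    ⌊/2⌋-< a zero ()
    ⌊/2⌋-< zero (suc l) _ = s≤s z≤n
    ⌊/2⌋-< (suc zero) (suc l) _ = s≤s z≤n
    ⌊/2⌋-< (suc (suc a)) (suc l) lt = s≤s (⌊/2⌋-< a l (≤-pred (≤-pred (≤-trans lt (≤-reflexive (*-suc 2 l))))))

    ⌊/2⌋-≥ : ∀ a l → 2 * l ≤ a → l ≤ ⌊ a /2⌋
    ⌊/2⌋-≥ a zero _ = z≤n
    ⌊/2⌋-≥ zero (suc l) ()
    ⌊/2⌋-≥ (suc zero) (suc l) le = ⊥-elim (<⇒≱ (s≤s (s≤s z≤n)) (≤-trans (≤-reflexive (sym (*-suc 2 l))) le))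
    ⌊/2⌋-≥ (suc (suc a)) (suc l) le = s≤s (⌊/2⌋-≥ a l (≤-pred (≤-pred (≤-trans (≤-reflexive (sym (*-suc 2 l))) le))))

  -- Splitting at an odd element 2q + 1, pair the numbers below it as {0,1}, {2,3}, … and the others as {2q+1,2q+2}, …
  twins : ∀ cs → Unique cs → 1 ≤ length cs → (∀ {c} → c ∈ cs → c + 2 ≤ 2 * length cs) → ∀ q → suc (2 * q) ∈ cs →
    ¬ (∃ λ c → c ∈ cs × suc c ∈ cs) → ⊥
  twins cs unique k≥1 bound q q∈ none = <⇒≱ short (pigeonhole R cs (upTo (length cs ∸ 1)) unique target injective)
    where
      k : ℕ
      k = length cs
      short : length (upTo (k ∸ 1)) < k
      short = ≤-trans (s≤s (≤-reflexive (length-upTo (k ∸ 1)))) (≤-reflexive (trans (+-comm 1 (k ∸ 1)) (m∸n+n≡m k≥1)))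
      R : ℕ → ℕ → Set
      R c y = (c < 2 * q × y ≡ ⌊ c /2⌋) ⊎ (∃ λ c′ → c ≡ suc c′ × 2 * q ≤ c′ × y ≡ ⌊ c′ /2⌋)
      apart : ∀ {a b} → a ∈ cs → b ∈ cs → ⌊ a /2⌋ ≡ ⌊ b /2⌋ → a ≡ b
      apart {a} {b} a∈ b∈ e with <-cmp a b
      ... | tri< lt _ _ = ⊥-elim (none (a , a∈ , subst (_∈ cs) (sym (⌊/2⌋-twins a b e lt)) b∈))
      ... | tri≈ _ eq _ = eq
      ... | tri> _ _ gt = ⊥-elim (none (b , b∈ , subst (_∈ cs) (sym (⌊/2⌋-twins b a (sym e) gt)) a∈))
      apart⁺ : ∀ {a b} → suc a ∈ cs → suc b ∈ cs → ⌊ a /2⌋ ≡ ⌊ b /2⌋ → a ≡ b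
      apart⁺ {a} {b} a∈ b∈ e with <-cmp a b
      ... | tri< lt _ _ = ⊥-elim (none (suc a , a∈ , subst (λ x → suc x ∈ cs) (sym (⌊/2⌋-twins a b e lt)) b∈))
      ... | tri≈ _ eq _ = eq
      ... | tri> _ _ gt = ⊥-elim (none (suc b , b∈ , subst (λ x → suc x ∈ cs) (sym (⌊/2⌋-twins b a (sym e) gt)) a∈))
      target : ∀ {c} → c ∈ cs → ∃ λ y → y ∈ upTo (k ∸ 1) × R c y
      target {c} c∈ with <-cmp c (2 * q)
      ... | tri< lt _ _ = ⌊ c /2⌋ , ∈-upTo⁺ (<-≤-trans (⌊/2⌋-< c q lt) q≤) , inj₁ (lt , refl)
        where
          q≤ : q ≤ k ∸ 1
          q≤ = *-cancelˡ-≤ 2 (lin≤ (q ∷ k ∷ k ∸ 1 ∷ []) (2 ⊗ # 0) (2 ⊗ # 2) ((1 · s⁺ (2 ⊗ # 0) ⊕ K 2 ≼ 2 ⊗ # 1) ∷ (2 · # 1 ≼ # 2 ⊕ K 1) ∷ [])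
            (bound q∈ , ≤-reflexive (sym (m∸n+n≡m k≥1)) , tt))
      ... | tri≈ _ refl _ = ⊥-elim (none (2 * q , c∈ , q∈))
      target {suc c} c∈ | tri> _ _ (s≤s ge) = ⌊ c /2⌋ , ∈-upTo⁺ (⌊/2⌋-< c (k ∸ 1)
          (lin≤ (c ∷ k ∷ k ∸ 1 ∷ []) (s⁺ (# 0)) (2 ⊗ # 2) ((1 · s⁺ (# 0) ⊕ K 2 ≼ 2 ⊗ # 1) ∷ (2 · # 1 ≼ # 2 ⊕ K 1) ∷ []) (bound c∈ , ≤-reflexive (sym (m∸n+n≡m k≥1)) , tt))) ,
        inj₂ (c , refl , ge , refl)
      injective : ∀ {c c′ y} → c ∈ cs → c′ ∈ cs → R c y → R c′ y → c ≡ c′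
      injective c∈ c′∈ (inj₁ (_ , e)) (inj₁ (_ , e′)) = apart c∈ c′∈ (trans (sym e) e′)
      injective c∈ c′∈ (inj₂ (a , refl , _ , e)) (inj₂ (b , refl , _ , e′)) = cong suc (apart⁺ c∈ c′∈ (trans (sym e) e′))
      injective {c} _ _ (inj₁ (lt , e)) (inj₂ (b , refl , ge , e′)) = ⊥-elim (<⇒≱ (⌊/2⌋-< c q lt) (≤-trans (⌊/2⌋-≥ b q ge) (≤-reflexive (trans (sym e′) e))))
      injective {_} {c} _ _ (inj₂ (b , refl , ge , e′)) (inj₁ (lt , e)) = ⊥-elim (<⇒≱ (⌊/2⌋-< c q lt) (≤-trans (⌊/2⌋-≥ b q ge) (≤-reflexive (trans (sym e′) e))))

  evenOrOdd : ∀ c → 2 ∣ c ⊎ ∃ λ q → c ≡ suc (2 * q)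
  evenOrOdd zero = inj₁ (2 ∣0)
  evenOrOdd (suc zero) = inj₂ (0 , refl)
  evenOrOdd (suc (suc c)) with evenOrOdd c
  ... | inj₁ d = inj₁ (∣m∣n⇒∣m+n (∣-refl {2}) d)
  ... | inj₂ (q , refl) = inj₂ (suc q , cong suc (sym (*-suc 2 q)))

  module _ (bs : List ℕ) (unique : Unique bs) (0∈ : 0 ∈ bs) (small : Small bs) (k≥11 : 11 ≤ length bs) where

    private
      content : List ℕ → ℕ
      content = foldr gcd 0

      content∣ : ∀ {b} xs → b ∈ xs → content xs ∣ b
      content∣ (x ∷ xs) (here refl) = gcd[m,n]∣m x (content xs)
      content∣ (x ∷ xs) (there b∈) = ∣-trans (gcd[m,n]∣n x (content xs)) (content∣ xs b∈)

      ∣content : ∀ {d} xs → (∀ {b} → b ∈ xs → d ∣ b) → d ∣ content xs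
      ∣content [] h = _ ∣0
      ∣content (x ∷ xs) h = gcd-greatest (h (here refl)) (∣content xs (h ∘ there))

      module Normalised (w : ℕ) (w∈ : w ∈ bs) (w-max : ∀ {x} → x ∈ bs → x ≤ w) (g : ℕ) (g≡ : g ≡ content bs) {{_ : NonZero g}} where

        quot : ℕ → ℕ
        quot b = b / g

        quot* : ∀ {b} → b ∈ bs → b ≡ quot b * g
        quot* {b} b∈ = sym (m/n*n≡m (subst (_∣ b) (sym g≡) (content∣ bs b∈)))

        cs : List ℕ
        cs = map quot bs

        length-cs : length cs ≡ length bs
        length-cs = length-map quot bs

        ∈cs⁻ : ∀ {c} → c ∈ cs → c * g ∈ bs
        ∈cs⁻ h with ∈-map⁻ quot h
        ... | b , b∈ , refl = subst (_∈ bs) (quot* b∈) b∈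

        ∈cs⁺ : ∀ {c} → c * g ∈ bs → c ∈ cs
        ∈cs⁺ {c} h = subst (_∈ cs) (*-cancelʳ-≡ _ _ g (sym (quot* h))) (∈-map⁺ quot h)

        cs-unique : Unique cs
        cs-unique = unique-map bs unique (λ b∈ → b∈)
          where
            unique-map : ∀ xs → Unique xs → (∀ {x} → x ∈ xs → x ∈ bs) → Unique (map quot xs)
            unique-map [] _ _ = []
            unique-map (x ∷ xs) (x∉ ∷ u) f = All.tabulate (λ h e → let y , y∈ , e′ = ∈-map⁻ quot h in
                All.lookup x∉ y∈ (trans (quot* (f (here refl))) (trans (cong (_* g) (trans e e′)) (sym (quot* (f (there y∈))))))) ∷ unique-map xs u (f ∘ there)

        cs-small : Small cs
        cs-small zs (uz , hz) = subst₂ (λ a b → a + 3 ≤ 3 * b) (length-map (_* g) zs) (sym length-cs)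
          (small (map (_* g) zs) (U.map⁺ (λ {a} {b} → *-cancelʳ-≡ a b g) uz , λ h → let z , z∈ , e = ∈-map⁻ (_* g) h ; a , b , a∈ , b∈ , e′ = hz z∈ in
            a * g , b * g , ∈cs⁻ a∈ , ∈cs⁻ b∈ , trans e (trans (cong (_* g) e′) (*-distribʳ-+ g a b))))

        cs-coprime : ∀ d → (∀ {c} → c ∈ cs → d ∣ c) → d ≡ 1
        cs-coprime d h = ∣1⇒≡1 (*-cancelʳ-∣ g (subst (d * g ∣_) (sym (*-identityˡ g)) (subst (d * g ∣_) (sym g≡)
          (∣content bs (λ b∈ → subst (d * g ∣_) (sym (quot* b∈)) (*-monoˡ-∣ g (h (∈-map⁺ quot b∈))))))))

        scale : BiAP cs → BiAP bs
        scale ap = record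
          { u₁ = u₁ * g ; u₂ = u₂ * g ; τ = τ * g ; l₁ = l₁ ; l₂ = l₂
          ; τ>0 = *-mono-≤ τ>0 (>-nonZero⁻¹ g) ; l₁>0 = l₁>0 ; l₂>0 = l₂>0 ; l₁+l₂ = trans l₁+l₂ length-cs
          ; cover = λ b∈ → Sum.map (up (quot* b∈)) (up (quot* b∈)) (cover (∈-map⁺ quot b∈))
          ; inside = [ down inj₁ , down inj₂ ]′ }
          where
            open BiAP ap
            expand : ∀ u i → (u + i * τ) * g ≡ u * g + i * (τ * g)
            expand u i = trans (*-distribʳ-+ g u (i * τ)) (cong (u * g +_) (*-assoc i τ g))
            up : ∀ {b c u l} → b ≡ c * g → InAP u τ l c → InAP (u * g) (τ * g) l b
            up {u = u} e (i , i< , e′) = i , i< , trans e (trans (cong (_* g) e′) (expand u i))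
            down : ∀ {u l b} → (∀ {c} → InAP u τ l c → InAP u₁ τ l₁ c ⊎ InAP u₂ τ l₂ c) → InAP (u * g) (τ * g) l b → b ∈ bs
            down {u} f (i , i< , e) = subst (_∈ bs) (sym (trans e (sym (expand u i)))) (∈cs⁻ (inside (f (i , i< , refl))))

        dense : quot w + 2 ≤ 2 * length bs → Dense bs
        dense bound = pairUp (any? (λ c → suc c ∈? cs) cs)
          where
            quot≤ : ∀ {b} → b ∈ bs → quot b ≤ quot w
            quot≤ b∈ = *-cancelʳ-≤ _ _ g (subst₂ _≤_ (quot* b∈) (quot* w∈) (w-max b∈))
            cs-bound : ∀ {c} → c ∈ cs → c + 2 ≤ 2 * length cs
            cs-bound h with ∈-map⁻ quot h
            ... | b , b∈ , refl = ≤-trans (+-monoˡ-≤ 2 (quot≤ b∈)) (≤-trans bound (≤-reflexive (cong (2 *_) (sym length-cs))))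
            pairUp : _ → Dense bs
            pairUp (yes h) = let c , c∈ , sc∈ = find h in record
              { g = g ; index = λ b∈ → _ , quot* b∈ , ≤-trans (+-monoˡ-≤ 2 (quot≤ b∈)) bound
              ; a = c * g ; a∈ = ∈cs⁻ c∈ ; a+g∈ = subst (_∈ bs) (+-comm g (c * g)) (∈cs⁻ sc∈) }
            -- Without consecutive elements `twins` excludes odd ones, and 2 would divide a coprime
            -- set.
            pairUp (no none) = ⊥-elim (2≢1 (cs-coprime 2 λ {c} c∈ → [ (λ d → d) , (λ { (q , refl) →
                ⊥-elim (twins cs cs-unique (≤-trans (≤-trans (s≤s z≤n) k≥11) (≤-reflexive (sym length-cs))) cs-bound q c∈ (λ (c , c∈ , sc∈) → none (lose c∈ sc∈))) }) ]′ (evenOrOdd c)))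
              where
                2≢1 : 2 ≢ 1
                2≢1 ()

        result : Dense bs ⊎ BiAP bs
        result with ≤-<-connex (quot w + 2) (2 * length bs)
        ... | inj₁ bound = inj₁ (dense bound)
        ... | inj₂ large = inj₂ (scale (sparse (quot w) refl))
          where
            sparse : ∀ c → quot w ≡ c → BiAP cs
            sparse zero e = ⊥-elim (lin⊥ (quot w ∷ length bs ∷ []) ((1 · s⁺ (2 ⊗ # 1) ≼ # 0 ⊕ K 2) ∷ (1 · # 0 ≼ K 0) ∷ (2 · K 11 ≼ # 1) ∷ []) (large , ≤-reflexive e , k≥11 , tt))
            sparse (suc n) e = Sparse.biAP n cs cs-unique (∈cs⁺ 0∈) (subst (_∈ cs) e (∈-map⁺ quot w∈))
              (λ h → bounded h) cs-small (≤-trans k≥11 (≤-reflexive (sym length-cs)))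
              (≤-trans (≤-reflexive (cong (2 *_) length-cs)) (lin≤ (quot w ∷ length bs ∷ n ∷ []) (2 ⊗ # 1) (s⁺ (s⁺ (# 2))) ((1 · s⁺ (2 ⊗ # 1) ≼ # 0 ⊕ K 2) ∷ (1 · # 0 ≼ s⁺ (# 2)) ∷ []) (large , ≤-reflexive e , tt)))
              cs-coprime
              where
                bounded : ∀ {c} → c ∈ cs → c ≤ suc n
                bounded h with ∈-map⁻ quot h
                ... | b , b∈ , refl = ≤-trans (*-cancelʳ-≤ _ _ g (subst₂ _≤_ (quot* b∈) (quot* w∈) (w-max b∈))) (≤-reflexive e)

    denseOrBiAP : Dense bs ⊎ BiAP bs
    denseOrBiAP = go (maximum 0∈)
      where
        go : (∃ λ w → w ∈ bs × (∀ {x} → x ∈ bs → x ≤ w)) → Dense bs ⊎ BiAP bs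
        go (w , w∈ , w-max) = Normalised.result w w∈ w-max (content bs) refl {{≢-nonZero g≢0}}
          where
            w≢0 : ∀ xs → Unique xs → (∀ {x} → x ∈ xs → x ∈ bs) → 2 ≤ length xs → w ≢ 0
            w≢0 (x ∷ y ∷ _) ((ne All.∷ _) ∷ _) f _ refl = ne (trans (n≤0⇒n≡0 (w-max (f (here refl)))) (sym (n≤0⇒n≡0 (w-max (f (there (here refl)))))))
            w≢0 (x ∷ []) _ _ (s≤s ())
            g≢0 : content bs ≢ 0
            g≢0 e = w≢0 bs unique (λ h → h) (≤-trans (s≤s (s≤s z≤n)) k≥11) (0∣⇒≡0 (subst (_∣ w) e (content∣ bs w∈)))

-- Integer models of finite sets in torsion-free abelian groups

module FreimanModel {c ℓ} (𝔸 : AbelianGroup c ℓ) where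
  open AbelianGroup 𝔸 renaming (Carrier to A)
  open import Algebra.Properties.AbelianGroup 𝔸
  open import Algebra.Properties.CommutativeMonoid.Mult commutativeMonoid renaming (_×_ to _×ⁿ_)
  open import Relation.Binary.Reasoning.Setoid setoid

  import Data.Nat.Divisibility as ℕD
  open import Data.Integer as ℤ using (ℤ; +_; -[1+_]; _⊖_; ∣_∣)
  import Data.Integer.Properties as ℤP
  import Data.Nat.Tactic.RingSolver as NatSolver
  open import Data.Integer.Tactic.RingSolver using (solve-∀)
  open import Data.Fin using (zero; suc)

  -- The shape in which the model is read back: a weighted relation with four terms, solved for a
  -- term of a progression with ratio x ∙ y ⁻¹.
  ratio : ∀ n {x y u z} → n ×ⁿ x ∙ 1 ×ⁿ u ≈ n ×ⁿ y ∙ 1 ×ⁿ z → z ≈ u ∙ n ×ⁿ (x ∙ y ⁻¹)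
  ratio n {x} {y} {u} {z} e = ∙-cancelˡ (n ×ⁿ y) z (u ∙ n ×ⁿ (x ∙ y ⁻¹)) (begin
    n ×ⁿ y ∙ z                              ≈⟨ ∙-congˡ (sym (×-homo-1 z)) ⟩
    n ×ⁿ y ∙ 1 ×ⁿ z                         ≈⟨ sym e ⟩
    n ×ⁿ x ∙ 1 ×ⁿ u                         ≈⟨ ∙-cong (×-congʳ n (sym x∙y⁻¹∙y)) (×-homo-1 u) ⟩
    n ×ⁿ ((x ∙ y ⁻¹) ∙ y) ∙ u               ≈⟨ ∙-congʳ (×-distrib-+ (x ∙ y ⁻¹) y n) ⟩
    (n ×ⁿ (x ∙ y ⁻¹) ∙ n ×ⁿ y) ∙ u          ≈⟨ ∙-congʳ (comm _ _) ⟩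
    (n ×ⁿ y ∙ n ×ⁿ (x ∙ y ⁻¹)) ∙ u          ≈⟨ assoc _ _ _ ⟩
    n ×ⁿ y ∙ (n ×ⁿ (x ∙ y ⁻¹) ∙ u)          ≈⟨ ∙-congˡ (comm _ _) ⟩
    n ×ⁿ y ∙ (u ∙ n ×ⁿ (x ∙ y ⁻¹))          ∎)
    where
      x∙y⁻¹∙y : (x ∙ y ⁻¹) ∙ y ≈ x
      x∙y⁻¹∙y = trans (assoc x (y ⁻¹) y) (trans (∙-congˡ (inverseˡ y)) (identityʳ x))

  scal : ℤ → A → A
  scal (+ n) x = n ×ⁿ x
  scal -[1+ n ] x = (suc n ×ⁿ x) ⁻¹

  scal-cong : ∀ i {x y} → x ≈ y → scal i x ≈ scal i y
  scal-cong (+ n) e = ×-congʳ n e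
  scal-cong -[1+ n ] e = ⁻¹-cong (×-congʳ (suc n) e)

  scal-⊖ : ∀ m n x → scal (m ⊖ n) x ≈ m ×ⁿ x ∙ (n ×ⁿ x) ⁻¹
  scal-⊖ zero zero x = sym (inverseʳ ε)
  scal-⊖ zero (suc n) x = sym (identityˡ _)
  scal-⊖ (suc m) zero x = sym (trans (∙-congˡ ε⁻¹≈ε) (identityʳ _))
  scal-⊖ (suc m) (suc n) x = begin
    scal (suc m ⊖ suc n) x             ≡⟨ cong (λ i → scal i x) (ℤP.[1+m]⊖[1+n]≡m⊖n m n) ⟩
    scal (m ⊖ n) x                     ≈⟨ scal-⊖ m n x ⟩
    m ×ⁿ x ∙ (n ×ⁿ x) ⁻¹               ≈⟨ ∙-congʳ (sym (trans (sym (assoc _ _ _)) (trans (∙-congʳ (inverseˡ x)) (identityˡ _)))) ⟩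
    (x ⁻¹ ∙ (x ∙ m ×ⁿ x)) ∙ (n ×ⁿ x) ⁻¹ ≈⟨ trans (∙-congʳ (comm _ _)) (assoc _ _ _) ⟩
    (x ∙ m ×ⁿ x) ∙ (x ⁻¹ ∙ (n ×ⁿ x) ⁻¹) ≈⟨ ∙-congˡ (⁻¹-∙-comm x (n ×ⁿ x)) ⟩
    (x ∙ m ×ⁿ x) ∙ (x ∙ n ×ⁿ x) ⁻¹      ∎

  scal-+ : ∀ i j x → scal (i ℤ.+ j) x ≈ scal i x ∙ scal j x
  scal-+ (+ m) (+ n) x = ×-homo-+ x m n
  scal-+ (+ m) -[1+ n ] x = scal-⊖ m (suc n) x
  scal-+ -[1+ m ] (+ n) x = trans (scal-⊖ n (suc m) x) (comm _ _)
  scal-+ -[1+ m ] -[1+ n ] x = trans (⁻¹-cong (trans (×-congˡ {x} (≡.sym (cong suc (ℕP.+-suc m n)))) (×-homo-+ x (suc m) (suc n)))) (sym (⁻¹-∙-comm _ _))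

  scal-neg : ∀ i x → scal (ℤ.- i) x ≈ (scal i x) ⁻¹
  scal-neg (+ zero) x = sym ε⁻¹≈ε
  scal-neg (+ suc n) x = refl
  scal-neg -[1+ n ] x = sym (⁻¹-involutive _)

  scal-∙ : ∀ i x y → scal i (x ∙ y) ≈ scal i x ∙ scal i y
  scal-∙ (+ n) x y = ×-distrib-+ x y n
  scal-∙ -[1+ n ] x y = trans (⁻¹-cong (×-distrib-+ x y (suc n))) (sym (⁻¹-∙-comm _ _))

  scal-ε : ∀ i → scal i ε ≈ ε
  scal-ε i = identityʳ-unique (scal i ε) (scal i ε) (sym (trans (scal-cong i (sym (identityˡ ε))) (scal-∙ i ε ε)))

  scal-⁻¹ : ∀ i x → scal i (x ⁻¹) ≈ (scal i x) ⁻¹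
  scal-⁻¹ i x = inverseʳ-unique (scal i x) (scal i (x ⁻¹)) (trans (sym (scal-∙ i x (x ⁻¹))) (trans (scal-cong i (inverseʳ x)) (scal-ε i)))

  scal-*⁺ : ∀ m j x → scal (+ m ℤ.* j) x ≈ scal (+ m) (scal j x)
  scal-*⁺ zero j x = refl
  scal-*⁺ (suc m) j x = begin
    scal (+ suc m ℤ.* j) x                ≡⟨ cong (λ i → scal i x) (ℤP.suc-* (+ m) j) ⟩
    scal (j ℤ.+ + m ℤ.* j) x              ≈⟨ scal-+ j (+ m ℤ.* j) x ⟩
    scal j x ∙ scal (+ m ℤ.* j) x         ≈⟨ ∙-congˡ (scal-*⁺ m j x) ⟩
    scal j x ∙ scal (+ m) (scal j x)      ∎

  scal-* : ∀ i j x → scal (i ℤ.* j) x ≈ scal i (scal j x)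
  scal-* (+ m) j x = scal-*⁺ m j x
  scal-* -[1+ m ] j x = begin
    scal (-[1+ m ] ℤ.* j) x               ≡⟨ cong (λ i → scal i x) (≡.sym (ℤP.neg-distribˡ-* (+ suc m) j)) ⟩
    scal (ℤ.- (+ suc m ℤ.* j)) x          ≈⟨ scal-neg (+ suc m ℤ.* j) x ⟩
    (scal (+ suc m ℤ.* j) x) ⁻¹           ≈⟨ ⁻¹-cong (scal-*⁺ (suc m) j x) ⟩
    (scal (+ suc m) (scal j x)) ⁻¹        ∎

  comb : ∀ {d} → (Fin d → ℤ) → (Fin d → A) → A
  comb {zero} v g = ε
  comb {suc d} v g = scal (v zero) (g zero) ∙ comb (v ∘ suc) (g ∘ suc)

  interchange : ∀ a b x y → (a ∙ b) ∙ (x ∙ y) ≈ (a ∙ x) ∙ (b ∙ y)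
  interchange a b x y = begin
    (a ∙ b) ∙ (x ∙ y) ≈⟨ assoc a b (x ∙ y) ⟩
    a ∙ (b ∙ (x ∙ y)) ≈⟨ ∙-congˡ (trans (sym (assoc b x y)) (trans (∙-congʳ (comm b x)) (assoc x b y))) ⟩
    a ∙ (x ∙ (b ∙ y)) ≈⟨ sym (assoc a x (b ∙ y)) ⟩
    (a ∙ x) ∙ (b ∙ y) ∎

  comb-cong : ∀ {d} {v w : Fin d → ℤ} g → (∀ j → v j ≡ w j) → comb v g ≈ comb w g
  comb-cong {zero} g e = refl
  comb-cong {suc d} g e = ∙-cong (reflexive (cong (λ i → scal i (g zero)) (e zero))) (comb-cong (g ∘ suc) (e ∘ suc))

  comb-+ : ∀ {d} (v w : Fin d → ℤ) g → comb (λ j → v j ℤ.+ w j) g ≈ comb v g ∙ comb w g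
  comb-+ {zero} v w g = sym (identityˡ ε)
  comb-+ {suc d} v w g = trans (∙-cong (scal-+ (v zero) (w zero) (g zero)) (comb-+ (v ∘ suc) (w ∘ suc) (g ∘ suc))) (interchange _ _ _ _)

  comb-* : ∀ {d} i (v : Fin d → ℤ) g → comb (λ j → i ℤ.* v j) g ≈ scal i (comb v g)
  comb-* {zero} i v g = sym (scal-ε i)
  comb-* {suc d} i v g = trans (∙-cong (scal-* i (v zero) (g zero)) (comb-* i (v ∘ suc) (g ∘ suc))) (sym (scal-∙ i _ _))

  comb-- : ∀ {d} (v w : Fin d → ℤ) g → comb (λ j → v j ℤ.- w j) g ≈ comb v g ∙ (comb w g) ⁻¹
  comb-- v w g = trans (comb-+ v (λ j → ℤ.- w j) g) (∙-congˡ (trans (comb-cong g (λ j → ≡.sym (ℤP.-1*i≡-i (w j)))) (trans (comb-* (ℤ.- + 1) w g) (⁻¹-cong (identityʳ _)))))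

  comb-0 : ∀ {d} (g : Fin d → A) → comb (λ _ → + 0) g ≈ ε
  comb-0 {zero} g = refl
  comb-0 {suc d} g = trans (identityˡ _) (comb-0 (g ∘ suc))

  δ : ∀ {d} → Fin d → Fin d → ℤ
  δ zero zero = + 1
  δ zero (suc j) = + 0
  δ (suc i) zero = + 0
  δ (suc i) (suc j) = δ i j

  comb-δ : ∀ {d} (i : Fin d) g → comb (δ i) g ≈ g i
  comb-δ zero g = trans (∙-cong (identityʳ _) (comb-0 (g ∘ suc))) (identityʳ _)
  comb-δ (suc i) g = trans (identityˡ _) (comb-δ i (g ∘ suc))

  numeral : ∀ {d} → ℤ → (Fin d → ℤ) → ℤ
  numeral {zero} L v = + 0
  numeral {suc d} L v = v zero ℤ.+ L ℤ.* numeral L (v ∘ suc)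

  numeral-combination : ∀ {d} L p q (v₁ v₂ v₃ v₄ : Fin d → ℤ) →
    numeral L (λ j → (p ℤ.* v₁ j ℤ.+ q ℤ.* v₂ j) ℤ.- (p ℤ.* v₃ j ℤ.+ q ℤ.* v₄ j)) ≡
    (p ℤ.* numeral L v₁ ℤ.+ q ℤ.* numeral L v₂) ℤ.- (p ℤ.* numeral L v₃ ℤ.+ q ℤ.* numeral L v₄)
  numeral-combination {zero} L p q v₁ v₂ v₃ v₄ = z p q
    where
      z : ∀ p q → + 0 ≡ (p ℤ.* + 0 ℤ.+ q ℤ.* + 0) ℤ.- (p ℤ.* + 0 ℤ.+ q ℤ.* + 0)
      z = solve-∀
  numeral-combination {suc d} L p q v₁ v₂ v₃ v₄ = ≡.trans
    (cong (λ w → ((p ℤ.* v₁ zero ℤ.+ q ℤ.* v₂ zero) ℤ.- (p ℤ.* v₃ zero ℤ.+ q ℤ.* v₄ zero)) ℤ.+ L ℤ.* w)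
      (numeral-combination L p q (v₁ ∘ suc) (v₂ ∘ suc) (v₃ ∘ suc) (v₄ ∘ suc)))
    (z L p q (v₁ zero) (v₂ zero) (v₃ zero) (v₄ zero) (numeral L (v₁ ∘ suc)) (numeral L (v₂ ∘ suc)) (numeral L (v₃ ∘ suc)) (numeral L (v₄ ∘ suc)))
    where
      z : ∀ L p q a b x y a′ b′ x′ y′ → ((p ℤ.* a ℤ.+ q ℤ.* b) ℤ.- (p ℤ.* x ℤ.+ q ℤ.* y)) ℤ.+ L ℤ.* ((p ℤ.* a′ ℤ.+ q ℤ.* b′) ℤ.- (p ℤ.* x′ ℤ.+ q ℤ.* y′)) ≡
        (p ℤ.* (a ℤ.+ L ℤ.* a′) ℤ.+ q ℤ.* (b ℤ.+ L ℤ.* b′)) ℤ.- (p ℤ.* (x ℤ.+ L ℤ.* x′) ℤ.+ q ℤ.* (y ℤ.+ L ℤ.* y′))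
      z = solve-∀

  -- A vanishing numeral makes its lowest digit a multiple of L, hence 0 when it is smaller than L;
  -- then the rest vanishes as well.
  numeral≡0 : ∀ {d} L (v : Fin d → ℤ) → (∀ j → ∣ v j ∣ ℕ.< L) → numeral (+ L) v ≡ + 0 → ∀ j → v j ≡ + 0
  numeral≡0 {suc d} L v small e = λ { zero → head≡0 ; (suc j) → numeral≡0 L (v ∘ suc) (small ∘ suc) tail≡0 j }
    where
      n : ℤ
      n = numeral (+ L) (v ∘ suc)
      solo : ∀ a x → a ≡ (a ℤ.+ x) ℤ.- x
      solo = solve-∀
      size : ∣ v zero ∣ ≡ L ℕ.* ∣ n ∣
      size = ≡.trans (cong ∣_∣ (≡.trans (solo (v zero) (+ L ℤ.* n)) (≡.trans (cong (ℤ._- (+ L ℤ.* n)) e) (ℤP.+-identityˡ (ℤ.- (+ L ℤ.* n)))))) (≡.trans (ℤP.∣-i∣≡∣i∣ (+ L ℤ.* n)) (ℤP.abs-* (+ L) n))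
      tail≡0 : n ≡ + 0
      tail≡0 = ℤP.∣i∣≡0⇒i≡0 (decidable-stable (∣ n ∣ ℕ.≟ 0) λ ne → ℕP.<⇒≱ (small zero)
        (ℕP.≤-trans (ℕP.m≤m*n L ∣ n ∣ {{ℕ.≢-nonZero ne}}) (ℕP.≤-reflexive (≡.sym size))))
      head≡0 : v zero ≡ + 0
      head≡0 = ℤP.∣i∣≡0⇒i≡0 (≡.trans size (≡.trans (cong (λ i → L ℕ.* ∣ i ∣) tail≡0) (ℕP.*-zeroʳ L)))

  boundFin : ∀ {d} (f : Fin d → ℕ) → ∃ λ M → ∀ i → f i ℕ.≤ M
  boundFin {zero} f = 0 , λ ()
  boundFin {suc d} f with boundFin (f ∘ suc)
  ... | M , h = f zero ℕ.⊔ M , λ { zero → ℕP.m≤m⊔n (f zero) M ; (suc i) → ℕP.≤-trans (h i) (ℕP.m≤n⊔m (f zero) M) }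

  minFin : ∀ {d} (f : Fin d → ℕ) → ∃ λ μ → (∀ i → μ ℕ.≤ f i) × (Fin d → ∃ λ i → f i ≡ μ)
  minFin {zero} f = 0 , (λ ()) , λ ()
  minFin {suc zero} f = f zero , (λ { zero → ℕP.≤-refl }) , λ _ → zero , ≡.refl
  minFin {suc (suc d)} f with minFin (f ∘ suc)
  ... | μ , h , at with at zero | ℕP.≤-total (f zero) μ
  ...   | i , e | inj₁ le = f zero , (λ { zero → ℕP.≤-refl ; (suc j) → ℕP.≤-trans le (h j) }) , λ _ → zero , ≡.refl
  ...   | i , e | inj₂ ge = μ , (λ { zero → ge ; (suc j) → h j }) , λ _ → suc i , e

  shift-nonneg : ∀ a D → ∣ a ∣ ℕ.≤ D → + ∣ a ℤ.+ + D ∣ ≡ a ℤ.+ + D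
  shift-nonneg (+ n) D _ = ≡.refl
  shift-nonneg -[1+ n ] D le = ≡.trans (cong (λ i → + ∣ i ∣) (ℤP.⊖-≥ le)) (≡.sym (ℤP.⊖-≥ le))

  module _ (torsionFree : ∀ n {z} → suc n ×ⁿ z ≈ ε → z ≈ ε) {k : ℕ} (s : Fin k → A)
    (dec : ∀ i j l h → Dec (s i ∙ s j ≈ s l ∙ s h)) where

    scal≈ε : ∀ N → N ≢ + 0 → ∀ {z} → scal N z ≈ ε → z ≈ ε
    scal≈ε (+ zero) ne _ = ⊥-elim (ne ≡.refl)
    scal≈ε (+ suc n) _ e = torsionFree n e
    scal≈ε -[1+ n ] _ e = torsionFree n (trans (sym (⁻¹-involutive _)) (trans (⁻¹-cong e) ε⁻¹≈ε))

    -- Coordinates of the N-th multiples of the s i with respect to the s j themselves.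
    record Coordinates : Set (c Level.⊔ ℓ) where
      field
        N : ℤ
        N≢0 : N ≢ + 0
        V : Fin k → Fin k → ℤ
        rep : ∀ i → scal N (s i) ≈ comb (V i) s

    Quad : Set
    Quad = (Fin k × Fin k) × (Fin k × Fin k)

    defect : (Fin k → Fin k → ℤ) → Quad → Fin k → ℤ
    defect V ((i , j) , (l , h)) x = (V i x ℤ.+ V j x) ℤ.- (V l x ℤ.+ V h x)

    -- An identity of coordinate vectors. A true relation of the group need not satisfy it at once,
    -- because the s i used as coordinates are themselves dependent.
    Sat : (Fin k → Fin k → ℤ) → Quad → Set
    Sat V q = ∀ x → defect V q x ≡ + 0

    Holdsᵍ : Quad → Set ℓ
    Holdsᵍ ((i , j) , (l , h)) = s i ∙ s j ≈ s l ∙ s h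

    open Coordinates

    defect≈ε : ∀ C q → Holdsᵍ q → comb (defect (V C) q) s ≈ ε
    defect≈ε C ((i , j) , (l , h)) e = begin
      comb (defect (V C) ((i , j) , (l , h))) s                                  ≈⟨ comb-- _ _ s ⟩
      comb (λ x → V C i x ℤ.+ V C j x) s ∙ comb (λ x → V C l x ℤ.+ V C h x) s ⁻¹ ≈⟨ ∙-cong (pair i j) (⁻¹-cong (pair l h)) ⟩
      scal (N C) (s i ∙ s j) ∙ scal (N C) (s l ∙ s h) ⁻¹                         ≈⟨ ∙-congˡ (⁻¹-cong (scal-cong (N C) (sym e))) ⟩
      scal (N C) (s i ∙ s j) ∙ scal (N C) (s i ∙ s j) ⁻¹                         ≈⟨ inverseʳ _ ⟩
      ε                                                                          ∎
      where
        pair : ∀ i j → comb (λ x → V C i x ℤ.+ V C j x) s ≈ scal (N C) (s i ∙ s j)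
        pair i j = trans (comb-+ (V C i) (V C j) s) (trans (∙-cong (sym (rep C i)) (sym (rep C j))) (sym (scal-∙ (N C) (s i) (s j))))

    -- Eliminating a coordinate x₀ at which the relation q has a nonzero coefficient.
    eliminate : ∀ C q → Holdsᵍ q → ∀ x₀ → defect (V C) q x₀ ≢ + 0 →
      Σ Coordinates λ C′ → Sat (V C′) q × (∀ q′ → Sat (V C) q′ → Sat (V C′) q′)
    eliminate C q e x₀ ne = record
      { N = ρ ℤ.* N C ; N≢0 = λ z → [ ne , N≢0 C ]′ (ℤP.i*j≡0⇒i≡0∨j≡0 ρ z) ; V = V′ ; rep = rep′ } ,
      (λ x → ≡.trans (linear q x) (cancel ρ (defect (V C) q x))) ,
      λ q′ sat x → ≡.trans (linear q′ x) (≡.trans (cong₂ (λ a b → ρ ℤ.* a ℤ.- b ℤ.* defect (V C) q x) (sat x) (sat x₀)) (zeros ρ (defect (V C) q x)))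
      where
        ρ : ℤ
        ρ = defect (V C) q x₀
        V′ : Fin k → Fin k → ℤ
        V′ i x = ρ ℤ.* V C i x ℤ.- V C i x₀ ℤ.* defect (V C) q x
        rep′ : ∀ i → scal (ρ ℤ.* N C) (s i) ≈ comb (V′ i) s
        rep′ i = sym (begin
          comb (V′ i) s                                              ≈⟨ comb-- _ _ s ⟩
          comb (λ x → ρ ℤ.* V C i x) s ∙ comb (λ x → V C i x₀ ℤ.* defect (V C) q x) s ⁻¹
            ≈⟨ ∙-cong (comb-* ρ (V C i) s) (⁻¹-cong (trans (comb-* (V C i x₀) (defect (V C) q) s) (trans (scal-cong (V C i x₀) (defect≈ε C q e)) (scal-ε (V C i x₀))))) ⟩
          scal ρ (comb (V C i) s) ∙ ε ⁻¹                             ≈⟨ trans (∙-congˡ ε⁻¹≈ε) (identityʳ _) ⟩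
          scal ρ (comb (V C i) s)                                    ≈⟨ scal-cong ρ (sym (rep C i)) ⟩
          scal ρ (scal (N C) (s i))                                  ≈⟨ sym (scal-* ρ (N C) (s i)) ⟩
          scal (ρ ℤ.* N C) (s i)                                     ∎)
        linear : ∀ q′ x → defect V′ q′ x ≡ ρ ℤ.* defect (V C) q′ x ℤ.- defect (V C) q′ x₀ ℤ.* defect (V C) q x
        linear ((i , j) , (l , h)) x = z ρ (defect (V C) q x) (V C i x) (V C j x) (V C l x) (V C h x) (V C i x₀) (V C j x₀) (V C l x₀) (V C h x₀)
          where
            z : ∀ ρ r a b c d a₀ b₀ c₀ d₀ → ((ρ ℤ.* a ℤ.- a₀ ℤ.* r) ℤ.+ (ρ ℤ.* b ℤ.- b₀ ℤ.* r)) ℤ.- ((ρ ℤ.* c ℤ.- c₀ ℤ.* r) ℤ.+ (ρ ℤ.* d ℤ.- d₀ ℤ.* r)) ≡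
              ρ ℤ.* ((a ℤ.+ b) ℤ.- (c ℤ.+ d)) ℤ.- ((a₀ ℤ.+ b₀) ℤ.- (c₀ ℤ.+ d₀)) ℤ.* r
            z = solve-∀
        cancel : ∀ ρ r → ρ ℤ.* r ℤ.- ρ ℤ.* r ≡ + 0
        cancel = solve-∀
        zeros : ∀ ρ r → ρ ℤ.* + 0 ℤ.- + 0 ℤ.* r ≡ + 0
        zeros = solve-∀

    holds? : ∀ q → Dec (Holdsᵍ q)
    holds? ((i , j) , (l , h)) = dec i j l h

    -- Elimination over ℤ without a basis: a true relation that the coordinates violate is used to
    -- clear one coordinate, and by linearity the relations already satisfied survive.
    resolve : ∀ qs → Σ Coordinates λ C → ∀ {q} → q ∈ qs → Holdsᵍ q → Sat (V C) q
    resolve [] = record { N = + 1 ; N≢0 = λ () ; V = δ ; rep = λ i → trans (identityʳ (s i)) (sym (comb-δ i s)) } , λ ()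
    resolve (q ∷ qs) with resolve qs | holds? q
    ... | C , sat | no ¬e = C , λ { (here ≡.refl) e → ⊥-elim (¬e e) ; (there q∈) e → sat q∈ e }
    ... | C , sat | yes e with F.any? (λ x → ¬? (defect (V C) q x ℤ.≟ + 0))
    ...   | no none = C , λ { (here ≡.refl) _ x → decidable-stable (defect (V C) q x ℤ.≟ + 0) (λ ne → none (x , ne)) ; (there q∈) e′ → sat q∈ e′ }
    ...   | yes (x₀ , ne) with eliminate C q e x₀ ne
    ...     | C′ , satq , keep = C′ , λ { (here ≡.refl) _ → satq ; {q′} (there q∈) e′ → keep q′ (sat q∈ e′) }

    -- `forward` bounds the number of sums by that of products. `backward` carries weights because
    -- progressions, and not only sums of two terms, have to be recovered.
    record IntegerModel (X : ℕ) : Set (c Level.⊔ ℓ) where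
      field
        b : Fin k → ℕ
        forward : ∀ {i j l h} → s i ∙ s j ≈ s l ∙ s h → b i ℕ.+ b j ≡ b l ℕ.+ b h
        backward : ∀ {p q i j l h} → p ℕ.≤ X → q ℕ.≤ X → p ℕ.* b i ℕ.+ q ℕ.* b j ≡ p ℕ.* b l ℕ.+ q ℕ.* b h →
          p ×ⁿ s i ∙ q ×ⁿ s j ≈ p ×ⁿ s l ∙ q ×ⁿ s h
        zeroAt : Fin k → ∃ λ i → b i ≡ 0

      progression : ∀ {m τ x u i j} → 1 ℕ.≤ X → m ℕ.≤ X → b j ≡ b i ℕ.+ τ → b x ≡ b u ℕ.+ m ℕ.* τ → s x ≈ s u ∙ m ×ⁿ (s j ∙ s i ⁻¹)
      progression {m} {τ} {x} {u} {i} {j} 1≤X m≤X ej ex = ratio m (backward m≤X 1≤X (≡.trans (cong₂ (λ y z → m ℕ.* y ℕ.+ 1 ℕ.* z) ej ≡.refl)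
        (≡.trans (regroup m (b i) τ (b u)) (cong (λ z → m ℕ.* b i ℕ.+ 1 ℕ.* z) (≡.sym ex)))))
        where
          regroup : ∀ m i τ u → m ℕ.* (i ℕ.+ τ) ℕ.+ 1 ℕ.* u ≡ m ℕ.* i ℕ.+ 1 ℕ.* (u ℕ.+ m ℕ.* τ)
          regroup = NatSolver.solve-∀

    integerModel : ∀ X → IntegerModel X
    integerModel X with resolve (cartesianProduct (cartesianProduct (allFin k) (allFin k)) (cartesianProduct (allFin k) (allFin k)))
    ... | C , sat = build (boundFin (λ i → proj₁ (boundFin (λ x → ∣ V C i x ∣))))
      where
        build : (∃ λ M → ∀ i → proj₁ (boundFin (λ x → ∣ V C i x ∣)) ℕ.≤ M) → IntegerModel X
        build (M , M-bound) = model
          where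
            V≤M : ∀ i x → ∣ V C i x ∣ ℕ.≤ M
            V≤M i x = ℕP.≤-trans (proj₂ (boundFin (λ x → ∣ V C i x ∣)) x) (M-bound i)
            -- Exceeds the sum of four products of a weight at most X with an entry at most M, so
            -- each digit of a mixed vector is small.
            L : ℕ
            L = suc ((X ℕ.* M ℕ.+ X ℕ.* M) ℕ.+ (X ℕ.* M ℕ.+ X ℕ.* M))
            a : Fin k → ℤ
            a i = numeral (+ L) (V C i)
            D : ℕ
            D = proj₁ (boundFin (λ i → ∣ a i ∣))
            d c₊ : Fin k → ℕ
            c₊ i = ∣ a i ℤ.+ + D ∣
            c₊≡ : ∀ i → + c₊ i ≡ a i ℤ.+ + D
            c₊≡ i = shift-nonneg (a i) D (proj₂ (boundFin (λ i → ∣ a i ∣)) i)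
            μ : ℕ
            μ = proj₁ (minFin c₊)
            d i = c₊ i ℕ.∸ μ
            d+μ : ∀ i → d i ℕ.+ μ ≡ c₊ i
            d+μ i = ℕP.m∸n+n≡m (proj₁ (proj₂ (minFin c₊)) i)
            -- The shift D - μ that makes the minimum 0 enters with the factor p + q, the same on
            -- both sides of a relation, and cancels there.
            weigh : ∀ p q i j → + (p ℕ.* d i ℕ.+ q ℕ.* d j) ≡ (+ p ℤ.* a i ℤ.+ + q ℤ.* a j) ℤ.+ (+ p ℤ.+ + q) ℤ.* (+ D ℤ.- + μ)
            weigh p q i j = ≡.trans (≡.trans (ℤP.pos-+ (p ℕ.* d i) (q ℕ.* d j)) (cong₂ ℤ._+_ (term p i) (term q j)))
                (z (+ p) (+ q) (a i) (a j) (+ D ℤ.- + μ))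
              where
                value : ∀ i → + d i ≡ a i ℤ.+ (+ D ℤ.- + μ)
                value i = ≡.trans (drop (+ d i) (+ μ)) (≡.trans (cong (ℤ._- + μ) (≡.trans (≡.sym (ℤP.pos-+ (d i) μ)) (≡.trans (cong +_ (d+μ i)) (c₊≡ i)))) (ℤP.+-assoc (a i) (+ D) (ℤ.- + μ)))
                  where
                    drop : ∀ x y → x ≡ (x ℤ.+ y) ℤ.- y
                    drop = solve-∀
                term : ∀ p i → + (p ℕ.* d i) ≡ + p ℤ.* (a i ℤ.+ (+ D ℤ.- + μ))
                term p i = ≡.trans (ℤP.pos-* p (d i)) (cong (+ p ℤ.*_) (value i))
                z : ∀ p q x y e → p ℤ.* (x ℤ.+ e) ℤ.+ q ℤ.* (y ℤ.+ e) ≡ (p ℤ.* x ℤ.+ q ℤ.* y) ℤ.+ (p ℤ.+ q) ℤ.* e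
                z = solve-∀
            mix : ∀ p q (i j l h x : Fin k) → ℤ
            mix p q i j l h x = (+ p ℤ.* V C i x ℤ.+ + q ℤ.* V C j x) ℤ.- (+ p ℤ.* V C l x ℤ.+ + q ℤ.* V C h x)
            difference : ∀ p q i j l h → + (p ℕ.* d i ℕ.+ q ℕ.* d j) ℤ.- + (p ℕ.* d l ℕ.+ q ℕ.* d h) ≡ numeral (+ L) (mix p q i j l h)
            difference p q i j l h = ≡.trans (cong₂ ℤ._-_ (weigh p q i j) (weigh p q l h))
              (≡.trans (z (+ p ℤ.* a i ℤ.+ + q ℤ.* a j) (+ p ℤ.* a l ℤ.+ + q ℤ.* a h) ((+ p ℤ.+ + q) ℤ.* (+ D ℤ.- + μ)))
                (≡.sym (numeral-combination (+ L) (+ p) (+ q) (V C i) (V C j) (V C l) (V C h))))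
              where
                z : ∀ x y e → (x ℤ.+ e) ℤ.- (y ℤ.+ e) ≡ x ℤ.- y
                z = solve-∀
            mix-small : ∀ p q → p ℕ.≤ X → q ℕ.≤ X → ∀ i j l h x → ∣ mix p q i j l h x ∣ ℕ.< L
            mix-small p q p≤ q≤ i j l h x = ℕ.s≤s (ℕP.≤-trans (ℤP.∣i-j∣≤∣i∣+∣j∣ (+ p ℤ.* V C i x ℤ.+ + q ℤ.* V C j x) (+ p ℤ.* V C l x ℤ.+ + q ℤ.* V C h x)) (ℕP.+-mono-≤ (half i j) (half l h)))
              where
                term : ∀ p i → p ℕ.≤ X → ∣ + p ℤ.* V C i x ∣ ℕ.≤ X ℕ.* M
                term p i p≤ = ℕP.≤-trans (ℕP.≤-reflexive (ℤP.abs-* (+ p) (V C i x))) (ℕP.*-mono-≤ p≤ (V≤M i x))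
                half : ∀ i j → ∣ + p ℤ.* V C i x ℤ.+ + q ℤ.* V C j x ∣ ℕ.≤ X ℕ.* M ℕ.+ X ℕ.* M
                half i j = ℕP.≤-trans (ℤP.∣i+j∣≤∣i∣+∣j∣ (+ p ℤ.* V C i x) (+ q ℤ.* V C j x)) (ℕP.+-mono-≤ (term p i p≤) (term q j q≤))
            weighted : ∀ p q i j → comb (λ x → + p ℤ.* V C i x ℤ.+ + q ℤ.* V C j x) s ≈ scal (N C) (p ×ⁿ s i ∙ q ×ⁿ s j)
            weighted p q i j = trans (comb-+ _ _ s) (trans (∙-cong (term p i) (term q j)) (sym (scal-∙ (N C) _ _)))
              where
                term : ∀ p i → comb (λ x → + p ℤ.* V C i x) s ≈ scal (N C) (p ×ⁿ s i)
                term p i = begin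
                  comb (λ x → + p ℤ.* V C i x) s      ≈⟨ comb-* (+ p) (V C i) s ⟩
                  scal (+ p) (comb (V C i) s)         ≈⟨ scal-cong (+ p) (sym (rep C i)) ⟩
                  scal (+ p) (scal (N C) (s i))       ≈⟨ sym (scal-* (+ p) (N C) (s i)) ⟩
                  scal (+ p ℤ.* N C) (s i)            ≡⟨ cong (λ z → scal z (s i)) (ℤP.*-comm (+ p) (N C)) ⟩
                  scal (N C ℤ.* + p) (s i)            ≈⟨ scal-* (N C) (+ p) (s i) ⟩
                  scal (N C) (p ×ⁿ s i)               ∎
            model : IntegerModel X
            model = record
              { b = d
              ; forward = λ {i} {j} {l} {h} e → ℤP.+-injective (ℤP.i-j≡0⇒i≡j _ _ (≡.trans (cong₂ (λ x y → + x ℤ.- + y) (unitWeights i j) (unitWeights l h))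
                  (≡.trans (difference 1 1 i j l h) (≡.trans (numeral-cong (λ x → ≡.trans (ones (V C i x) (V C j x) (V C l x) (V C h x))
                    (sat (∈-cartesianProduct⁺ (∈-cartesianProduct⁺ (∈-allFin i) (∈-allFin j)) (∈-cartesianProduct⁺ (∈-allFin l) (∈-allFin h))) e x))) (numeral-0 {k})))))
              ; backward = λ {p} {q} {i} {j} {l} {h} p≤ q≤ e → ∙⁻¹-cancel (scal≈ε (N C) (N≢0 C) (begin
                  scal (N C) ((p ×ⁿ s i ∙ q ×ⁿ s j) ∙ (p ×ⁿ s l ∙ q ×ⁿ s h) ⁻¹) ≈⟨ trans (scal-∙ (N C) _ _) (∙-congˡ (scal-⁻¹ (N C) _)) ⟩
                  scal (N C) (p ×ⁿ s i ∙ q ×ⁿ s j) ∙ scal (N C) (p ×ⁿ s l ∙ q ×ⁿ s h) ⁻¹ ≈⟨ ∙-cong (sym (weighted p q i j)) (⁻¹-cong (sym (weighted p q l h))) ⟩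
                  comb (λ x → + p ℤ.* V C i x ℤ.+ + q ℤ.* V C j x) s ∙ comb (λ x → + p ℤ.* V C l x ℤ.+ + q ℤ.* V C h x) s ⁻¹ ≈⟨ sym (comb-- _ _ s) ⟩
                  comb (mix p q i j l h) s ≈⟨ comb-cong s (numeral≡0 L (mix p q i j l h) (mix-small p q p≤ q≤ i j l h)
                     (≡.trans (≡.sym (difference p q i j l h)) (≡.trans (cong (λ x → + x ℤ.- + (p ℕ.* d l ℕ.+ q ℕ.* d h)) e) (ℤP.+-inverseʳ (+ (p ℕ.* d l ℕ.+ q ℕ.* d h)))))) ⟩
                  comb (λ _ → + 0) s ≈⟨ comb-0 s ⟩
                  ε ∎))
              ; zeroAt = λ i → let i₀ , e = proj₂ (proj₂ (minFin c₊)) i in i₀ , ≡.trans (cong (ℕ._∸ μ) e) (ℕP.n∸n≡0 μ) }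
              where
                unitWeights : ∀ i j → d i ℕ.+ d j ≡ 1 ℕ.* d i ℕ.+ 1 ℕ.* d j
                unitWeights i j = ≡.sym (cong₂ ℕ._+_ (ℕP.*-identityˡ (d i)) (ℕP.*-identityˡ (d j)))
                ones : ∀ x y z w → (+ 1 ℤ.* x ℤ.+ + 1 ℤ.* y) ℤ.- (+ 1 ℤ.* z ℤ.+ + 1 ℤ.* w) ≡ (x ℤ.+ y) ℤ.- (z ℤ.+ w)
                ones = solve-∀
                numeral-cong : ∀ {m} {v w : Fin m → ℤ} → (∀ x → v x ≡ w x) → numeral (+ L) v ≡ numeral (+ L) w
                numeral-cong {zero} f = ≡.refl
                numeral-cong {suc m} f = cong₂ (λ x y → x ℤ.+ + L ℤ.* y) (f zero) (numeral-cong (f ∘ suc))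
                numeral-0 : ∀ {m} → numeral {m} (+ L) (λ _ → + 0) ≡ + 0
                numeral-0 {zero} = ≡.refl
                numeral-0 {suc m} = ≡.trans (cong (λ y → + 0 ℤ.+ + L ℤ.* y) (numeral-0 {m})) (≡.trans (ℤP.+-identityˡ (+ L ℤ.* + 0)) (ℤP.*-zeroʳ (+ L)))
                ∙⁻¹-cancel : ∀ {x y} → x ∙ y ⁻¹ ≈ ε → x ≈ y
                ∙⁻¹-cancel {x} {y} e = trans (sym (identityʳ x)) (trans (∙-congˡ (sym (inverseˡ y))) (trans (sym (assoc x (y ⁻¹) y)) (trans (∙-congʳ e) (identityˡ y))))

-- Commutation and generators in an ordered group

module OrderedGroup {c ℓ ℓ₂ : Level} (G : Group c ℓ) (_≤ᴳ_ : Rel (Group.Carrier G) ℓ₂) (ord : IsGroupOrder G _≤ᴳ_) where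
  open Group G renaming (Carrier to A)
  open import Algebra.Properties.Group G
  open IsGroupOrder ord
  open import Relation.Binary.Structures using (IsTotalOrder)
  open IsTotalOrder isTotalOrder using (total; antisym) renaming (trans to ≼-trans; reflexive to ≼-reflexive)

  open import Data.List.Membership.Setoid setoid using () renaming (_∈_ to _∈ᵍ_)
  open LinearArithmetic
  open FiniteSets

  infix 4 _≼_ _≺_
  _≼_ : Rel A ℓ₂
  _≼_ = _≤ᴳ_

  _≺_ : A → A → Set _
  x ≺ y = x ≼ y × ¬ x ≈ y

  ≼-resp : ∀ {a b x y} → a ≈ b → x ≈ y → a ≼ x → b ≼ y
  ≼-resp e f h = ≼-trans (≼-reflexive (sym e)) (≼-trans h (≼-reflexive f))

  ∙-monoˡ : ∀ x {a b} → a ≼ b → x ∙ a ≼ x ∙ b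
  ∙-monoˡ x {a} {b} h = ≼-resp (identityʳ (x ∙ a)) (identityʳ (x ∙ b)) (compatible a b x ε h)

  ∙-monoʳ : ∀ x {a b} → a ≼ b → a ∙ x ≼ b ∙ x
  ∙-monoʳ x {a} {b} h = ≼-resp (∙-congʳ (identityˡ a)) (∙-congʳ (identityˡ b)) (compatible a b ε x h)

  ∙-mono : ∀ {a b x y} → a ≼ b → x ≼ y → a ∙ x ≼ b ∙ y
  ∙-mono {a} {b} {x} {y} h k = ≼-trans (∙-monoʳ x h) (∙-monoˡ b k)

  ≺-≼-trans : ∀ {x y z} → x ≺ y → y ≼ z → x ≺ z
  ≺-≼-trans (h , ne) k = ≼-trans h k , λ e → ne (antisym h (≼-trans k (≼-reflexive (sym e))))

  ≼-≺-trans : ∀ {x y z} → x ≼ y → y ≺ z → x ≺ z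
  ≼-≺-trans h (k , ne) = ≼-trans h k , λ e → ne (antisym k (≼-trans (≼-reflexive (sym e)) h))

  ≺-irrefl : ∀ {x y} → x ≈ y → ¬ x ≺ y
  ≺-irrefl e (_ , ne) = ne e

  ∙-strictˡ : ∀ x {a b} → a ≺ b → x ∙ a ≺ x ∙ b
  ∙-strictˡ x {a} {b} (h , ne) = ∙-monoˡ x h , λ e → ne (∙-cancelˡ x a b e)

  ∙-strictʳ : ∀ x {a b} → a ≺ b → a ∙ x ≺ b ∙ x
  ∙-strictʳ x {a} {b} (h , ne) = ∙-monoʳ x h , λ e → ne (∙-cancelʳ x a b e)

  outgrowsˡ : ∀ {x y b d} → x ∙ b ≈ y ∙ d → d ≺ b → x ≺ y
  outgrowsˡ {x} {y} {b} e lt =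
    [ (λ h → h) , (λ h → ⊥-elim (≺-irrefl (sym e) (≺-≼-trans (∙-strictˡ y lt) (∙-monoʳ b h)))) ]′ (total x y) ,
    λ eq → ≺-irrefl (trans (sym e) (∙-congʳ eq)) (∙-strictˡ y lt)

  outgrowsʳ : ∀ {x y b d} → b ∙ x ≈ d ∙ y → d ≺ b → x ≺ y
  outgrowsʳ {x} {y} {b} e lt =
    [ (λ h → h) , (λ h → ⊥-elim (≺-irrefl (sym e) (≺-≼-trans (∙-strictʳ y lt) (∙-monoˡ b h)))) ]′ (total x y) ,
    λ eq → ≺-irrefl (trans (sym e) (∙-congˡ eq)) (∙-strictʳ y lt)

  x∙y∙y⁻¹ : ∀ x y → (x ∙ y) ∙ y ⁻¹ ≈ x
  x∙y∙y⁻¹ x y = trans (assoc x y (y ⁻¹)) (trans (∙-congˡ (inverseʳ y)) (identityʳ x))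

  y⁻¹∙y∙x : ∀ x y → y ⁻¹ ∙ (y ∙ x) ≈ x
  y⁻¹∙y∙x x y = trans (sym (assoc (y ⁻¹) y x)) (trans (∙-congʳ (inverseˡ y)) (identityˡ x))

  Commute : A → A → Set ℓ
  Commute x y = x ∙ y ≈ y ∙ x

  commute-⁻¹ : ∀ {x y} → Commute x y → Commute x (y ⁻¹)
  commute-⁻¹ {x} {y} e = trans (sym (y⁻¹∙y∙x (x ∙ y ⁻¹) y)) (∙-congˡ (trans (sym (assoc y x (y ⁻¹))) (trans (∙-congʳ (sym e)) (x∙y∙y⁻¹ x y))))

  commute-∙ : ∀ {x y z} → Commute x y → Commute x z → Commute x (y ∙ z)
  commute-∙ {x} {y} {z} e f = trans (sym (assoc x y z)) (trans (∙-congʳ e) (trans (assoc y x z) (trans (∙-congˡ f) (sym (assoc y z x)))))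

  commute-span : ∀ {W x z} → (∀ {w} → w ∈ᵍ W → Commute x w) → ⟨_⟩ G W z → Commute x z
  commute-span h (gen p) = h p
  commute-span h one = trans (identityʳ _) (sym (identityˡ _))
  commute-span h (mul p q) = commute-∙ (commute-span h p) (commute-span h q)
  commute-span h (inv p) = commute-⁻¹ (commute-span h p)
  commute-span h (resp e p) = trans (∙-congˡ (sym e)) (trans (commute-span h p) (∙-congʳ e))

  span-abelian : ∀ {W x z} → (∀ {v w} → v ∈ᵍ W → w ∈ᵍ W → Commute v w) → ⟨_⟩ G W x → ⟨_⟩ G W z → Commute x z
  span-abelian h p q = commute-span (λ w∈ → sym (commute-span (λ v∈ → h w∈ v∈) p)) q

  span-⊆ : ∀ {W W′ z} → (∀ {w} → w ∈ᵍ W → ⟨_⟩ G W′ w) → ⟨_⟩ G W z → ⟨_⟩ G W′ z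
  span-⊆ h (gen p) = h p
  span-⊆ h one = one
  span-⊆ h (mul p q) = mul (span-⊆ h p) (span-⊆ h q)
  span-⊆ h (inv p) = inv (span-⊆ h p)
  span-⊆ h (resp e p) = resp e (span-⊆ h p)

  module Descending {k n : ℕ} (s : Fin k → A) (desc : ∀ {i j} → toℕ i < toℕ j → s j ≺ s i)
    (p : Fin k → Fin k → Fin n) (p⇒≈ : ∀ {a b x y} → p a b ≡ p x y → s a ∙ s b ≈ s x ∙ s y)
    (≈⇒p : ∀ {a b x y} → s a ∙ s b ≈ s x ∙ s y → p a b ≡ p x y) where

    -- A set of positions: products are counted without deciding equality in the group.
    Q : ℕ → DSet n
    Q j .mem y = ∃ λ a → j ≤ toℕ a × ∃ λ b → j ≤ toℕ b × p a b ≡ y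
    Q j .mem? y = F.any? λ a → (j ℕ.≤? toℕ a) ×-dec F.any? λ b → (j ℕ.≤? toℕ b) ×-dec (p a b F.≟ y)

    Q-mono : ∀ {j} → Q (suc j) ⊆ₛ Q j
    Q-mono (a , ja , b , jb , e) = a , <⇒≤ ja , b , <⇒≤ jb , e

    desc≼ : ∀ {i j} → toℕ i ≤ toℕ j → s j ≼ s i
    desc≼ le with m≤n⇒m<n∨m≡n le
    ... | inj₁ lt = proj₁ (desc lt)
    ... | inj₂ e = ≼-reflexive (reflexive (cong s (F.toℕ-injective (≡.sym e))))

    ≺⇒< : ∀ {i j} → s i ≺ s j → toℕ j < toℕ i
    ≺⇒< {i} {j} h with ≤-<-connex (toℕ i) (toℕ j)
    ... | inj₂ lt = lt
    ... | inj₁ le = ⊥-elim (≺-irrefl refl (≺-≼-trans h (desc≼ le)))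

    p-injʳ : ∀ {i a b} → p i a ≡ p i b → a ≡ b
    p-injʳ {i} {a} {b} e with <-cmp (toℕ a) (toℕ b)
    ... | tri< lt _ _ = ⊥-elim (≺-irrefl (sym (∙-cancelˡ (s i) _ _ (p⇒≈ e))) (desc lt))
    ... | tri≈ _ eq _ = F.toℕ-injective eq
    ... | tri> _ _ gt = ⊥-elim (≺-irrefl (∙-cancelˡ (s i) _ _ (p⇒≈ e)) (desc gt))

    p-injˡ : ∀ {i a b} → p a i ≡ p b i → a ≡ b
    p-injˡ {i} {a} {b} e with <-cmp (toℕ a) (toℕ b)
    ... | tri< lt _ _ = ⊥-elim (≺-irrefl (sym (∙-cancelʳ (s i) _ _ (p⇒≈ e))) (desc lt))
    ... | tri≈ _ eq _ = F.toℕ-injective eq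
    ... | tri> _ _ gt = ⊥-elim (≺-irrefl (∙-cancelʳ (s i) _ _ (p⇒≈ e)) (desc gt))

    bigger : ∀ {a b x y} → s x ∙ s y ≺ s a ∙ s b → p a b ≢ p x y
    bigger h e = ≺-irrefl (sym (p⇒≈ e)) h

    module _ {jb : Fin k} where
      private
        j : ℕ
        j = toℕ jb

      jj∉ : p jb jb ∉ₛ Q (suc j)
      jj∉ (a , ja , b , jb′ , e) = bigger (≼-≺-trans (∙-monoˡ (s a) (proj₁ (desc jb′))) (∙-strictʳ (s jb) (desc ja))) (≡.sym e)

      module _ {jc : Fin k} (jc≡ : toℕ jc ≡ suc j) where

        jc∉ : p jb jc ∉ₛ Q (suc j)
        jc∉ (a , ja , b , jb′ , e) = bigger (≼-≺-trans (∙-monoˡ (s a) (desc≼ (≤-trans (≤-reflexive jc≡) jb′))) (∙-strictʳ (s jc) (desc ja))) (≡.sym e)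

        cj∉ : p jc jb ∉ₛ Q (suc j)
        cj∉ (a , ja , b , jb′ , e) = bigger (≼-≺-trans (∙-monoʳ (s b) (desc≼ (≤-trans (≤-reflexive jc≡) ja))) (∙-strictˡ (s jc) (desc jb′))) (≡.sym e)

        j<c : j < toℕ jc
        j<c = ≤-reflexive (≡.sym jc≡)

        jj≢jc : p jb jb ≢ p jb jc
        jj≢jc = bigger (∙-strictˡ (s jb) (desc j<c))

        two-new : card (Q (suc j)) + 2 ≤ card (Q j)
        two-new = lin≤ (card (Q (suc j)) ∷ card (Q j) ∷ card (Q j ∩ₛ Q (suc j)) ∷ card (Q j ∖ₛ Q (suc j)) ∷ []) (# 0 ⊕ K 2) (# 1)
          ((1 · # 0 ≼ # 2) ∷ (1 · # 2 ⊕ # 3 ≼ # 1) ∷ (1 · K 2 ≼ # 3) ∷ [])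
          (card-mono (Q (suc j)) (Q j ∩ₛ Q (suc j)) (λ q → Q-mono q , q) , ≤-reflexive (card-∖ (Q j) (Q (suc j))) ,
           card-≥2 (Q j ∖ₛ Q (suc j)) ((jb , ≤-refl , jb , ≤-refl , ≡.refl) , jj∉) ((jb , ≤-refl , jc , <⇒≤ j<c , ≡.refl) , jc∉) jj≢jc , tt)

        -- At most two new products when s jb joins: then every product s jb · s i with i > jc is old.
        module Few (few : card (Q j) ≤ card (Q (suc j)) + 2) where

          new≤2 : card (Q j ∖ₛ Q (suc j)) ≤ 2
          new≤2 = lin≤ (card (Q (suc j)) ∷ card (Q j) ∷ card (Q j ∩ₛ Q (suc j)) ∷ card (Q j ∖ₛ Q (suc j)) ∷ []) (# 3) (K 2)
            ((1 · # 0 ≼ # 2) ∷ (1 · # 2 ⊕ # 3 ≼ # 1) ∷ (1 · # 1 ≼ # 0 ⊕ K 2) ∷ [])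
            (card-mono (Q (suc j)) (Q j ∩ₛ Q (suc j)) (λ q → Q-mono q , q) , ≤-reflexive (card-∖ (Q j) (Q (suc j))) , few , tt)

          only-two : ∀ {y} → y ∈ₛ Q j → y ∉ₛ Q (suc j) → y ≢ p jb jb → y ≡ p jb jc
          only-two {y} y∈ y∉ ne = decidable-stable (y F.≟ p jb jc) λ ne′ → <⇒≱ (card-≥3 (Q j ∖ₛ Q (suc j))
            ((jb , ≤-refl , jb , ≤-refl , ≡.refl) , jj∉) ((jb , ≤-refl , jc , <⇒≤ j<c , ≡.refl) , jc∉) (y∈ , y∉) jj≢jc (ne ∘ ≡.sym) (ne′ ∘ ≡.sym)) new≤2

          bc : Commute (s jb) (s jc)
          bc = sym (p⇒≈ (only-two (jc , <⇒≤ j<c , jb , ≤-refl , ≡.refl) cj∉ (bigger (∙-strictʳ (s jb) (desc j<c)) ∘ ≡.sym)))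

          oldˡ : ∀ {i} → toℕ jc < toℕ i → p jb i ∈ₛ Q (suc j)
          oldˡ {i} lt = decidable-stable (mem? (Q (suc j)) (p jb i)) λ ∉Q →
            bigger (∙-strictˡ (s jb) (desc lt)) (≡.sym (only-two (jb , ≤-refl , i , <⇒≤ (ℕP.<-trans j<c lt) , ≡.refl) ∉Q
              (bigger (∙-strictˡ (s jb) (desc (ℕP.<-trans j<c lt))) ∘ ≡.sym)))

          -- The only candidate for a new product is s jb ∙ s jc, which by `bc` equals s jc ∙ s jb
          -- and is too large.
          oldʳ : ∀ {i} → toℕ jc < toℕ i → p i jb ∈ₛ Q (suc j)
          oldʳ {i} lt = decidable-stable (mem? (Q (suc j)) (p i jb)) λ ∉Q →
            ≺-irrefl (trans (p⇒≈ (only-two (i , <⇒≤ (ℕP.<-trans j<c lt) , jb , ≤-refl , ≡.refl) ∉Q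
              (bigger (∙-strictʳ (s jb) (desc (ℕP.<-trans j<c lt))) ∘ ≡.sym))) bc) (∙-strictʳ (s jb) (desc lt))

          W : List A
          W = s jb ∷ s jc ∷ []

          W-commute : ∀ {v w} → v ∈ᵍ W → w ∈ᵍ W → Commute v w
          W-commute (here e) (here f) = trans (∙-cong e f) (sym (∙-cong f e))
          W-commute (here e) (there (here f)) = trans (∙-cong e f) (trans bc (sym (∙-cong f e)))
          W-commute (there (here e)) (here f) = trans (∙-cong e f) (trans (sym bc) (sym (∙-cong f e)))
          W-commute (there (here e)) (there (here f)) = trans (∙-cong e f) (sym (∙-cong f e))

          -- Strong induction on i. In one of the old forms s_i b = s_a s_d and b s_i = s_a′ s_d′
          -- both factors precede s_i; otherwise d ≥ i and a′ ≥ i, and s_i b ≼ c s_i ≺ b s_i ≼ s_i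
          -- b, where b and c are the first two elements.
          in-span : ∀ i → j ≤ toℕ i → ⟨_⟩ G W (s i)
          in-span i = go i (<-wellFounded (toℕ i))
            where
              b cc : A
              b = s jb
              cc = s jc
              below-b : ∀ {d} → suc j ≤ toℕ d → s d ≺ b
              below-b = desc
              below-c : ∀ {d} → suc j ≤ toℕ d → s d ≼ cc
              below-c le = desc≼ (≤-trans (≤-reflexive jc≡) le)
              go : ∀ i → Acc _<_ (toℕ i) → j ≤ toℕ i → ⟨_⟩ G W (s i)
              go i (acc rec) j≤i with m≤n⇒m<n∨m≡n j≤i
              ... | inj₂ e = gen (here (reflexive (cong s (F.toℕ-injective (≡.sym e)))))
              ... | inj₁ j<i with m≤n⇒m<n∨m≡n j<i
              ...   | inj₂ e = gen (there (here (reflexive (cong s (F.toℕ-injective (≡.trans (≡.sym e) (≡.sym jc≡)))))))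
              ...   | inj₁ c<i = combine (oldʳ (≤-trans (≤-reflexive (cong suc jc≡)) c<i)) (oldˡ (≤-trans (≤-reflexive (cong suc jc≡)) c<i))
                where
                  combine : p i jb ∈ₛ Q (suc j) → p jb i ∈ₛ Q (suc j) → ⟨_⟩ G W (s i)
                  combine (a , ja , d , jd , e) (a′ , ja′ , d′ , jd′ , e′) with <-≤-connex (toℕ d) (toℕ i) | <-≤-connex (toℕ a′) (toℕ i)
                  ... | inj₁ d<i | _ = resp (trans (∙-congʳ (p⇒≈ e)) (x∙y∙y⁻¹ (s i) b))
                        (mul (mul (go a (rec a<i) (<⇒≤ ja)) (go d (rec d<i) (<⇒≤ jd))) (inv (gen (here refl))))
                    where
                      a<i : toℕ a < toℕ i
                      a<i = ≺⇒< (outgrowsˡ (sym (p⇒≈ e)) (below-b jd))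
                  ... | inj₂ _ | inj₁ a′<i = resp (trans (∙-congˡ (p⇒≈ e′)) (y⁻¹∙y∙x (s i) b))
                        (mul (inv (gen (here refl))) (mul (go a′ (rec a′<i) (<⇒≤ ja′)) (go d′ (rec d′<i) (<⇒≤ jd′))))
                    where
                      d′<i : toℕ d′ < toℕ i
                      d′<i = ≺⇒< (outgrowsʳ (sym (p⇒≈ e′)) (below-b ja′))
                  ... | inj₂ d≥i | inj₂ a′≥i = ⊥-elim (≺-irrefl refl
                        (≼-≺-trans (≼-trans (≼-reflexive (sym (p⇒≈ e))) (∙-mono (below-c ja) (desc≼ d≥i)))
                        (≺-≼-trans (∙-strictʳ (s i) (desc j<c))
                        (≼-trans (≼-reflexive (sym (p⇒≈ e′))) (∙-mono (desc≼ a′≥i) (proj₁ (below-b jd′)))))))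

    at : ∀ {j} → j < k → ∃ λ i → toℕ i ≡ j
    at lt = fromℕ< lt , F.toℕ-fromℕ< lt

    j<k : ∀ j l → j + suc l ≡ k → j < k
    j<k j l e = ≤-trans (s≤s (ℕP.m≤m+n j l)) (≤-reflexive (≡.trans (≡.sym (ℕP.+-suc j l)) e))

    next : ∀ j l → j + suc l ≡ k → suc j + l ≡ k
    next j l e = ≡.trans (≡.sym (ℕP.+-suc j l)) e

    lowerBound : ∀ l {j} → j + suc l ≡ k → 2 * suc l ≤ card (Q j) + 1
    lowerBound zero {j} e with at (j<k j 0 e)
    ... | jb , ≡.refl = ℕP.+-monoˡ-≤ 1 (card-≥1 (Q (toℕ jb)) (jb , ≤-refl , jb , ≤-refl , ≡.refl))
    lowerBound (suc l) {j} e with at (j<k j (suc l) e) | at (j<k (suc j) l (next j (suc l) e))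
    ... | jb , ≡.refl | jc , jc≡ = lin≤ (l ∷ card (Q (toℕ jb)) ∷ card (Q (suc (toℕ jb))) ∷ []) (2 ⊗ s⁺ (s⁺ (# 0))) (# 1 ⊕ K 1)
          ((1 · 2 ⊗ s⁺ (# 0) ≼ # 2 ⊕ K 1) ∷ (1 · # 2 ⊕ K 2 ≼ # 1) ∷ []) (lowerBound l (next _ (suc l) e) , two-new jc≡ , tt)

    -- The bound 3 arises as two neighbours plus one element whose products with all smaller ones
    -- are new.
    record Generated (j : ℕ) : Set (c Level.⊔ ℓ) where
      field
        W : List (Fin k)
        W≤3 : length W ≤ 3
        W≥ : ∀ {w} → w ∈ W → j ≤ toℕ w
        spans : ∀ i → j ≤ toℕ i → ⟨_⟩ G (map s W) (s i)
        commute : ∀ i i′ → j ≤ toℕ i → j ≤ toℕ i′ → Commute (s i) (s i′)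

    ∈-map-s : ∀ {W x} → x ∈ᵍ map s W → ∃ λ w → w ∈ W × x ≈ s w
    ∈-map-s {w ∷ W} (here e) = w , here ≡.refl , e
    ∈-map-s {w ∷ W} (there h) = let v , v∈ , e = ∈-map-s h in v , there v∈ , e

    few⇒Generated : ∀ {jb jc} → toℕ jc ≡ suc (toℕ jb) → card (Q (toℕ jb)) ≤ card (Q (suc (toℕ jb))) + 2 → Generated (toℕ jb)
    few⇒Generated {jb} {jc} jc≡ few = record
      { W = jb ∷ jc ∷ []
      ; W≤3 = s≤s (s≤s z≤n)
      ; W≥ = λ { (here ≡.refl) → ≤-refl ; (there (here ≡.refl)) → <⇒≤ (≤-reflexive (≡.sym jc≡)) }
      ; spans = in-span
      ; commute = λ i i′ h h′ → span-abelian W-commute (in-span i h) (in-span i′ h′) }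
      where open Few {jb} {jc} jc≡ few

    module Join {jb : Fin k} (IH : Generated (suc (toℕ jb))) where
      open Generated IH
      private
        j : ℕ
        j = toℕ jb

      commute-all : (∀ i → suc j ≤ toℕ i → Commute (s jb) (s i)) → ∀ i i′ → j ≤ toℕ i → j ≤ toℕ i′ → Commute (s i) (s i′)
      commute-all h i i′ le le′ with m≤n⇒m<n∨m≡n le | m≤n⇒m<n∨m≡n le′
      ... | inj₁ lt | inj₁ lt′ = commute i i′ lt lt′
      ... | inj₁ lt | inj₂ e = trans (∙-congˡ (eq e)) (trans (sym (h i lt)) (sym (∙-congʳ (eq e))))
        where
          eq : j ≡ toℕ i′ → s i′ ≈ s jb
          eq e = reflexive (cong s (F.toℕ-injective (≡.sym e)))
      ... | inj₂ e | inj₁ lt′ = trans (∙-congʳ (eq e)) (trans (h i′ lt′) (sym (∙-congˡ (eq e))))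
        where
          eq : j ≡ toℕ i → s i ≈ s jb
          eq e = reflexive (cong s (F.toℕ-injective (≡.sym e)))
      ... | inj₂ e | inj₂ e′ = reflexive (cong₂ (λ a b → s a ∙ s b) e″ (≡.sym e″))
        where
          e″ : i ≡ i′
          e″ = F.toℕ-injective (≡.trans (≡.sym e) e′)

      fromSpan : ⟨_⟩ G (map s W) (s jb) → Generated j
      fromSpan h = record
        { W = W ; W≤3 = W≤3 ; W≥ = λ w∈ → <⇒≤ (W≥ w∈)
        ; spans = λ i le → [ spans i , (λ e → resp (reflexive (cong s (F.toℕ-injective e))) h) ]′ (m≤n⇒m<n∨m≡n le)
        ; commute = commute-all λ i lt → span-abelian (λ v∈ w∈ → let v , v∈′ , e = ∈-map-s v∈ ; w , w∈′ , f = ∈-map-s w∈ in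
            trans (∙-cong e f) (trans (commute v w (W≥ v∈′) (W≥ w∈′)) (sym (∙-cong f e)))) h (spans i lt) }

      oldProduct : ∀ {i} → suc j ≤ toℕ i → p jb i ∈ₛ Q (suc j) ⊎ p i jb ∈ₛ Q (suc j) → Generated j
      oldProduct {i} lt (inj₁ (a , ja , b , jb′ , e)) = fromSpan (resp (trans (∙-congʳ (p⇒≈ e)) (x∙y∙y⁻¹ _ _)) (mul (mul (spans a ja) (spans b jb′)) (inv (spans i lt))))
      oldProduct {i} lt (inj₂ (a , ja , b , jb′ , e)) = fromSpan (resp (trans (∙-congˡ (p⇒≈ e)) (y⁻¹∙y∙x _ _)) (mul (inv (spans i lt)) (mul (spans a ja) (spans b jb′))))

      -- The hypothesis is the least size that `lowerBound` permits, so the largest of the remaining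
      -- elements adds just two products and `Few` applies to it.
      twoGenerators : ∀ l → j + suc (suc l) ≡ k → card (Q (suc j)) + 1 ≤ 2 * suc l →
        ∃ λ W → length W ≤ 2 × (∀ {w} → w ∈ W → suc j ≤ toℕ w) × (∀ i → suc j ≤ toℕ i → ⟨_⟩ G (map s W) (s i))
      twoGenerators zero e _ with at (j<k (suc j) 0 (next j 1 e))
      ... | jc , jc≡ = jc ∷ [] , s≤s z≤n , (λ { (here ≡.refl) → ≤-reflexive (≡.sym jc≡) }) ,
              λ i lt → gen (here (reflexive (cong s (F.toℕ-injective (ℕP.≤-antisym
                (≤-pred (≤-trans (F.toℕ<n i) (≤-reflexive (≡.trans (≡.sym (next j 1 e)) (≡.trans (ℕP.+-comm (suc j) 1) (cong suc (≡.sym jc≡)))))))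
                (≤-trans (≤-reflexive jc≡) lt))))))
      twoGenerators (suc l′) e q≤ with at (j<k (suc j) (suc l′) (next j (suc (suc l′)) e)) | at (j<k (suc (suc j)) l′ (next (suc j) (suc l′) (next j (suc (suc l′)) e)))
      ... | jc , jc≡ | jd , jd≡ = jc ∷ jd ∷ [] , ≤-refl ,
              (λ { (here ≡.refl) → ≤-reflexive (≡.sym jc≡) ; (there (here ≡.refl)) → <⇒≤ (≤-reflexive (≡.sym jd≡)) }) ,
              λ i lt → Few.in-span {jc} {jd} (≡.trans jd≡ (cong suc (≡.sym jc≡))) few i (≤-trans (≤-reflexive jc≡) lt)
        where
          few : card (Q (toℕ jc)) ≤ card (Q (suc (toℕ jc))) + 2
          few = subst (λ x → card (Q x) ≤ card (Q (suc x)) + 2) (≡.sym jc≡)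
            (lin≤ (l′ ∷ card (Q (suc j)) ∷ card (Q (suc (suc j))) ∷ []) (# 1) (# 2 ⊕ K 2)
              ((1 · # 1 ⊕ K 1 ≼ 2 ⊗ s⁺ (s⁺ (# 0))) ∷ (1 · 2 ⊗ s⁺ (# 0) ≼ # 2 ⊕ K 1) ∷ []) (q≤ , lowerBound l′ (next (suc j) (suc l′) (next j (suc (suc l′)) e)) , tt))

      -- No product of s jb with a smaller element is old: then left and right multiples of s jb coincide as sets, hence in order.
      module AllNew (l : ℕ) (len : j + suc (suc l) ≡ k) (small : card (Q j) + 3 ≤ 3 * suc (suc l))
        (newˡ : ∀ {i} → suc j ≤ toℕ i → p jb i ∉ₛ Q (suc j)) (newʳ : ∀ {i} → suc j ≤ toℕ i → p i jb ∉ₛ Q (suc j)) where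

        Lₛ Rₛ : DSet n
        Lₛ .mem y = ∃ λ i → suc j ≤ toℕ i × p jb i ≡ y
        Lₛ .mem? y = F.any? λ i → (suc j ℕ.≤? toℕ i) ×-dec (p jb i F.≟ y)
        Rₛ .mem y = ∃ λ i → suc j ≤ toℕ i × p i jb ≡ y
        Rₛ .mem? y = F.any? λ i → (suc j ℕ.≤? toℕ i) ×-dec (p i jb F.≟ y)

        shifted : Fin (suc l) → Fin k
        shifted i = fromℕ< (≤-trans (ℕP.+-monoʳ-< (suc j) (F.toℕ<n i)) (≤-reflexive (next j (suc l) len)))

        toℕ-shifted : ∀ i → toℕ (shifted i) ≡ suc j + toℕ i
        toℕ-shifted i = F.toℕ-fromℕ< _

        shifted≥ : ∀ i → suc j ≤ toℕ (shifted i)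
        shifted≥ i = ≤-trans (ℕP.m≤m+n (suc j) (toℕ i)) (≤-reflexive (≡.sym (toℕ-shifted i)))

        shifted-inj : ∀ {i i′} → shifted i ≡ shifted i′ → i ≡ i′
        shifted-inj {i} {i′} e = F.toℕ-injective (ℕP.+-cancelˡ-≡ (suc j) _ _ (≡.trans (≡.sym (toℕ-shifted i)) (≡.trans (cong toℕ e) (toℕ-shifted i′))))

        l≤L : suc l ≤ card Lₛ
        l≤L = ≤-trans (≤-reflexive (≡.sym card-full)) (card-inj (fullₛ {suc l}) Lₛ (λ i → p jb (shifted i)) (λ {i} _ → shifted i , shifted≥ i , ≡.refl) (λ _ _ e → shifted-inj (p-injʳ e)))

        l≤R : suc l ≤ card Rₛ
        l≤R = ≤-trans (≤-reflexive (≡.sym card-full)) (card-inj (fullₛ {suc l}) Rₛ (λ i → p (shifted i) jb) (λ {i} _ → shifted i , shifted≥ i , ≡.refl) (λ _ _ e → shifted-inj (p-injˡ e)))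

        LR : DSet n
        LR = Lₛ ∪ₛ Rₛ

        total-count : card (Q (suc j)) + card LR + 1 ≤ card (Q j)
        total-count = lin≤ (card (Q (suc j)) ∷ card LR ∷ card (Q j) ∷ card (Q (suc j) ∪ₛ LR) ∷ card (single (p jb jb)) ∷ []) (# 0 ⊕ # 1 ⊕ K 1) (# 2)
          ((1 · # 0 ⊕ # 1 ≼ # 3) ∷ (1 · # 3 ⊕ # 4 ≼ # 2) ∷ (1 · K 1 ≼ # 4) ∷ [])
          (card-disjoint (Q (suc j)) LR (Q (suc j) ∪ₛ LR) inj₁ inj₂ (λ { q (inj₁ (i , lt , ≡.refl)) → newˡ lt q ; q (inj₂ (i , lt , ≡.refl)) → newʳ lt q }) ,
           card-disjoint (Q (suc j) ∪ₛ LR) (single (p jb jb)) (Q j)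
             (λ { (inj₁ q) → Q-mono q ; (inj₂ (inj₁ (i , lt , e))) → jb , ≤-refl , i , <⇒≤ lt , e ; (inj₂ (inj₂ (i , lt , e))) → i , <⇒≤ lt , jb , ≤-refl , e })
             (λ { ≡.refl → jb , ≤-refl , jb , ≤-refl , ≡.refl })
             (λ { (inj₁ q) ≡.refl → jj∉ q ; (inj₂ (inj₁ (i , lt , e))) ≡.refl → bigger (∙-strictˡ (s jb) (desc lt)) (≡.sym e)
                ; (inj₂ (inj₂ (i , lt , e))) ≡.refl → bigger (∙-strictʳ (s jb) (desc lt)) (≡.sym e) }) ,
           ≤-reflexive (≡.sym (card-single (p jb jb))) , tt)

        -- Of 3(l + 2) - 3 products at least 2(l + 1) - 1 are old and one is the square of s jb; l +
        -- 1 remain for left and right multiples together.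
        LR≤ : card LR ≤ suc l
        LR≤ = lin≤ (l ∷ card (Q (suc j)) ∷ card LR ∷ card (Q j) ∷ []) (# 2) (s⁺ (# 0))
          ((1 · # 1 ⊕ # 2 ⊕ K 1 ≼ # 3) ∷ (1 · # 3 ⊕ K 3 ≼ 3 ⊗ s⁺ (s⁺ (# 0))) ∷ (1 · 2 ⊗ s⁺ (# 0) ≼ # 1 ⊕ K 1) ∷ [])
          (total-count , small , lowerBound l (next j (suc l) len) , tt)

        Q≤ : card (Q (suc j)) + 1 ≤ 2 * suc l
        Q≤ = lin≤ (l ∷ card (Q (suc j)) ∷ card LR ∷ card (Q j) ∷ card Lₛ ∷ []) (# 1 ⊕ K 1) (2 ⊗ s⁺ (# 0))
          ((1 · # 1 ⊕ # 2 ⊕ K 1 ≼ # 3) ∷ (1 · # 3 ⊕ K 3 ≼ 3 ⊗ s⁺ (s⁺ (# 0))) ∷ (1 · s⁺ (# 0) ≼ # 4) ∷ (1 · # 4 ≼ # 2) ∷ [])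
          (total-count , small , l≤L , card-mono Lₛ LR inj₁ , tt)

        R⊆L : Rₛ ⊆ₛ Lₛ
        R⊆L q = ⊆-card Lₛ LR inj₁ (≤-trans LR≤ l≤L) (inj₂ q)

        L⊆R : Lₛ ⊆ₛ Rₛ
        L⊆R q = ⊆-card Rₛ LR inj₂ (≤-trans LR≤ l≤R) (inj₁ q)

        -- Let b = s jb and s_i b = b s_a. If a < i, then s_a commutes with b by induction, and
        -- cancelling gives s_a = s_i. So a ≥ i and s_i b ≼ b s_i; writing b s_i as a right multiple
        -- gives the converse.
        central : ∀ i → suc j ≤ toℕ i → Commute (s jb) (s i)
        central i = go i (<-wellFounded (toℕ i))
          where
            go : ∀ i → Acc _<_ (toℕ i) → suc j ≤ toℕ i → Commute (s jb) (s i)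
            go i (acc rec) j<i = conclude (R⊆L (i , j<i , ≡.refl)) (L⊆R (i , j<i , ≡.refl))
              where
                conclude : p i jb ∈ₛ Lₛ → p jb i ∈ₛ Rₛ → Commute (s jb) (s i)
                conclude (a , ja , e) (d , jd , f) = antisym
                  (≼-trans (≼-reflexive (sym (p⇒≈ f))) (∙-monoʳ (s jb) (desc≼ i≤d)))
                  (≼-trans (≼-reflexive (sym (p⇒≈ e))) (∙-monoˡ (s jb) (desc≼ i≤a)))
                  where
                    i≤a : toℕ i ≤ toℕ a
                    i≤a = ℕP.≮⇒≥ λ a<i → ≺-irrefl (∙-cancelʳ (s jb) _ _ (trans (sym (p⇒≈ e)) (go a (rec a<i) ja))) (desc a<i)
                    i≤d : toℕ i ≤ toℕ d
                    i≤d = ℕP.≮⇒≥ λ d<i → ≺-irrefl (∙-cancelˡ (s jb) _ _ (trans (sym (p⇒≈ f)) (sym (go d (rec d<i) jd)))) (desc d<i)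

        private
          below = twoGenerators l len Q≤

        generated : Generated j
        generated = record
          { W = jb ∷ proj₁ below ; W≤3 = s≤s (proj₁ (proj₂ below))
          ; W≥ = λ { (here ≡.refl) → ≤-refl ; (there h) → <⇒≤ (proj₁ (proj₂ (proj₂ below)) h) }
          ; spans = λ i le → [ (λ lt → span-⊆ (gen ∘ there) (proj₂ (proj₂ (proj₂ below)) i lt)) ,
                               (λ e → gen (here (reflexive (cong s (F.toℕ-injective (≡.sym e)))))) ]′ (m≤n⇒m<n∨m≡n le)
          ; commute = commute-all central }

    step : ∀ l {j} → j + suc (suc l) ≡ k → card (Q j) + 3 ≤ 3 * suc (suc l) →
      (card (Q (suc j)) + 3 ≤ 3 * suc l → Generated (suc j)) → Generated j
    step l {j} e h IH with at (j<k j (suc l) e) | at (j<k (suc j) l (next j (suc l) e))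
    ... | jb , ≡.refl | jc , jc≡ with ≤-<-connex (card (Q (suc (toℕ jb))) + 3) (3 * suc l)
    -- Now |Q j| ≤ 3l + 3 and |Q (j + 1)| ≥ 3l + 1, so at most two products are new.
    ...   | inj₂ gt = few⇒Generated jc≡ (lin≤ (card (Q (toℕ jb)) ∷ card (Q (suc (toℕ jb))) ∷ l ∷ []) (# 0) (# 1 ⊕ K 2)
              ((1 · # 0 ⊕ K 3 ≼ 3 ⊗ s⁺ (s⁺ (# 2))) ∷ (1 · s⁺ (3 ⊗ s⁺ (# 2)) ≼ # 1 ⊕ K 3) ∷ []) (h , gt , tt))
    ...   | inj₁ le with F.any? (λ i → (suc (toℕ jb) ℕ.≤? toℕ i) ×-dec (mem? (Q (suc (toℕ jb))) (p jb i) ⊎-dec mem? (Q (suc (toℕ jb))) (p i jb)))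
    ...     | yes (i , lt , old) = Join.oldProduct (IH le) lt old
    ...     | no none = Join.AllNew.generated (IH le) l e h (λ lt q → none (_ , lt , inj₁ q)) (λ lt q → none (_ , lt , inj₂ q))

    generated : ∀ l {j} → j + l ≡ k → card (Q j) + 3 ≤ 3 * l → Generated j
    generated zero {j} e h = ⊥-elim (lin⊥ (card (Q j) ∷ []) ((1 · # 0 ⊕ K 3 ≼ K 0) ∷ []) (h , tt))
    generated (suc zero) {j} e h = ⊥-elim (lin⊥ (card (Q j) ∷ []) ((1 · # 0 ⊕ K 3 ≼ K 3) ∷ (1 · K 2 ≼ # 0 ⊕ K 1) ∷ []) (h , lowerBound zero e , tt))
    generated (suc (suc l)) {j} e h = step l e h (generated (suc l) (next j (suc l) e))

-- Passage between the group and the integer model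

module SmallDoublingTheorem {c ℓ ℓ₂ : Level} (G : Group c ℓ) (_≤ᴳ_ : Rel (Group.Carrier G) ℓ₂) (ord : IsGroupOrder G _≤ᴳ_) where
  open Group G renaming (Carrier to A)
  open IsGroupOrder ord
  open import Relation.Binary.Structures using (IsTotalOrder)
  open IsTotalOrder isTotalOrder using (total; antisym) renaming (refl to ≼-refl)
  open import Data.Fin using (zero; suc)
  open import Data.List.Relation.Binary.Permutation.Propositional using (_↭_; ↭-refl; ↭-sym; ↭-trans; prep; swap)
  open import Data.List.Relation.Binary.Permutation.Propositional.Properties using (All-resp-↭; Any-resp-↭; ↭-length)
  open import Data.List.Membership.Setoid setoid using () renaming (_∈_ to _∈ᵍ_)
  open LinearArithmetic
  open FiniteSets using (pigeonhole; card-mono; card-full; fullₛ)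
  open IntegerSets using (BiAP; module BiAP; InAP; Small)
  open IntegerTheorem using (Dense; module Dense; denseOrBiAP)
  open OrderedGroup G _≤ᴳ_ ord

  -- `total` decides where x goes, and freshness makes the comparison strict; no decision of
  -- equality is involved.
  insert : ∀ x ys → All (λ y → ¬ x ≈ y) ys → AllPairs (λ y z → z ≺ y) ys → ∃ λ zs → AllPairs (λ y z → z ≺ y) zs × x ∷ ys ↭ zs
  insert x [] _ _ = x ∷ [] , [] ∷ [] , ↭-refl
  insert x (y ∷ ys) (x≉y ∷ fresh) (ys≺y ∷ desc) with total y x | insert x ys fresh desc
  ... | inj₁ y≼x | _ = x ∷ y ∷ ys , (y≺x ∷ All.map (λ lt → ≺-≼-trans lt y≼x) ys≺y) ∷ ys≺y ∷ desc , ↭-refl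
    where
      y≺x : y ≺ x
      y≺x = y≼x , x≉y ∘ sym
  ... | inj₂ x≼y | zs , desc′ , x∷ys↭zs = y ∷ zs , All-resp-↭ x∷ys↭zs ((x≼y , x≉y) ∷ ys≺y) ∷ desc′ , ↭-trans (swap x y ↭-refl) (prep y x∷ys↭zs)

  sort : ∀ xs → FiniteSubset G xs → ∃ λ zs → AllPairs (λ y z → z ≺ y) zs × xs ↭ zs
  sort [] _ = [] , [] , ↭-refl
  sort (x ∷ xs) (fresh ∷ u) with sort xs u
  ... | ys , desc , xs↭ys with insert x ys (All-resp-↭ xs↭ys fresh) desc
  ...   | zs , desc′ , x∷ys↭zs = zs , desc′ , ↭-trans (prep x xs↭ys) x∷ys↭zs

  record Enumeration (S : List A) : Set (c Level.⊔ ℓ Level.⊔ ℓ₂) where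
    field
      k : ℕ
      k≡ : k ≡ length S
      s : Fin k → A
      descending : ∀ {i j} → toℕ i < toℕ j → s j ≺ s i
      s∈ : ∀ i → s i ∈ᵍ S
      onto : ∀ {x} → x ∈ᵍ S → ∃ λ i → x ≈ s i

  lookup-descending : ∀ {xs} → AllPairs (λ y z → z ≺ y) xs → ∀ {i j} → toℕ i < toℕ j → lookup xs j ≺ lookup xs i
  lookup-descending (below ∷ _) {zero} {suc j} _ = All.lookup below (∈-lookup j)
  lookup-descending (_ ∷ desc) {suc i} {suc j} (s≤s lt) = lookup-descending desc lt

  enumerate : ∀ S → FiniteSubset G S → Enumeration S
  enumerate S u with sort S u
  ... | zs , desc , S↭zs = record
    { k = length zs
    ; k≡ = ≡.sym (↭-length S↭zs)
    ; s = lookup zs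
    ; descending = lookup-descending desc
    ; s∈ = λ i → Any-resp-↭ (↭-sym S↭zs) (Any.map reflexive (∈-lookup i))
    ; onto = λ x∈ → let x∈′ = Any-resp-↭ S↭zs x∈ in Any.index x∈′ , AnyP.lookup-index x∈′ }

  unique-lookup : ∀ {xs} → FiniteSubset G xs → ∀ i j → lookup xs i ≈ lookup xs j → i ≡ j
  unique-lookup (_ ∷ _) zero zero _ = ≡.refl
  unique-lookup (fresh ∷ _) zero (suc j) e = ⊥-elim (All.lookup fresh (∈-lookup j) e)
  unique-lookup (fresh ∷ _) (suc i) zero e = ⊥-elim (All.lookup fresh (∈-lookup i) (sym e))
  unique-lookup (_ ∷ u) (suc i) (suc j) e = cong suc (unique-lookup u i j e)

  pow-above : ∀ {z} → ε ≼ z → ∀ n → ε ≼ pow G z n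
  pow-above h zero = ≼-refl
  pow-above h (suc n) = ≼-resp (identityʳ ε) refl (∙-mono (pow-above h n) h)

  pow-below : ∀ {z} → z ≼ ε → ∀ n → pow G z n ≼ ε
  pow-below h zero = ≼-refl
  pow-below h (suc n) = ≼-resp refl (identityʳ ε) (∙-mono (pow-below h n) h)

  -- If ε ≼ z, then the n-th power is above ε as well, so z is below the next power, which is ε. The
  -- other side is symmetric.
  pow-torsionFree : ∀ n {z} → pow G z (suc n) ≈ ε → z ≈ ε
  pow-torsionFree n {z} e = [ above , below ]′ (total ε z)
    where
      above : ε ≼ z → z ≈ ε
      above h = antisym (≼-resp (identityˡ z) e (∙-monoʳ z (pow-above h n))) h
      below : z ≼ ε → z ≈ ε
      below h = antisym h (≼-resp e (identityˡ z) (∙-monoʳ z (pow-below h n)))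

  module Spanned (S : List A) (commutes : ∀ {x y} → ⟨_⟩ G S x → ⟨_⟩ G S y → x ∙ y ≈ y ∙ x) where

    spanGroup : AbelianGroup (c Level.⊔ ℓ) ℓ
    spanGroup = record
      { Carrier = ∃ (⟨_⟩ G S)
      ; _≈_ = λ x y → proj₁ x ≈ proj₁ y
      ; _∙_ = λ (x , p) (y , q) → x ∙ y , mul p q
      ; ε = ε , one
      ; _⁻¹ = λ (x , p) → x ⁻¹ , inv p
      ; isAbelianGroup = record
        { isGroup = record
          { isMonoid = record
            { isSemigroup = record
              { isMagma = record { isEquivalence = record { refl = refl ; sym = sym ; trans = trans } ; ∙-cong = ∙-cong }
              ; assoc = λ x y z → assoc _ _ _ }
            ; identity = (λ x → identityˡ _) , λ x → identityʳ _ }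
          ; inverse = (λ x → inverseˡ _) , λ x → inverseʳ _
          ; ⁻¹-cong = ⁻¹-cong }
        ; comm = λ (_ , p) (_ , q) → commutes p q } }

    open import Algebra.Properties.CommutativeMonoid.Mult (AbelianGroup.commutativeMonoid spanGroup) using () renaming (_×_ to _×ⁿ_) public

    multiple≈pow : ∀ n x → proj₁ (n ×ⁿ x) ≈ pow G (proj₁ x) n
    multiple≈pow zero x = refl
    multiple≈pow (suc n) x = trans (commutes (proj₂ x) (proj₂ (n ×ⁿ x))) (∙-congʳ (multiple≈pow n x))

  module SmallSquare (S : List A) (enumeration : Enumeration S) (ys : List A) (unique : FiniteSubset G ys)
    (square : ∀ {z} → InSq G S z → z ∈ᵍ ys) (small : length ys + 3 ≤ 3 * length S) where

    open Enumeration enumeration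

    n : ℕ
    n = length ys

    small′ : n + 3 ≤ 3 * k
    small′ = subst (λ m → n + 3 ≤ 3 * m) (≡.sym k≡) small

    abstract
      -- The position of the product in the list of S². It stays opaque because only equality of
      -- positions matters.
      p : Fin k → Fin k → Fin n
      p i j = Any.index (square {s i ∙ s j} (s i , s j , s∈ i , s∈ j , refl))

      p-correct : ∀ i j → s i ∙ s j ≈ lookup ys (p i j)
      p-correct i j = AnyP.lookup-index (square {s i ∙ s j} (s i , s j , s∈ i , s∈ j , refl))

    p⇒≈ : ∀ {i j x y} → p i j ≡ p x y → s i ∙ s j ≈ s x ∙ s y
    p⇒≈ {i} {j} {x} {y} e = trans (p-correct i j) (trans (reflexive (cong (lookup ys) e)) (sym (p-correct x y)))

    ≈⇒p : ∀ {i j x y} → s i ∙ s j ≈ s x ∙ s y → p i j ≡ p x y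
    ≈⇒p {i} {j} {x} {y} e = unique-lookup unique _ _ (trans (sym (p-correct i j)) (trans e (p-correct x y)))

    open Descending s descending p p⇒≈ ≈⇒p using (Q; p-injʳ; module Generated; generated; ∈-map-s)

    open Generated (generated k {0} ≡.refl (ℕP.≤-trans (ℕP.+-monoˡ-≤ 3 (ℕP.≤-trans (card-mono (Q 0) fullₛ (λ _ → tt)) (ℕP.≤-reflexive card-full))) small′))

    abelian : AbelianSpan G S
    abelian x y p q = span-abelian generators p q
      where
        generators : ∀ {v w} → v ∈ᵍ S → w ∈ᵍ S → Commute v w
        generators v∈ w∈ with onto v∈ | onto w∈
        ... | i , e | j , f = trans (∙-cong e f) (trans (commute i j z≤n z≤n) (sym (∙-cong f e)))

    threeGenerators : GeneratedByAtMost G 3 S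
    threeGenerators = map s W , ℕP.≤-trans (ℕP.≤-reflexive (length-map s W)) W≤3 , λ g →
      span-⊆ (λ x∈ → let i , e = onto x∈ in resp (sym e) (spans i z≤n)) ,
      span-⊆ (λ w∈ → let w , _ , e = ∈-map-s w∈ in resp (sym e) (gen (s∈ w)))

    open Spanned S (λ {x} {y} → abelian x y)

    σ : Fin k → AbelianGroup.Carrier spanGroup
    σ i = s i , gen (s∈ i)

    module M = FreimanModel spanGroup

    products? : ∀ i j l h → Dec (s i ∙ s j ≈ s l ∙ s h)
    products? i j l h = map′ p⇒≈ ≈⇒p (p i j F.≟ p l h)

    torsionFree : ∀ m {z} → proj₁ (suc m ×ⁿ z) ≈ ε → proj₁ z ≈ ε
    torsionFree m {z} e = pow-torsionFree m (trans (sym (multiple≈pow (suc m) z)) e)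

    module Progressions (k≥11 : 11 ≤ k) (model : M.IntegerModel torsionFree σ products? (2 * k)) where

      open M.IntegerModel model

      1≤2k : 1 ≤ 2 * k
      1≤2k = lin≤ (k ∷ []) (K 1) (2 ⊗ # 0) ((2 · K 11 ≼ # 0) ∷ []) (k≥11 , tt)

      bs : List ℕ
      bs = tabulate b

      length-bs : length bs ≡ k
      length-bs = length-tabulate b

      indexOf : ∀ {v} → v ∈ bs → ∃ λ i → v ≡ b i
      indexOf = ∈-tabulate⁻

      s-injective : ∀ {i j} → s i ≈ s j → i ≡ j
      s-injective {i} {j} e = p-injʳ {i} (≈⇒p (∙-congˡ e))

      -- Exponent 0 in a progression: equal numbers come from equal group elements.
      b-injective : ∀ {i j} → b i ≡ b j → i ≡ j
      b-injective {i} {j} e = s-injective (trans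
        (progression {0} {0} {i} {j} {i} {i} 1≤2k z≤n (≡.sym (ℕP.+-identityʳ (b i))) (≡.trans e (≡.sym (ℕP.+-identityʳ (b j)))))
        (identityʳ (s j)))

      -- By `forward` the position of a product determines the sum of the two numbers, so `bs` has
      -- at most |S²| sums.
      bs-small : Small bs
      bs-small zs (zs! , sums) = subst (λ m → length zs + 3 ≤ 3 * m) (≡.sym length-bs) (ℕP.≤-trans (ℕP.+-monoˡ-≤ 3 zs≤n) small′)
        where
          zs≤n : length zs ≤ n
          zs≤n = ℕP.≤-trans
            (pigeonhole (λ z y → ∃ λ i → ∃ λ j → z ≡ b i + b j × p i j ≡ y) zs (allFin n) zs!
              (λ z∈ → let _ , _ , x∈ , y∈ , e = sums z∈ ; i , x≡ = indexOf x∈ ; j , y≡ = indexOf y∈ in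
                p i j , ∈-allFin (p i j) , i , j , ≡.trans e (cong₂ _+_ x≡ y≡) , ≡.refl)
              (λ { _ _ (i , j , e , f) (i′ , j′ , e′ , f′) → ≡.trans e (≡.trans (forward {i} {j} {i′} {j′} (p⇒≈ (≡.trans f (≡.sym f′)))) (≡.sym e′)) }))
            (ℕP.≤-reflexive (length-tabulate {n = n} id))

      ratioOf : Fin k → Fin k → AbelianGroup.Carrier spanGroup
      ratioOf i j = AbelianGroup._∙_ spanGroup (σ j) (AbelianGroup._⁻¹ spanGroup (σ i))

      inProgression : ∀ {m τ x u i j} → m ≤ 2 * k → b j ≡ b i + τ → b x ≡ b u + m * τ → s x ≈ s u ∙ pow G (proj₁ (ratioOf i j)) m
      inProgression {m} {τ} {x} {u} {i} {j} m≤ ej ex = trans (progression {m} {τ} {x} {u} {i} {j} 1≤2k m≤ ej ex) (∙-congˡ (multiple≈pow m (ratioOf i j)))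

      dense⇒GP : Dense bs → SubsetOfGP G S
      dense⇒GP d = conclude (zeroAt (fromℕ< {0} (ℕP.≤-trans (s≤s z≤n) k≥11))) (indexOf (d .a∈)) (indexOf (d .a+g∈))
        where
          open Dense
          conclude : (∃ λ o → b o ≡ 0) → (∃ λ i → d .a ≡ b i) → (∃ λ j → d .a + d .g ≡ b j) → SubsetOfGP G S
          -- The element numbered 0 is the first term, and indices up to 2k - 2 give length 2k - 1.
          conclude (o , bo≡0) (i , ei) (j , ej) = s o , proj₁ t , 2 * k ∸ 1 , abelian _ _ (gen (s∈ o)) (proj₂ t) ,
            lin≤ (k ∷ 2 * k ∸ 1 ∷ []) (K 1) (# 1) ((1 · 2 ⊗ # 0 ≼ # 1 ⊕ K 1) ∷ (2 · K 11 ≼ # 0) ∷ []) (ℕP.≤-reflexive (≡.sym 2k-1) , k≥11 , tt) ,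
            ℕP.≤-reflexive (≡.trans 2k-1 (cong (2 *_) k≡)) ,
            λ x x∈ → let l , x≈ = onto x∈ in member x≈ (d .index (∈-tabulate⁺ {f = b} l))
            where
              t = ratioOf i j
              2k-1 : 2 * k ∸ 1 + 1 ≡ 2 * k
              2k-1 = ℕP.m∸n+n≡m 1≤2k
              member : ∀ {x l} → x ≈ s l → (∃ λ m → b l ≡ m * d .g × m + 2 ≤ 2 * length bs) → InGP G (s o) (proj₁ t) (2 * k ∸ 1) x
              member {x} {l} x≈ (m , e , m+2≤) = m ,
                lin≤ (m ∷ k ∷ 2 * k ∸ 1 ∷ []) (s⁺ (# 0)) (# 2) ((1 · # 0 ⊕ K 2 ≼ 2 ⊗ # 1) ∷ (1 · 2 ⊗ # 1 ≼ # 2 ⊕ K 1) ∷ []) (m+2≤2k , ℕP.≤-reflexive (≡.sym 2k-1) , tt) ,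
                trans x≈ (inProgression {m} {d .g} {l} {o} {i} {j} (ℕP.≤-trans (ℕP.m≤m+n m 2) m+2≤2k)
                  (≡.trans (≡.sym ej) (cong (_+ d .g) ei)) (≡.trans e (cong (_+ m * d .g) (≡.sym bo≡0))))
                where
                  m+2≤2k : m + 2 ≤ 2 * k
                  m+2≤2k = subst (λ w → m + 2 ≤ 2 * w) length-bs m+2≤

      biAP⇒GPs : BiAP bs → UnionOfTwoGP G S
      biAP⇒GPs d = conclude stepPair (indexOf (inside (inj₁ (start u₁ l₁>0)))) (indexOf (inside (inj₂ (start u₂ l₂>0))))
        where
          open BiAP d
          start : ∀ u {l} → 0 < l → InAP u τ l u
          start u l>0 = 0 , l>0 , ≡.sym (ℕP.+-identityʳ u)
          second : ∀ u {l} → 1 < l → InAP u τ l (u + τ)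
          second u l>1 = 1 , l>1 , cong (u +_) (≡.sym (ℕP.*-identityˡ τ))
          pair : ∀ {u} → u ∈ bs → u + τ ∈ bs → ∃ λ i → ∃ λ j → b j ≡ b i + τ
          pair u∈ u+τ∈ = let i , e = indexOf u∈ ; j , f = indexOf u+τ∈ in i , j , ≡.trans (≡.sym f) (cong (_+ τ) e)
          l₁+l₂≡k : l₁ + l₂ ≡ k
          l₁+l₂≡k = ≡.trans l₁+l₂ length-bs
          -- One of the two progressions has at least two terms, which exhibits the common difference inside bs.
          stepPair : ∃ λ i → ∃ λ j → b j ≡ b i + τ
          stepPair = [ (λ l₁>1 → pair (inside (inj₁ (start u₁ l₁>0))) (inside (inj₁ (second u₁ l₁>1)))) ,
                   (λ l₁≤1 → pair (inside (inj₂ (start u₂ l₂>0))) (inside (inj₂ (second u₂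
                     (lin≤ (l₁ ∷ l₂ ∷ k ∷ []) (K 2) (# 1) ((1 · # 0 ≼ K 1) ∷ (1 · # 2 ≼ # 0 ⊕ # 1) ∷ (1 · K 11 ≼ # 2) ∷ []) (l₁≤1 , ℕP.≤-reflexive (≡.sym l₁+l₂≡k) , k≥11 , tt)))))) ]′
                 (ℕP.<-≤-connex 1 l₁)
          conclude : (∃ λ i → ∃ λ j → b j ≡ b i + τ) → (∃ λ x → u₁ ≡ b x) → (∃ λ x → u₂ ≡ b x) → UnionOfTwoGP G S
          conclude (i , j , ij) (x₁ , e₁) (x₂ , e₂) = s x₁ , s x₂ , proj₁ t , l₁ , l₂ ,
            abelian _ _ (gen (s∈ x₁)) (proj₂ t) , abelian _ _ (gen (s∈ x₂)) (proj₂ t) , l₁>0 , l₂>0 , ≡.trans l₁+l₂≡k k≡ ,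
            λ z → (λ z∈ → let x , z≈ = onto z∈ in
                     Sum.map (toGP e₁ z≈ l₁≤2k) (toGP e₂ z≈ l₂≤2k) (cover (∈-tabulate⁺ {f = b} x))) ,
                  [ fromGP e₁ l₁≤2k (inside ∘ inj₁) , fromGP e₂ l₂≤2k (inside ∘ inj₂) ]′
            where
              t = ratioOf i j
              l₁≤2k : l₁ ≤ 2 * k
              l₁≤2k = lin≤ (l₁ ∷ l₂ ∷ k ∷ []) (# 0) (2 ⊗ # 2) ((1 · # 0 ⊕ # 1 ≼ # 2) ∷ []) (ℕP.≤-reflexive l₁+l₂≡k , tt)
              l₂≤2k : l₂ ≤ 2 * k
              l₂≤2k = lin≤ (l₁ ∷ l₂ ∷ k ∷ []) (# 1) (2 ⊗ # 2) ((1 · # 0 ⊕ # 1 ≼ # 2) ∷ []) (ℕP.≤-reflexive l₁+l₂≡k , tt)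
              toGP : ∀ {u v l x z} → u ≡ b v → z ≈ s x → l ≤ 2 * k → InAP u τ l (b x) → InGP G (s v) (proj₁ t) l z
              toGP {u} {v} {l} {x} e z≈ l≤ (m , m<l , f) = m , m<l ,
                trans z≈ (inProgression {m} {τ} {x} {v} {i} {j} (ℕP.≤-trans (ℕP.<⇒≤ m<l) l≤) ij (≡.trans f (cong (_+ m * τ) e)))
              fromGP : ∀ {u v l z} → u ≡ b v → l ≤ 2 * k → (∀ {y} → InAP u τ l y → y ∈ bs) → InGP G (s v) (proj₁ t) l z → z ∈ᵍ S
              fromGP {u} {v} {l} {z} e l≤ inside′ (m , m<l , z≈) with indexOf (inside′ (m , m<l , ≡.refl))
              ... | x , f = Any.map (trans (trans z≈ (sym (inProgression {m} {τ} {x} {v} {i} {j} (ℕP.≤-trans (ℕP.<⇒≤ m<l) l≤) ij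
                  (≡.trans (≡.sym f) (cong (_+ m * τ) e)))))) (s∈ x)

      progressions : SubsetOfGP G S ⊎ UnionOfTwoGP G S
      progressions = Sum.map dense⇒GP biAP⇒GPs (denseOrBiAP bs (U.tabulate⁺ b-injective) zero∈ bs-small (ℕP.≤-trans k≥11 (ℕP.≤-reflexive (≡.sym length-bs))))
        where
          zero∈ : 0 ∈ bs
          zero∈ with zeroAt (fromℕ< {0} (ℕP.≤-trans (s≤s z≤n) k≥11))
          ... | o , e = subst (_∈ bs) e (∈-tabulate⁺ {f = b} o)

    conclusion : AbelianSpan G S × GeneratedByAtMost G 3 S × (11 ≤ length S → SubsetOfGP G S ⊎ UnionOfTwoGP G S)
    conclusion = abelian , threeGenerators , λ big →
      -- The weight 2k covers every exponent read back: at most 2k - 2 in the dense case, less than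
      -- k for two progressions.
      Progressions.progressions (ℕP.≤-trans big (ℕP.≤-reflexive (≡.sym k≡))) (M.integerModel torsionFree σ products? (2 * k))

theorem2p1 : ∀ {c ℓ ℓ₂ : Level} (G : Group c ℓ) (_≼_ : Rel (Group.Carrier G) ℓ₂) →
    IsGroupOrder G _≼_ →
    (S : List (Group.Carrier G)) → FiniteSubset G S →
    SmallDoubling G S →
    AbelianSpan G S × GeneratedByAtMost G 3 S ×
    (11 ≤ length S → SubsetOfGP G S ⊎ UnionOfTwoGP G S)
theorem2p1 G _≼_ ord S unique (_ , (ys , ys-unique , square , ≡.refl) , small) =
  SmallSquare.conclusion S (enumerate S unique) ys ys-unique (λ {z} → proj₂ (square z)) small
  where open SmallDoublingTheorem G _≼_ ord
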